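{- Let $T$ be a binary tree on $n\geq 12$ vertices. Let $l$ be the smallest positive odd integer such that $f_{T_{rg}^{l}}(r)>3\times 2^{\frac{n-l-1}{2}}-2$, where $r$ denotes the root of the rooted binary tree $T_{rg}^{l}$. Write $\alpha=d_{T_{rg}^{n,l}}\big(C_d(T_{rg}^{n,l}),S_c(T_{rg}^{n,l})\big)$. Then $$d_T(C_d(T),S_c(T))\leq\begin{cases}\alpha & \text{if } \alpha\geq 1,\\ 1 & \text{otherwise.}\end{cases}$$
   Context: All graphs are finite, simple, connected and undirected. A pendant vertex is a vertex of degree $1$. A binary tree is a tree in which every non-pendant vertex has degree $3$ (so its number of vertices is even). Centroid and subtree core: a subtree of $T$ is a (nonempty) connected subgraph of $T$. A branch at $v\in V(T)$ is a maximal subtree of $T$ containing $v$ as a pendant vertex; the weight of $v$ is the maximum number of edges in a branch at $v$; the centroid $C_d(T)$ is the set of vertices of minimum weight. $f_T(v)$ is the number of subtrees of $T$ containing $v$; the subtree core $S_c(T)$ is the set of vertices $v$ for which $f_T(v)$ is maximum. For $X,Y\subseteq V(T)$, $d_T(X,Y)=\min\{d_T(x,y):x\in X,y\in Y\}$. The eccentricity of $v$ is $\max_u d_T(u,v)$. Rooted binary trees: a rooted binary tree is a rooted tree whose root has degree $2$ and in which every other vertex has degree $1$ or $3$; the single-vertex rooted tree is also allowed. The height (level) of a vertex is its distance to the root. A rooted binary tree is ordered if the vertices of each level $l\ge 1$ are linearly ordered so that two vertices at level $l+1$ with different parents are ordered as their parents are at level $l$. A rooted binary tree is rgood if (i) the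 heights of any two of its pendant vertices differ by at most $1$, and (ii) it can be ordered so that the parents of the pendant vertices at the highest level form a final segment in the ordering of the vertices at the next-to-highest level. For each odd $l$ there is, up to isomorphism, exactly one rgood binary tree on $l$ vertices, denoted $T_{rg}^l$. Crg trees: a binary caterpillar is a binary tree having a path such that every vertex not on the path is adjacent to a vertex of the path. For even $n\ge 4$ and odd $l$ with $3\le l<n$, the crg tree $T_{rg}^{n,l}$ is the tree on $n$ vertices obtained by identifying the root of $T_{rg}^l$ with a vertex of maximum eccentricity of a binary caterpillar on $n-l+1$ vertices. -}

module Defs where

open import Data.Fin using (Fin)
import Data.Fin.Properties as Finₚ
open import Data.Fin.Subset using (Subset; _∈_; _⊆_; Nonempty; ∣_∣; inside; outside)
open import Data.Fin.Subset.Properties using (_∈?_; _⊆?_; nonempty?)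
open import Data.List using (List; []; _∷_; [_]; _∷ʳ_; allFin; upTo; map; filter; length; cartesianProduct; cartesianProductWith)
open import Data.List.Extrema.Nat using (max; min)
open import Data.List.Membership.Propositional using () renaming (_∈_ to _∈ˡ_; _∉_ to _∉ˡ_)
open import Data.List.Membership.Propositional.Properties using (∈-allFin; ∈-cartesianProductWith⁺)
open import Data.List.Relation.Unary.All using (all?; tabulate; lookup)
open import Data.List.Relation.Unary.Any using (here; there)
open import Data.List.Relation.Unary.Linked using (Linked)
open import Data.List.Relation.Unary.Unique.Propositional using (Unique)
open import Data.Nat using (ℕ; zero; suc; _+_; _*_; _∸_; _^_; _/_; _≤_; _<_; _≤?_; _≟_)
open import Data.Nat.Divisibility using (_∣_; _∤_)
open import Data.Product using (Σ; ∃-syntax; _×_; _,_; uncurry)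
open import Data.Sum using (_⊎_; inj₁; inj₂)
open import Data.Vec using (Vec; []; _∷_)
import Data.Vec as Vec
open import Function using (_⇔_; Injective)
open import Level using (0ℓ)
open import Relation.Binary using (Rel; Symmetric; Irreflexive; Decidable; Tri)
open import Relation.Binary.Construct.Closure.ReflexiveTransitive using (Star; ε; _◅_; _◅◅_)
open import Relation.Binary.PropositionalEquality using (_≡_; _≢_; refl)
open import Relation.Nullary using (¬_; Dec)
open import Relation.Nullary.Decidable using (map′; _×-dec_; _⊎-dec_; _→-dec_)
open import Relation.Unary using (Pred) renaming (Decidable to Decidable₁)

private
  variable
    m n l : ℕ

module _ {R : Rel (Fin n) 0ℓ} where

  -- Reachability through interior vertices from the given list only (the
  -- Floyd–Warshall recursion); used to decide Star R.
  Via : List (Fin n) → Rel (Fin n) 0ℓ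
  Via []       u v = u ≡ v ⊎ R u v
  Via (x ∷ xs) u v = Via xs u v ⊎ (Via xs u x × Via xs x v)

  via? : Decidable R → ∀ xs → Decidable (Via xs)
  via? R? []       u v = u Finₚ.≟ v ⊎-dec R? u v
  via? R? (x ∷ xs) u v = via? R? xs u v ⊎-dec (via? R? xs u x ×-dec via? R? xs x v)

  via⇒star : ∀ xs {u v} → Via xs u v → Star R u v
  via⇒star []       (inj₁ refl)    = ε
  via⇒star []       (inj₂ r)       = r ◅ ε
  via⇒star (x ∷ xs) (inj₁ p)       = via⇒star xs p
  via⇒star (x ∷ xs) (inj₂ (p , q)) = via⇒star xs p ◅◅ via⇒star xs q

  via-refl : ∀ xs {u} → Via xs u u
  via-refl []       = inj₁ refl
  via-refl (x ∷ xs) = inj₁ (via-refl xs)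

  via-edge : ∀ xs {u v} → R u v → Via xs u v
  via-edge []       r = inj₂ r
  via-edge (x ∷ xs) r = inj₁ (via-edge xs r)

  via-trans : ∀ {xs u w v} → w ∈ˡ xs → Via xs u w → Via xs w v → Via xs u v
  via-trans (here refl) (inj₁ p)       (inj₁ q)       = inj₂ (p , q)
  via-trans (here refl) (inj₁ p)       (inj₂ (_ , q)) = inj₂ (p , q)
  via-trans (here refl) (inj₂ (p , _)) (inj₁ q)       = inj₂ (p , q)
  via-trans (here refl) (inj₂ (p , _)) (inj₂ (_ , q)) = inj₂ (p , q)
  via-trans (there w∈)  (inj₁ p)       (inj₁ q)       = inj₁ (via-trans w∈ p q)
  via-trans (there w∈)  (inj₁ p)       (inj₂ (q , s)) = inj₂ (via-trans w∈ p q , s)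
  via-trans (there w∈)  (inj₂ (p , q)) (inj₁ s)       = inj₂ (p , via-trans w∈ q s)
  via-trans (there w∈)  (inj₂ (p , _)) (inj₂ (_ , s)) = inj₂ (p , s)

  star⇒via : ∀ {u v} → Star R u v → Via (allFin n) u v
  star⇒via ε        = via-refl (allFin n)
  star⇒via (r ◅ rs) = via-trans (∈-allFin _) (via-edge (allFin n) r) (star⇒via rs)

  star? : Decidable R → Decidable (Star R)
  star? R? u v = map′ (via⇒star (allFin n)) star⇒via (via? R? (allFin n) u v)

record Graph (n : ℕ) : Set₁ where
  field
    _~_      : Rel (Fin n) 0ℓ
    ~-sym    : Symmetric _~_
    ~-irrefl : Irreflexive _≡_ _~_
    _~?_     : Decidable _~_

module _ (G : Graph n) where
  open Graph G

  degree : Fin n → ℕ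
  degree v = length (filter (v ~?_) (allFin n))

  Pendant : Fin n → Set
  Pendant v = degree v ≡ 1

  Connected : Set
  Connected = ∀ u v → Star _~_ u v

  IsPath : List (Fin n) → Set
  IsPath vs = Linked _~_ vs × Unique vs

  -- A cycle is a path x, y, …, z on at least three vertices whose ends
  -- are adjacent.
  Acyclic : Set
  Acyclic = ∀ x y zs z → IsPath (x ∷ y ∷ zs ∷ʳ z) → ¬ (z ~ x)

  IsTree : Set
  IsTree = 0 < n × Connected × Acyclic

  IsBinaryTree : Set
  IsBinaryTree = IsTree × (∀ v → ¬ Pendant v → degree v ≡ 3)

  IsBinaryCaterpillar : Set
  IsBinaryCaterpillar = IsBinaryTree ×
    ∃[ p ] (IsPath p × (∀ v → v ∉ˡ p → ∃[ w ] (w ∈ˡ p × v ~ w)))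

  Walk : ℕ → Rel (Fin n) 0ℓ
  Walk zero    u v = u ≡ v
  Walk (suc k) u v = ∃[ w ] (u ~ w × Walk k w v)

  walk? : ∀ k → Decidable (Walk k)
  walk? zero    u v = u Finₚ.≟ v
  walk? (suc k) u v = Finₚ.any? λ w → (u ~? w) ×-dec walk? k w v

  -- Distances in a connected graph on n vertices are < n, so in both
  -- minima below the value n is attained only if there is nothing to
  -- minimise over (no connecting walk, respectively X or Y empty).
  dist : Fin n → Fin n → ℕ
  dist u v = min n (filter (λ k → walk? k u v) (upTo n))

  setDist : {X Y : Pred (Fin n) 0ℓ} → Decidable₁ X → Decidable₁ Y → ℕ
  setDist X? Y? = min n (map (uncurry dist)
    (cartesianProduct (filter X? (allFin n)) (filter Y? (allFin n))))

  eccentricity : Fin n → ℕ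
  eccentricity v = max 0 (map (dist v) (allFin n))

  MaxEccentricity : Fin n → Set
  MaxEccentricity v = ∀ u → eccentricity u ≤ eccentricity v

-- A set of vertices together with a set of edges, the latter given by
-- the rows of its adjacency matrix.
record Subgraph (n : ℕ) : Set where
  constructor subgraph
  field
    vertices : Subset n
    rows     : Vec (Subset n) n

  nbrs : Fin n → Subset n
  nbrs = Vec.lookup rows

open Subgraph

edgeCount : Subgraph n → ℕ
edgeCount {n} H = length (filter (λ (u , v) → (u Finₚ.<? v) ×-dec (v ∈? nbrs H u))
                                 (cartesianProduct (allFin n) (allFin n)))

infix 4 _⊑_
_⊑_ : Rel (Subgraph n) 0ℓ
H ⊑ K = vertices H ⊆ vertices K × (∀ u → nbrs H u ⊆ nbrs K u)

vectors : {A : Set} → List A → ∀ n → List (Vec A n)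
vectors xs zero    = [ [] ]
vectors xs (suc n) = cartesianProductWith _∷_ xs (vectors xs n)

subsets : ∀ n → List (Subset n)
subsets = vectors (inside ∷ outside ∷ [])

-- Every subgraph is listed exactly once.
subgraphs : ∀ n → List (Subgraph n)
subgraphs n = cartesianProductWith subgraph (subsets n) (vectors (subsets n) n)

∈-vectors : {A : Set} {xs : List A} → (∀ x → x ∈ˡ xs) → (v : Vec A n) → v ∈ˡ vectors xs n
∈-vectors ∈xs []      = here refl
∈-vectors ∈xs (x ∷ v) = ∈-cartesianProductWith⁺ _∷_ (∈xs x) (∈-vectors ∈xs v)

∈-subsets : (p : Subset n) → p ∈ˡ subsets n
∈-subsets = ∈-vectors λ { inside → here refl ; outside → there (here refl) }

∈-subgraphs : (H : Subgraph n) → H ∈ˡ subgraphs n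
∈-subgraphs (subgraph V E) =
  ∈-cartesianProductWith⁺ subgraph (∈-subsets V) (∈-vectors ∈-subsets E)

∀subgraph? : {P : Pred (Subgraph n) 0ℓ} → Decidable₁ P → Dec (∀ H → P H)
∀subgraph? P? = map′ (λ ps H → lookup ps (∈-subgraphs H)) (λ p → tabulate λ {H} _ → p H)
                     (all? P? (subgraphs _))

module _ (G : Graph n) where
  open Graph G

  record IsSubtree (H : Subgraph n) : Set where
    constructor isSubtree
    field
      edges-sym : ∀ u v → v ∈ nbrs H u → u ∈ nbrs H v
      edges-V   : ∀ u v → v ∈ nbrs H u → u ∈ vertices H
      edges-G   : ∀ u v → v ∈ nbrs H u → u ~ v
      nonempty  : Nonempty (vertices H)
      connected : ∀ u v → u ∈ vertices H → v ∈ vertices H →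
                  Star (λ a b → b ∈ nbrs H a) u v

  isSubtree? : Decidable₁ IsSubtree
  isSubtree? H = map′ (λ (a , b , c , d , e) → isSubtree a b c d e)
                      (λ (isSubtree a b c d e) → a , b , c , d , e)
    ((∀₂? λ u v → (v ∈? nbrs H u) →-dec (u ∈? nbrs H v)) ×-dec
     (∀₂? λ u v → (v ∈? nbrs H u) →-dec (u ∈? vertices H)) ×-dec
     (∀₂? λ u v → (v ∈? nbrs H u) →-dec (u ~? v)) ×-dec
     nonempty? (vertices H) ×-dec
     (∀₂? λ u v → (u ∈? vertices H) →-dec ((v ∈? vertices H) →-dec
                  star? (λ a b → b ∈? nbrs H a) u v)))
    where
    ∀₂? : {R : Rel (Fin n) 0ℓ} → Decidable R → Dec (∀ u v → R u v)
    ∀₂? R? = Finₚ.all? λ u → Finₚ.all? λ v → R? u v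

  SubtreeAt : Fin n → Pred (Subgraph n) 0ℓ
  SubtreeAt v H = IsSubtree H × v ∈ vertices H

  subtreeAt? : ∀ v → Decidable₁ (SubtreeAt v)
  subtreeAt? v H = isSubtree? H ×-dec (v ∈? vertices H)

  -- f_G(v)
  subtreeCount : Fin n → ℕ
  subtreeCount v = length (filter (subtreeAt? v) (subgraphs n))

  IsCore : Pred (Fin n) 0ℓ
  IsCore v = ∀ u → subtreeCount u ≤ subtreeCount v

  core? : Decidable₁ IsCore
  core? v = Finₚ.all? λ u → subtreeCount u ≤? subtreeCount v

  PendantAt : Fin n → Pred (Subgraph n) 0ℓ
  PendantAt v H = SubtreeAt v H × ∣ nbrs H v ∣ ≡ 1

  pendantAt? : ∀ v → Decidable₁ (PendantAt v)
  pendantAt? v H = subtreeAt? v H ×-dec (∣ nbrs H v ∣ ≟ 1)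

  IsBranch : Fin n → Pred (Subgraph n) 0ℓ
  IsBranch v H = PendantAt v H × (∀ K → PendantAt v K → H ⊑ K → K ⊑ H)

  isBranch? : ∀ v → Decidable₁ (IsBranch v)
  isBranch? v H = pendantAt? v H ×-dec
    (∀subgraph? λ K → pendantAt? v K →-dec ((H ⊑? K) →-dec (K ⊑? H)))
    where
    _⊑?_ : Decidable _⊑_
    H ⊑? K = (vertices H ⊆? vertices K) ×-dec (Finₚ.all? λ u → nbrs H u ⊆? nbrs K u)

  weight : Fin n → ℕ
  weight v = max 0 (map edgeCount (filter (isBranch? v) (subgraphs n)))

  IsCentroid : Pred (Fin n) 0ℓ
  IsCentroid v = ∀ u → weight v ≤ weight u

  centroid? : Decidable₁ IsCentroid
  centroid? v = Finₚ.all? λ u → weight v ≤? weight u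

  -- d_G(C_d(G), S_c(G))
  centroidCoreDist : ℕ
  centroidCoreDist = setDist G centroid? core?

module _ (G : Graph n) (r : Fin n) where
  open Graph G

  IsRootedBinaryTree : Set
  IsRootedBinaryTree = IsTree G ×
    (n ≡ 1 ⊎ (degree G r ≡ 2 × (∀ v → v ≢ r → degree G v ≡ 1 ⊎ degree G v ≡ 3)))

  level : Fin n → ℕ
  level = dist G r

  _ParentOf_ : Rel (Fin n) 0ℓ
  p ParentOf u = p ~ u × level u ≡ suc (level p)

  -- Only comparisons between vertices of the same level matter.
  record Ordering : Set₁ where
    field
      _≺_     : Rel (Fin n) 0ℓ
      ≺-trans : ∀ {u v w} → level u ≡ level v → level v ≡ level w → u ≺ v → v ≺ w → u ≺ w
      ≺-cmp   : ∀ u v → level u ≡ level v → Tri (u ≺ v) (u ≡ v) (v ≺ u)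
      ≺-par   : ∀ {p q u v} → p ParentOf u → q ParentOf v → level u ≡ level v →
                p ≺ q → u ≺ v

  IsTopPendant : Pred (Fin n) 0ℓ
  IsTopPendant u = Pendant G u × (∀ w → level w ≤ level u)

  IsTopParent : Pred (Fin n) 0ℓ
  IsTopParent p = ∃[ u ] (p ParentOf u × IsTopPendant u)

  IsRgood : Set₁
  IsRgood = IsRootedBinaryTree
    × (∀ u v → Pendant G u → Pendant G v → level u ≤ suc (level v))
    × Σ Ordering λ O → let open Ordering O in
        ∀ p q → level p ≡ level q → p ≺ q → IsTopParent p → IsTopParent q

-- C arises from the disjoint union of A and B by identifying a with b.
record IsIdentification {k m n} (A : Graph k) (a : Fin k) (B : Graph m) (b : Fin m)
                        (C : Graph n) : Set where
  private
    module A = Graph A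
    module B = Graph B
    module C = Graph C
  field
    ι       : Fin k → Fin n
    κ       : Fin m → Fin n
    ι-inj   : Injective _≡_ _≡_ ι
    κ-inj   : Injective _≡_ _≡_ κ
    cover   : ∀ x → (∃[ s ] ι s ≡ x) ⊎ (∃[ t ] κ t ≡ x)
    glue    : ι a ≡ κ b
    meet    : ∀ s t → ι s ≡ κ t → s ≡ a × t ≡ b
    edges   : ∀ x y → (x C.~ y) ⇔
                ((∃[ s ] ∃[ s′ ] (ι s ≡ x × ι s′ ≡ y × s A.~ s′)) ⊎
                 (∃[ t ] ∃[ t′ ] (κ t ≡ x × κ t′ ≡ y × t B.~ t′)))

-- C is (a copy of) T_rg^{n,l}.
IsCrgTree : (n l : ℕ) → Graph n → Set₁
IsCrgTree n l C = 2 ∣ n × 4 ≤ n × 2 ∤ l × 3 ≤ l × l < n ×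
  Σ (Graph l) λ R → Σ (Fin l) λ r → Σ (Graph (n ∸ l + 1)) λ K → Σ (Fin (n ∸ l + 1)) λ c →
    IsRgood R r × IsBinaryCaterpillar K × MaxEccentricity K c × IsIdentification R r K c C

-- f_{T_rg^k}(r) > 3·2^((n-k-1)/2) - 2.  Truncated subtraction is
-- harmless: for k < n nothing is truncated, and for even n ≥ 4 the
-- least odd k with this property is at most n - 1.
ExceedsThreshold : ℕ → ℕ → Set₁
ExceedsThreshold n k = Σ (Graph k) λ R → Σ (Fin k) λ r →
  IsRgood R r × 3 * 2 ^ ((n ∸ k ∸ 1) / 2) ∸ 2 < subtreeCount R r

IsCriticalOrder : ℕ → ℕ → Set₁
IsCriticalOrder n l = (2 ∤ l × ExceedsThreshold n l) ×
                      (∀ k → 2 ∤ k → ExceedsThreshold n k → l ≤ k)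

{-# OPTIONS --safe #-}

-- Deleting an edge x y of a binary tree leaves two rooted binary trees; y lies in more subtrees than x
-- exactly if the tree A at x has fewer subtrees containing its root than the tree B at y, and the
-- larger of A and B contains the centroid.  Let c = v₀, …, v_d = s be a shortest path from the centroid
-- to the subtree core, and cut its last edge: then B, at s, has more root subtrees than A.  Among rooted
-- binary trees of given order, rgood trees have the most root subtrees and caterpillars the fewest,
-- namely 3·2^j − 2 on 2 j + 1 vertices; hence |B| ≥ l.  Each inner vertex of the path contributes at
-- least two further vertices, so l + 2 (d − 1) < n / 2.  In the crg tree the core lies in the rgood
-- part, and the last inequality keeps the first d vertices of the caterpillar part, counted from the
-- root of the rgood part, out of the centroid; so its centroid and core are at distance at least d.
module Submission where

open import Defs
open import Data.Bool using (if_then_else_)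
open import Data.Empty using (⊥; ⊥-elim)
open import Data.Fin using (Fin; toℕ; fromℕ<)
import Data.Fin.Properties as Finₚ
open import Data.Fin.Subset using (Subset; _∈_; _∉_; _⊆_; ∣_∣; ⁅_⁆; _-_)
open import Data.Fin.Subset.Properties using (_∈?_; ⊆-antisym; nonempty?; Empty-unique; ∣⊥∣≡0; x∈p⇒∣p-x∣<∣p∣; x∈p∧x≢y⇒x∈p-y; p⊆q⇒∣p∣≤∣q∣; x∈⁅x⁆; x∈⁅y⁆⇒x≡y; ∣⁅x⁆∣≡1)
import Data.List as List
open import Data.List using (List; []; _∷_; _++_; length; filter; allFin; map; cartesianProduct; _∷ʳ_; upTo)
open import Data.List.Extrema.Nat using (max≤v⁺; v≤max⁺; argmax; f[xs]≤f[argmax]; min≤⊤; min≤xs; v≤min⁺; argmin; f[argmin]≤f[xs])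
import Data.List.Membership.DecPropositional as DecMembership
open import Data.List.Membership.Propositional using (lose) renaming (_∈_ to _∈ˡ_; _∉_ to _∉ˡ_)
open import Data.List.Membership.Propositional.Properties using (∈-∃++; ∈-filter⁺; ∈-filter⁻; ∈-++⁺ˡ; ∈-++⁺ʳ; ∈-++⁻; ∈-cartesianProduct⁺; ∈-cartesianProduct⁻; ∈-allFin; ∈-map⁺; ∈-upTo⁺)
open import Data.List.Properties using (length-++; filter-≐; length-map; filter-some; filter-all; length-tabulate)
open import Data.List.Relation.Unary.All as All using (All; []; _∷_)
import Data.List.Relation.Unary.All.Properties as Allₚ
open import Data.List.Relation.Unary.All.Properties using (¬Any⇒All¬)
open import Data.List.Relation.Unary.AllPairs using ([]; _∷_)
open import Data.List.Relation.Unary.Any as Any using (here; there; Any)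
open import Data.List.Relation.Unary.Linked as Linked using (Linked; []; [-]; _∷_)
open import Data.List.Relation.Unary.Unique.Propositional using (Unique)
import Data.List.Relation.Unary.Unique.Propositional.Properties as Uniqueₚ
open import Data.Nat using (ℕ; zero; suc; _+_; _*_; _≤_; z≤n; s≤s; _<_; >-nonZero; _^_; _∸_; _≤?_; NonZero; _≟_; _<?_; pred; _/_; _≤ᵇ_)
open import Data.Nat.DivMod using (m*n/n≡m)
open import Data.Nat.Divisibility using (_∣_; _∤_; ∣m+n∣m⇒∣n; ∣1⇒≡1; m∣m*n)
open import Data.Nat.Induction using (<-wellFounded)
open import Data.Nat.Properties
open import Data.Nat.Tactic.RingSolver using (solve-∀)
open import Data.Product using (_×_; _,_; proj₁; proj₂; ∃-syntax; swap; uncurry)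
import Data.Sum as Sum
open import Data.Sum using (_⊎_; inj₁; inj₂; [_,_]′)
import Data.Vec as Vec
open import Data.Vec using (Vec; []; _∷_)
open import Data.Vec.Properties using (∷-injective; lookup∘tabulate; tabulate∘lookup; tabulate-cong; []=⇒lookup; lookup⇒[]=)
open import Function using (_∘_; id; mk⇔; Equivalence)
open import Induction.WellFounded using (Acc; acc)
open import Level using (0ℓ)
open import Relation.Binary using (Rel; Decidable; tri<; tri≈; tri>; Tri)
open import Relation.Binary.Construct.Closure.ReflexiveTransitive as Star using (Star; ε; _◅_; _◅◅_)
open import Relation.Binary.PropositionalEquality
open import Relation.Nullary using (¬_; Dec; yes; no; contradiction; does)
open import Relation.Nullary.Decidable using (_×-dec_; ¬?; dec-true; _⊎-dec_; map′)
open import Relation.Unary using (Pred) renaming (Decidable to Decidable₁)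

-- The two trees meet only in the condition `2 * (l + 2 * i) < n`: `centroidCoreDist-bound` extracts
-- it from T and `far` turns it into a distance in the crg tree. Nothing is lost there, because a
-- step along the spine of a caterpillar costs exactly two vertices. Minimality of l speaks of rgood
-- trees only, so using it at the order of B takes an actual rgood tree of that order: the
-- heap-ordered one. The rgood graphs behind the threshold and inside the crg tree may differ; that
-- each is maximal makes them comparable. Maximality of rgood trees is the hard part. With `value` =
-- 1 + root subtrees, a node over values x and y has value 1 + x y. Replacing both children by rgood
-- trees does not make the node rgood. So one shows first that among two rgood trees of one level,
-- with a given total of leaves, the most unbalanced pair has the largest product; children of
-- different levels are brought to that case by rotations. Acyclicity is used in the form "every
-- edge is a bridge", so that sides of edges carry the arguments about trees.

module _ {A : Set} where

  count : {P : Pred A 0ℓ} → Decidable₁ P → List A → ℕ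
  count P? xs = length (filter P? xs)

  module _ {P Q : Pred A 0ℓ} (P? : Decidable₁ P) (Q? : Decidable₁ Q) where

    count-cong : (∀ {x} → P x → Q x) → (∀ {x} → Q x → P x) → ∀ xs → count P? xs ≡ count Q? xs
    count-cong P⇒Q Q⇒P xs = cong length (filter-≐ P? Q? (P⇒Q , Q⇒P) xs)

    count-mono : (∀ {x} → P x → Q x) → ∀ xs → count P? xs ≤ count Q? xs
    count-mono P⇒Q [] = z≤n
    count-mono P⇒Q (x ∷ xs) with P? x | Q? x
    ... | yes p | yes q = s≤s (count-mono P⇒Q xs)
    ... | yes p | no ¬q = contradiction (P⇒Q p) ¬q
    ... | no ¬p | yes q = ≤-trans (count-mono P⇒Q xs) (Data.Nat.Properties.n≤1+n _)
    ... | no ¬p | no ¬q = count-mono P⇒Q xs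

  count-⊎ : {P Q R : Pred A 0ℓ} (P? : Decidable₁ P) (Q? : Decidable₁ Q) (R? : Decidable₁ R) →
            (∀ {x} → P x → Q x ⊎ R x) → (∀ {x} → Q x → P x) → (∀ {x} → R x → P x) →
            (∀ {x} → Q x → ¬ R x) →
            ∀ xs → count P? xs ≡ count Q? xs + count R? xs
  count-⊎ P? Q? R? split Q⇒P R⇒P disj [] = refl
  count-⊎ P? Q? R? split Q⇒P R⇒P disj (x ∷ xs)
    with ih ← count-⊎ P? Q? R? split Q⇒P R⇒P disj xs | P? x | Q? x | R? x
  ... | _     | yes q | yes r = contradiction r (disj q)
  ... | yes p | yes q | no ¬r = cong suc ih
  ... | yes p | no ¬q | yes r = trans (cong suc ih) (sym (+-suc _ _))
  ... | no ¬p | yes q | _     = contradiction (Q⇒P q) ¬p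
  ... | no ¬p | _     | yes r = contradiction (R⇒P r) ¬p
  ... | no ¬p | no ¬q | no ¬r = ih
  ... | yes p | no ¬q | no ¬r with split p
  ...   | inj₁ q = contradiction q ¬q
  ...   | inj₂ r = contradiction r ¬r

length-injection : {A B : Set} {xs : List A} {ys : List B} (f : A → B) → Unique xs →
                   (∀ {x} → x ∈ˡ xs → f x ∈ˡ ys) →
                   (∀ {x y} → x ∈ˡ xs → y ∈ˡ xs → f x ≡ f y → x ≡ y) →
                   length xs ≤ length ys
length-injection {xs = []} f _ _ _ = z≤n
length-injection {xs = x ∷ xs} f (x∉xs ∷ uniq) into inj with ∈-∃++ (into (here refl))
... | as , bs , refl = ≤-trans (s≤s (length-injection f uniq into′ (λ y∈ z∈ → inj (there y∈) (there z∈))))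
                               (≤-reflexive length-eq)
  where
  length-eq : suc (length (as ++ bs)) ≡ length (as ++ f x ∷ bs)
  length-eq = trans (cong suc (length-++ as)) (sym (trans (length-++ as) (+-suc _ _)))
  into′ : ∀ {y} → y ∈ˡ xs → f y ∈ˡ as ++ bs
  into′ {y} y∈ with ∈-++⁻ as (into (there y∈))
  ... | inj₁ fy∈as         = ∈-++⁺ˡ fy∈as
  ... | inj₂ (here fy≡fx)  = contradiction (sym (inj (there y∈) (here refl) fy≡fx)) (All.lookup x∉xs y∈)
  ... | inj₂ (there fy∈bs) = ∈-++⁺ʳ as fy∈bs

length-bijection : {A B : Set} {xs : List A} {ys : List B} (f : A → B) (g : B → A) →
                   Unique xs → Unique ys →
                   (∀ {x} → x ∈ˡ xs → f x ∈ˡ ys × g (f x) ≡ x) →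
                   (∀ {y} → y ∈ˡ ys → g y ∈ˡ xs × f (g y) ≡ y) →
                   length xs ≡ length ys
length-bijection f g uxs uys f-into g-into = ≤-antisym
  (length-injection f uxs (proj₁ ∘ f-into) λ x∈ y∈ eq →
    trans (sym (proj₂ (f-into x∈))) (trans (cong g eq) (proj₂ (f-into y∈))))
  (length-injection g uys (proj₁ ∘ g-into) λ x∈ y∈ eq →
    trans (sym (proj₂ (g-into x∈))) (trans (cong f eq) (proj₂ (g-into y∈))))

length-cong-∈ : {A : Set} {xs ys : List A} → Unique xs → Unique ys →
                (∀ {x} → x ∈ˡ xs → x ∈ˡ ys) → (∀ {x} → x ∈ˡ ys → x ∈ˡ xs) → length xs ≡ length ys
length-cong-∈ uxs uys to from =
  length-bijection id id uxs uys (λ x∈ → to x∈ , refl) (λ y∈ → from y∈ , refl)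

count-singleton : {A : Set} {P : Pred A 0ℓ} (P? : Decidable₁ P) {xs : List A} {x : A} →
                  Unique xs → x ∈ˡ xs → P x → (∀ {y} → P y → y ≡ x) → count P? xs ≡ 1
count-singleton P? {xs} {x} uniq x∈ px only =
  length-cong-∈ {ys = x ∷ []} (Uniqueₚ.filter⁺ P? uniq) ([] ∷ [])
    (λ y∈ → here (only (proj₂ (∈-filter⁻ P? {xs = xs} y∈))))
    (λ { (here refl) → ∈-filter⁺ P? x∈ px })

unique-vectors : {A : Set} {xs : List A} → Unique xs → ∀ n → Unique (vectors xs n)
unique-vectors uniq zero    = [] ∷ []
unique-vectors uniq (suc n) = Uniqueₚ.cartesianProductWith⁺ _∷_ ∷-injective uniq (unique-vectors uniq n)

unique-subsets : ∀ n → Unique (subsets n)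
unique-subsets = unique-vectors (((λ ()) ∷ []) ∷ [] ∷ [])

unique-subgraphs : ∀ n → Unique (subgraphs n)
unique-subgraphs n = Uniqueₚ.cartesianProductWith⁺ subgraph (λ { refl → refl , refl })
  (unique-subsets n) (unique-vectors (unique-subsets n) n)

star-preserves : {A : Set} {R : Rel A 0ℓ} (Q : Pred A 0ℓ) → (∀ {a b} → Q a → R a b → Q b) →
                 ∀ {u x} → Q u → Star R u x → Q x
star-preserves Q step q ε       = q
star-preserves Q step q (r ◅ s) = star-preserves Q step (step q r) s

-- Sides of an edge, and bridges

module _ {n : ℕ} (G : Graph n) where
  open Graph G

  OffEdge : Fin n → Fin n → Rel (Fin n) 0ℓ
  OffEdge u v a b = a ~ b × ¬ (a ≡ u × b ≡ v) × ¬ (a ≡ v × b ≡ u)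

  -- The component of v once the edge u v is deleted. The order of the arguments matters: it points
  -- from u to v.
  Side : Fin n → Fin n → Pred (Fin n) 0ℓ
  Side u v = Star (OffEdge u v) v

  side? : ∀ u v → Decidable₁ (Side u v)
  side? u v = star? (λ a b → (a ~? b) ×-dec ¬? ((a Finₚ.≟ u) ×-dec (b Finₚ.≟ v))
                                      ×-dec ¬? ((a Finₚ.≟ v) ×-dec (b Finₚ.≟ u))) v

  -- The working form of acyclicity: deleting an edge separates its ends.
  Bridged : Set
  Bridged = ∀ {u v} → u ~ v → ¬ Side u v u

  side-step : ∀ {u v a b} → Side u v a → a ~ b → Side u v b ⊎ (a ≡ v × b ≡ u)
  side-step {u} {v} {a} {b} s a~b with (a Finₚ.≟ v) ×-dec (b Finₚ.≟ u)
  ... | yes exit = inj₂ exit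
  ... | no ¬exit with (a Finₚ.≟ u) ×-dec (b Finₚ.≟ v)
  ...   | yes (_ , refl) = inj₁ ε
  ...   | no ¬enter      = inj₁ (s ◅◅ ((a~b , ¬enter , ¬exit) ◅ ε))

  -- The list A holds neighbours of v already split off, so that the product formula can be applied
  -- to one neighbour at a time; with A = u ∷ [] these are the root subtrees of the branch at v away
  -- from u.
  CountPred : List (Fin n) → Fin n → Pred (Subgraph n) 0ℓ
  CountPred A v H = SubtreeAt G v H × All (_∉ Subgraph.vertices H) A

  countPred? : ∀ A v → Decidable₁ (CountPred A v)
  countPred? A v H = subtreeAt? G v H ×-dec All.all? (λ a → ¬? (a ∈? Subgraph.vertices H)) A

  avoidingCount : List (Fin n) → Fin n → ℕ
  avoidingCount A v = count (countPred? A v) (subgraphs n)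

  subtreeCount≡avoidingCount : ∀ v → subtreeCount G v ≡ avoidingCount [] v
  subtreeCount≡avoidingCount v =
    count-cong (subtreeAt? G v) (countPred? [] v) (λ p → p , []) proj₁ (subgraphs n)

module Sides {n : ℕ} (G : Graph n) (conn : Connected G) (bridged : Bridged G) where
  open Graph G

  side-disjoint : ∀ {u v x} → u ~ v → Side G u v x → ¬ Side G v u x
  side-disjoint u~v s s′ =
    bridged u~v (s ◅◅ Star.reverse (λ (a~b , p , q) → ~-sym a~b , (λ (e , f) → p (f , e)) , (λ (e , f) → q (f , e))) s′)

  side-total : ∀ u v x → Side G u v x ⊎ Side G v u x
  side-total u v x = star-preserves (λ x → Side G u v x ⊎ Side G v u x) step (inj₁ ε) (conn v x)
    where
    step : ∀ {a b} → Side G u v a ⊎ Side G v u a → a ~ b → Side G u v b ⊎ Side G v u b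
    step (inj₁ s) a~b with side-step G s a~b
    ... | inj₁ s′         = inj₁ s′
    ... | inj₂ (_ , refl) = inj₂ ε
    step (inj₂ s) a~b with side-step G s a~b
    ... | inj₁ s′         = inj₂ s′
    ... | inj₂ (_ , refl) = inj₁ ε

  side-complement : ∀ {u v x} → ¬ Side G u v x → Side G v u x
  side-complement {u} {v} {x} ¬s with side-total u v x
  ... | inj₁ s = contradiction s ¬s
  ... | inj₂ s = s

  side-split : ∀ {u v x} → Side G u v x → x ≡ v ⊎ ∃[ w ] (v ~ w × w ≢ u × Side G v w x)
  side-split {u} {v} = star-preserves Q step (inj₁ refl)
    where
    Q : Pred (Fin n) 0ℓ
    Q x = x ≡ v ⊎ ∃[ w ] (v ~ w × w ≢ u × Side G v w x)
    step : ∀ {a b} → Q a → OffEdge G u v a b → Q b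
    step (inj₁ refl) (a~b , _ , ¬exit) = inj₂ (_ , a~b , (λ b≡u → ¬exit (refl , b≡u)) , ε)
    step (inj₂ (w , v~w , w≢u , s)) (a~b , _) with side-step G s a~b
    ... | inj₁ s′        = inj₂ (w , v~w , w≢u , s′)
    ... | inj₂ (_ , b≡v) = inj₁ b≡v

  side-child : ∀ {u v w x} → u ~ v → v ~ w → w ≢ u → Side G v w x → Side G u v x
  side-child {u} {v} {w} u~v v~w w≢u =
    proj₂ ∘ star-preserves (λ x → Side G v w x × Side G u v x) step
      (ε , (v~w , (λ (v≡u , _) → ~-irrefl (sym v≡u) u~v) , λ (_ , w≡u) → w≢u w≡u) ◅ ε)
    where
    step : ∀ {a b} → Side G v w a × Side G u v a → OffEdge G v w a b → Side G v w b × Side G u v b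
    step (s , s′) r with side-step G s′ (proj₁ r)
    ... | inj₁ s″         = s ◅◅ (r ◅ ε) , s″
    ... | inj₂ (refl , _) = contradiction s (bridged v~w)

  sibling-sides-disjoint : ∀ {v w₁ w₂ x} → v ~ w₁ → v ~ w₂ → w₁ ≢ w₂ → Side G v w₁ x → ¬ Side G v w₂ x
  sibling-sides-disjoint v~w₁ v~w₂ w₁≢w₂ s₁ s₂ =
    side-disjoint v~w₁ s₁ (side-child (~-sym v~w₁) v~w₂ (w₁≢w₂ ∘ sym) s₂)

  side-toward : ∀ {z y} → z ≢ y → ∃[ w ] (z ~ w × Side G z w y)
  side-toward {z} {y} z≢y with star-preserves Q step (inj₁ refl) (conn z y)
    where
    Q : Pred (Fin n) 0ℓ
    Q x = z ≡ x ⊎ ∃[ w ] (z ~ w × Side G z w x)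
    step : ∀ {a b} → Q a → a ~ b → Q b
    step (inj₁ refl) a~b = inj₂ (_ , a~b , ε)
    step (inj₂ (w , z~w , s)) a~b with side-step G s a~b
    ... | inj₁ s′        = inj₂ (w , z~w , s′)
    ... | inj₂ (_ , b≡z) = inj₁ (sym b≡z)
  ... | inj₁ z≡y = contradiction z≡y z≢y
  ... | inj₂ r   = r

  -- The side of y is connected and misses z, so it cannot change from one branch at z to another.
  side-⊆-toward : ∀ {x y z w} → z ~ w → Side G z w y → ¬ Side G x y z →
                  ∀ {a} → Side G x y a → Side G z w a
  side-⊆-toward {x} {y} {z} {w} z~w y∈ z∉ =
    proj₂ ∘ star-preserves (λ a → Side G x y a × Side G z w a) step (ε , y∈)
    where
    step : ∀ {a b} → Side G x y a × Side G z w a → OffEdge G x y a b → Side G x y b × Side G z w b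
    step (s , s′) r with side-step G s′ (proj₁ r)
    ... | inj₁ s″         = s ◅◅ (r ◅ ε) , s″
    ... | inj₂ (_ , refl) = contradiction (s ◅◅ (r ◅ ε)) z∉

-- Subgraphs given by decidable predicates

open Subgraph

module _ {n : ℕ} where

  tabulate-∈⁺ : {P : Pred (Fin n) 0ℓ} (P? : Decidable₁ P) → ∀ {x} → P x → x ∈ Vec.tabulate (does ∘ P?)
  tabulate-∈⁺ P? {x} px =
    lookup⇒[]= x _ (trans (lookup∘tabulate _ x) (dec-true (P? x) px))

  tabulate-∈⁻ : {P : Pred (Fin n) 0ℓ} (P? : Decidable₁ P) → ∀ {x} → x ∈ Vec.tabulate (does ∘ P?) → P x
  tabulate-∈⁻ P? {x} x∈ with P? x | trans (sym (lookup∘tabulate (does ∘ P?) x)) ([]=⇒lookup x∈)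
  ... | yes px | _  = px
  ... | no _   | ()

  module _ {V : Pred (Fin n) 0ℓ} {E : Rel (Fin n) 0ℓ} (V? : Decidable₁ V) (E? : Decidable E) where

    comprehension : Subgraph n
    comprehension = subgraph (Vec.tabulate (does ∘ V?)) (Vec.tabulate λ u → Vec.tabulate (does ∘ E? u))

    ∈-vertices⁺ : ∀ {x} → V x → x ∈ vertices comprehension
    ∈-vertices⁺ = tabulate-∈⁺ V?

    ∈-vertices⁻ : ∀ {x} → x ∈ vertices comprehension → V x
    ∈-vertices⁻ = tabulate-∈⁻ V?

    ∈-nbrs⁺ : ∀ {u v} → E u v → v ∈ nbrs comprehension u
    ∈-nbrs⁺ {u} {v} e = subst (v ∈_) (sym (lookup∘tabulate _ u)) (tabulate-∈⁺ (E? u) e)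

    ∈-nbrs⁻ : ∀ {u v} → v ∈ nbrs comprehension u → E u v
    ∈-nbrs⁻ {u} {v} e = tabulate-∈⁻ (E? u) (subst (v ∈_) (lookup∘tabulate _ u) e)

  ⊑-antisym : {H K : Subgraph n} → H ⊑ K → K ⊑ H → H ≡ K
  ⊑-antisym {subgraph V E} {subgraph W F} (V⊆W , E⊆F) (W⊆V , F⊆E) =
    cong₂ subgraph (⊆-antisym V⊆W W⊆V)
      (trans (sym (tabulate∘lookup E)) (trans (tabulate-cong λ u → ⊆-antisym (E⊆F u) (F⊆E u)) (tabulate∘lookup F)))

length-cartesianProduct : {A B : Set} (xs : List A) (ys : List B) →
                          length (cartesianProduct xs ys) ≡ length xs * length ys
length-cartesianProduct []       ys = refl
length-cartesianProduct (x ∷ xs) ys =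
  trans (length-++ (List.map (x ,_) ys)) (cong₂ _+_ (length-map (x ,_) ys) (length-cartesianProduct xs ys))

-- The product formula for subtrees at an edge

module SubtreeCounting {n : ℕ} (G : Graph n) (conn : Connected G) (bridged : Bridged G) where
  open Graph G
  open Sides G conn bridged

  -- A record, so that H can be inferred from an edge.
  record Edge (H : Subgraph n) (a b : Fin n) : Set where
    constructor edge
    field ∈-nbrs : b ∈ nbrs H a

  subgraph-ext : ∀ {H K} → vertices H ⊆ vertices K → vertices K ⊆ vertices H →
                 (∀ {a b} → Edge H a b → Edge K a b) → (∀ {a b} → Edge K a b → Edge H a b) → H ≡ K
  subgraph-ext V⊆W W⊆V E⊆F F⊆E =
    ⊑-antisym (V⊆W , λ u e → Edge.∈-nbrs (E⊆F (edge e))) (W⊆V , λ u e → Edge.∈-nbrs (F⊆E (edge e)))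

  module Subtree {H : Subgraph n} (S : IsSubtree G H) where

    edge-sym : ∀ {a b} → Edge H a b → Edge H b a
    edge-sym (edge e) = edge (IsSubtree.edges-sym S _ _ e)

    edge-source : ∀ {a b} → Edge H a b → a ∈ vertices H
    edge-source (edge e) = IsSubtree.edges-V S _ _ e

    edge-target : ∀ {a b} → Edge H a b → b ∈ vertices H
    edge-target = edge-source ∘ edge-sym

    edge-~ : ∀ {a b} → Edge H a b → a ~ b
    edge-~ (edge e) = IsSubtree.edges-G S _ _ e

    edge-walk : ∀ {a b} → a ∈ vertices H → b ∈ vertices H → Star (Edge H) a b
    edge-walk a∈ b∈ = Star.map edge (IsSubtree.connected S _ _ a∈ b∈)

  open Subtree

  subtree-from-root : ∀ {H r} → (∀ {a b} → Edge H a b → Edge H b a) → (∀ {a b} → Edge H a b → a ∈ vertices H) →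
                      (∀ {a b} → Edge H a b → a ~ b) → r ∈ vertices H →
                      (∀ {x} → x ∈ vertices H → Star (Edge H) r x) → IsSubtree G H
  subtree-from-root {H} e-sym e-V e-G r∈ reach = isSubtree
    (λ a b e → Edge.∈-nbrs (e-sym (edge e)))
    (λ a b e → e-V (edge e)) (λ a b e → e-G (edge e)) (_ , r∈)
    (λ a b a∈ b∈ → Star.map Edge.∈-nbrs (Star.reverse e-sym (reach a∈) ◅◅ reach b∈))

  edge-entering : ∀ {H u v a b} → IsSubtree G H → ¬ Side G u v a → Side G u v b → Edge H a b → a ≡ u × b ≡ v
  edge-entering S a∉ b∈ e with side-step G b∈ (~-sym (edge-~ S e))
  ... | inj₁ a∈            = contradiction a∈ a∉
  ... | inj₂ (refl , refl) = refl , refl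

  crossing-edge : ∀ {H u v a b} → IsSubtree G H → a ∈ vertices H → b ∈ vertices H →
                  ¬ Side G u v a → Side G u v b → Edge H u v
  crossing-edge {H} {u} {v} S a∈H b∈H a∉ b∈ = go a∉ (edge-walk S a∈H b∈H)
    where
    go : ∀ {a} → ¬ Side G u v a → Star (Edge H) a _ → Edge H u v
    go a∉ ε = contradiction b∈ a∉
    go a∉ (_◅_ {j = c} e es) with side? G u v c
    ... | no c∉ = go c∉ es
    ... | yes c∈ with edge-entering S a∉ c∈ e
    ...   | refl , refl = e

  avoids-side : ∀ {H u v x} → SubtreeAt G u H → v ∉ vertices H → u ~ v → x ∈ vertices H → Side G v u x
  avoids-side {H} {u} {v} {x} (S , u∈) v∉ u~v x∈ = side-complement λ s →
    v∉ (edge-target S (crossing-edge S u∈ x∈ (bridged u~v) s))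

  restrict : Fin n → Fin n → Subgraph n → Subgraph n
  restrict u v H = comprehension (λ x → (x ∈? vertices H) ×-dec side? G u v x)
    (λ a b → (b ∈? nbrs H a) ×-dec side? G u v a ×-dec side? G u v b)

  join : Fin n → Fin n → Subgraph n → Subgraph n → Subgraph n
  join v w H₁ H₂ = comprehension (λ x → (x ∈? vertices H₁) ⊎-dec (x ∈? vertices H₂))
    (λ a b → ((b ∈? nbrs H₁ a) ⊎-dec (b ∈? nbrs H₂ a)) ⊎-dec
             (((a Finₚ.≟ v) ×-dec (b Finₚ.≟ w)) ⊎-dec ((a Finₚ.≟ w) ×-dec (b Finₚ.≟ v))))

  module _ {u v : Fin n} (H : Subgraph n) where
    private
      V? = λ x → (x ∈? vertices H) ×-dec side? G u v x
      E? = λ a b → (b ∈? nbrs H a) ×-dec side? G u v a ×-dec side? G u v b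

    ∈-restrict⁺ : ∀ {x} → x ∈ vertices H → Side G u v x → x ∈ vertices (restrict u v H)
    ∈-restrict⁺ x∈ s = ∈-vertices⁺ V? E? (x∈ , s)

    ∈-restrict⁻ : ∀ {x} → x ∈ vertices (restrict u v H) → x ∈ vertices H × Side G u v x
    ∈-restrict⁻ = ∈-vertices⁻ V? E?

  module _ {u v : Fin n} {H : Subgraph n} where
    private
      V? = λ x → (x ∈? vertices H) ×-dec side? G u v x
      E? = λ a b → (b ∈? nbrs H a) ×-dec side? G u v a ×-dec side? G u v b

    edge-restrict⁺ : ∀ {a b} → Edge H a b → Side G u v a → Side G u v b → Edge (restrict u v H) a b
    edge-restrict⁺ e s s′ = edge (∈-nbrs⁺ V? E? (e .Edge.∈-nbrs , s , s′))

    edge-restrict⁻ : ∀ {a b} → Edge (restrict u v H) a b → Edge H a b × Side G u v a × Side G u v b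
    edge-restrict⁻ (edge e) = let e′ , s , s′ = ∈-nbrs⁻ V? E? e in edge e′ , s , s′

  module _ (v w : Fin n) (H₁ H₂ : Subgraph n) where
    private
      V? = λ x → (x ∈? vertices H₁) ⊎-dec (x ∈? vertices H₂)
      E? = λ a b → ((b ∈? nbrs H₁ a) ⊎-dec (b ∈? nbrs H₂ a)) ⊎-dec
             (((a Finₚ.≟ v) ×-dec (b Finₚ.≟ w)) ⊎-dec ((a Finₚ.≟ w) ×-dec (b Finₚ.≟ v)))

    ∈-join⁺ : ∀ {x} → x ∈ vertices H₁ ⊎ x ∈ vertices H₂ → x ∈ vertices (join v w H₁ H₂)
    ∈-join⁺ = ∈-vertices⁺ V? E?

    ∈-join⁻ : ∀ {x} → x ∈ vertices (join v w H₁ H₂) → x ∈ vertices H₁ ⊎ x ∈ vertices H₂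
    ∈-join⁻ = ∈-vertices⁻ V? E?

    JoinEdge : Rel (Fin n) 0ℓ
    JoinEdge a b = (Edge H₁ a b ⊎ Edge H₂ a b) ⊎ ((a ≡ v × b ≡ w) ⊎ (a ≡ w × b ≡ v))

    edge-join⁺ : ∀ {a b} → JoinEdge a b → Edge (join v w H₁ H₂) a b
    edge-join⁺ (inj₁ (inj₁ (edge e))) = edge (∈-nbrs⁺ V? E? (inj₁ (inj₁ e)))
    edge-join⁺ (inj₁ (inj₂ (edge e))) = edge (∈-nbrs⁺ V? E? (inj₁ (inj₂ e)))
    edge-join⁺ (inj₂ p)               = edge (∈-nbrs⁺ V? E? (inj₂ p))

    edge-join⁻ : ∀ {a b} → Edge (join v w H₁ H₂) a b → JoinEdge a b
    edge-join⁻ (edge e) with ∈-nbrs⁻ V? E? e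
    ... | inj₁ (inj₁ e₁) = inj₁ (inj₁ (edge e₁))
    ... | inj₁ (inj₂ e₂) = inj₁ (inj₂ (edge e₂))
    ... | inj₂ p         = inj₂ p

  restrict-subtree : ∀ {u v H} → SubtreeAt G v H → SubtreeAt G v (restrict u v H)
  restrict-subtree {u} {v} {H} (S , v∈) =
      subtree-from-root
        (λ e → let e′ , s , s′ = edge-restrict⁻ e in edge-restrict⁺ (edge-sym S e′) s′ s)
        (λ e → let e′ , s , _ = edge-restrict⁻ e in ∈-restrict⁺ H (edge-source S e′) s)
        (λ e → edge-~ S (proj₁ (edge-restrict⁻ e)))
        v∈H′ reach
    , v∈H′
    where
    H′ = restrict u v H
    v∈H′ : v ∈ vertices H′
    v∈H′ = ∈-restrict⁺ H v∈ ε
    reach : ∀ {x} → x ∈ vertices H′ → Star (Edge H′) v x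
    reach {x} x∈ with star-preserves Q step (inj₁ (ε , ε)) (edge-walk S v∈ (proj₁ (∈-restrict⁻ H x∈)))
      where
      -- A walk leaving the side does so at v and comes back at v.
      Q : Pred (Fin n) 0ℓ
      Q y = (Side G u v y × Star (Edge H′) v y) ⊎ ¬ Side G u v y
      step : ∀ {y z} → Q y → Edge H y z → Q z
      step {y} {z} q e with side? G u v z
      step (inj₁ (s , p)) e | yes s′ = inj₁ (s′ , p ◅◅ (edge-restrict⁺ e s s′ ◅ ε))
      step (inj₂ ¬s) e | yes s′ with edge-entering S ¬s s′ e
      ... | _ , refl = inj₁ (s′ , ε)
      step q e | no ¬s′ = inj₂ ¬s′
    ... | inj₁ (_ , p) = p
    ... | inj₂ ¬s      = contradiction (proj₂ (∈-restrict⁻ H x∈)) ¬s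

  join-subtree : ∀ {v w H₁ H₂} → v ~ w → SubtreeAt G v H₁ → SubtreeAt G w H₂ → IsSubtree G (join v w H₁ H₂)
  join-subtree {v} {w} {H₁} {H₂} v~w (S₁ , v∈) (S₂ , w∈) =
    subtree-from-root (e-sym ∘ edge-join⁻ v w H₁ H₂) (e-source ∘ edge-join⁻ v w H₁ H₂) (e-~ ∘ edge-join⁻ v w H₁ H₂) (∈-join⁺ v w H₁ H₂ (inj₁ v∈)) (reach ∘ ∈-join⁻ v w H₁ H₂)
    where
    H = join v w H₁ H₂
    e-sym : ∀ {a b} → JoinEdge v w H₁ H₂ a b → Edge H b a
    e-sym (inj₁ (inj₁ e))       = edge-join⁺ v w H₁ H₂ (inj₁ (inj₁ (edge-sym S₁ e)))
    e-sym (inj₁ (inj₂ e))       = edge-join⁺ v w H₁ H₂ (inj₁ (inj₂ (edge-sym S₂ e)))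
    e-sym (inj₂ (inj₁ (p , q))) = edge-join⁺ v w H₁ H₂ (inj₂ (inj₂ (q , p)))
    e-sym (inj₂ (inj₂ (p , q))) = edge-join⁺ v w H₁ H₂ (inj₂ (inj₁ (q , p)))
    e-source : ∀ {a b} → JoinEdge v w H₁ H₂ a b → a ∈ vertices H
    e-source (inj₁ (inj₁ e))          = ∈-join⁺ v w H₁ H₂ (inj₁ (edge-source S₁ e))
    e-source (inj₁ (inj₂ e))          = ∈-join⁺ v w H₁ H₂ (inj₂ (edge-source S₂ e))
    e-source (inj₂ (inj₁ (refl , _))) = ∈-join⁺ v w H₁ H₂ (inj₁ v∈)
    e-source (inj₂ (inj₂ (refl , _))) = ∈-join⁺ v w H₁ H₂ (inj₂ w∈)
    e-~ : ∀ {a b} → JoinEdge v w H₁ H₂ a b → a ~ b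
    e-~ (inj₁ (inj₁ e))             = edge-~ S₁ e
    e-~ (inj₁ (inj₂ e))             = edge-~ S₂ e
    e-~ (inj₂ (inj₁ (refl , refl))) = v~w
    e-~ (inj₂ (inj₂ (refl , refl))) = ~-sym v~w
    reach : ∀ {x} → x ∈ vertices H₁ ⊎ x ∈ vertices H₂ → Star (Edge H) v x
    reach (inj₁ x∈) = Star.map (edge-join⁺ v w H₁ H₂ ∘ inj₁ ∘ inj₁) (edge-walk S₁ v∈ x∈)
    reach (inj₂ x∈) = edge-join⁺ v w H₁ H₂ (inj₂ (inj₁ (refl , refl))) ◅
                      Star.map (edge-join⁺ v w H₁ H₂ ∘ inj₁ ∘ inj₂) (edge-walk S₂ w∈ x∈)

  -- Serves both halves of a join: K adds to H only what is not inside the side, so cutting at the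
  -- edge gives H back.
  restrict-extension : ∀ {u v H K} → IsSubtree G H → (∀ {x} → x ∈ vertices H → Side G u v x) →
    vertices H ⊆ vertices K → (∀ {a b} → Edge H a b → Edge K a b) →
    (∀ {x} → x ∈ vertices K → Side G u v x → x ∈ vertices H) →
    (∀ {a b} → Edge K a b → Side G u v a → Side G u v b → Edge H a b) → restrict u v K ≡ H
  restrict-extension {K = K} S ⊆side V⊆ E⊆ V⊇ E⊇ = subgraph-ext
    (λ x∈ → let x∈K , s = ∈-restrict⁻ K x∈ in V⊇ x∈K s)
    (λ x∈ → ∈-restrict⁺ K (V⊆ x∈) (⊆side x∈))
    (λ e → let e′ , s , s′ = edge-restrict⁻ e in E⊇ e′ s s′)
    (λ e → edge-restrict⁺ (E⊆ e) (⊆side (edge-source S e)) (⊆side (edge-target S e)))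

  module _ {v w : Fin n} (v~w : v ~ w) {H₁ H₂ : Subgraph n}
           (sub₁ : SubtreeAt G v H₁) (sub₂ : SubtreeAt G w H₂)
           (w∉ : w ∉ vertices H₁) (v∉ : v ∉ vertices H₂) where
    private
      in₁ : ∀ {x} → x ∈ vertices H₁ → Side G w v x
      in₁ = avoids-side sub₁ w∉ v~w
      in₂ : ∀ {x} → x ∈ vertices H₂ → Side G v w x
      in₂ = avoids-side sub₂ v∉ (~-sym v~w)

    restrict-joinˡ : restrict w v (join v w H₁ H₂) ≡ H₁
    restrict-joinˡ = restrict-extension (proj₁ sub₁) in₁
      (∈-join⁺ v w H₁ H₂ ∘ inj₁) (edge-join⁺ v w H₁ H₂ ∘ inj₁ ∘ inj₁)
      (λ x∈ s → [ id , (λ x∈₂ → contradiction s (side-disjoint v~w (in₂ x∈₂))) ]′ (∈-join⁻ v w H₁ H₂ x∈))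
      (λ e s s′ → side-edge (edge-join⁻ v w H₁ H₂ e) s s′)
      where
      side-edge : ∀ {a b} → JoinEdge v w H₁ H₂ a b → Side G w v a → Side G w v b → Edge H₁ a b
      side-edge (inj₁ (inj₁ e)) s s′ = e
      side-edge (inj₁ (inj₂ e)) s s′ =
        contradiction s (side-disjoint v~w (in₂ (edge-source (proj₁ sub₂) e)))
      side-edge (inj₂ (inj₁ (_ , refl))) s s′ = contradiction s′ (bridged (~-sym v~w))
      side-edge (inj₂ (inj₂ (refl , _))) s s′ = contradiction s (bridged (~-sym v~w))

    restrict-joinʳ : restrict v w (join v w H₁ H₂) ≡ H₂
    restrict-joinʳ = restrict-extension (proj₁ sub₂) in₂
      (∈-join⁺ v w H₁ H₂ ∘ inj₂) (edge-join⁺ v w H₁ H₂ ∘ inj₁ ∘ inj₂)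
      (λ x∈ s → [ (λ x∈₁ → contradiction (in₁ x∈₁) (side-disjoint v~w s)) , id ]′ (∈-join⁻ v w H₁ H₂ x∈))
      (λ e s s′ → side-edge (edge-join⁻ v w H₁ H₂ e) s s′)
      where
      side-edge : ∀ {a b} → JoinEdge v w H₁ H₂ a b → Side G v w a → Side G v w b → Edge H₂ a b
      side-edge (inj₁ (inj₁ e)) s s′ =
        contradiction (in₁ (edge-source (proj₁ sub₁) e)) (side-disjoint v~w s)
      side-edge (inj₁ (inj₂ e)) s s′ = e
      side-edge (inj₂ (inj₁ (refl , _))) s s′ = contradiction s (bridged v~w)
      side-edge (inj₂ (inj₂ (_ , refl))) s s′ = contradiction s′ (bridged v~w)

  join-restrict : ∀ {v w H} → v ~ w → IsSubtree G H → v ∈ vertices H → w ∈ vertices H →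
                  join v w (restrict w v H) (restrict v w H) ≡ H
  join-restrict {v} {w} {H} v~w S v∈ w∈ = subgraph-ext
    (λ x∈ → [ proj₁ ∘ ∈-restrict⁻ H , proj₁ ∘ ∈-restrict⁻ H ]′ (∈-join⁻ v w H₁ H₂ x∈)) vertex⁺
    (edge⁻ ∘ edge-join⁻ v w H₁ H₂) (edge-join⁺ v w H₁ H₂ ∘ edge⁺)
    where
    H₁ = restrict w v H
    H₂ = restrict v w H
    cross : Edge H v w
    cross = crossing-edge S v∈ w∈ (bridged v~w) ε
    edge⁻ : ∀ {a b} → JoinEdge v w H₁ H₂ a b → Edge H a b
    edge⁻ (inj₁ (inj₁ e)) = proj₁ (edge-restrict⁻ e)
    edge⁻ (inj₁ (inj₂ e)) = proj₁ (edge-restrict⁻ e)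
    edge⁻ (inj₂ (inj₁ (refl , refl))) = cross
    edge⁻ (inj₂ (inj₂ (refl , refl))) = edge-sym S cross
    vertex⁺ : vertices H ⊆ vertices (join v w H₁ H₂)
    vertex⁺ {x} x∈ with side-total w v x
    ... | inj₁ s = ∈-join⁺ v w H₁ H₂ (inj₁ (∈-restrict⁺ H x∈ s))
    ... | inj₂ s = ∈-join⁺ v w H₁ H₂ (inj₂ (∈-restrict⁺ H x∈ s))
    edge⁺ : ∀ {a b} → Edge H a b → JoinEdge v w H₁ H₂ a b
    edge⁺ {a} {b} e with side? G v w a | side? G v w b
    ... | yes s | yes s′ = inj₁ (inj₂ (edge-restrict⁺ e s s′))
    ... | no ¬s | no ¬s′ = inj₁ (inj₁ (edge-restrict⁺ e (side-complement ¬s) (side-complement ¬s′)))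
    ... | no ¬s | yes s′ = inj₂ (inj₁ (edge-entering S ¬s s′ e))
    ... | yes s | no ¬s′ = inj₂ (inj₂ (swap (edge-entering S ¬s′ s (edge-sym S e))))

  -- A subtree at v either misses w, or contains the edge v w and splits there uniquely into a
  -- subtree at v missing w and a subtree at w missing v. With a and b choices this gives a + a b.
  -- The part at w cannot meet A, whose members are neighbours of v other than w and so lie in other
  -- branches.
  avoidingCount-edge : ∀ {v w A} → v ~ w → All (v ~_) A → w ∉ˡ A →
    avoidingCount G A v ≡ avoidingCount G (w ∷ A) v * suc (avoidingCount G (v ∷ []) w)
  avoidingCount-edge {v} {w} {A} v~w A-nbrs w∉A =
    trans (count-⊎ (countPred? G A v) (countPred? G (w ∷ A) v) both? split
            (λ { (p , _ ∷ q) → p , q }) (λ ((p , q) , _) → p , q)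
            (λ { (_ , w∉ ∷ _) (_ , w∈) → w∉ w∈ }) (subgraphs n))
    (trans (cong (avoidingCount G (w ∷ A) v +_) both≡) (sym (*-suc (avoidingCount G (w ∷ A) v) _)))
    where
    Both : Pred (Subgraph n) 0ℓ
    Both H = CountPred G A v H × w ∈ vertices H
    both? : Decidable₁ Both
    both? H = countPred? G A v H ×-dec (w ∈? vertices H)
    split : ∀ {H} → CountPred G A v H → CountPred G (w ∷ A) v H ⊎ Both H
    split {H} (p , q) with w ∈? vertices H
    ... | yes w∈ = inj₂ ((p , q) , w∈)
    ... | no w∉  = inj₁ (p , w∉ ∷ q)

    ys₁ = filter (countPred? G (w ∷ A) v) (subgraphs n)
    ys₂ = filter (countPred? G (v ∷ []) w) (subgraphs n)

    to : Subgraph n → Subgraph n × Subgraph n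
    to H = restrict w v H , restrict v w H
    from : Subgraph n × Subgraph n → Subgraph n
    from (H₁ , H₂) = join v w H₁ H₂

    to-into : ∀ {H} → H ∈ˡ filter both? (subgraphs n) → to H ∈ˡ cartesianProduct ys₁ ys₂ × from (to H) ≡ H
    to-into {H} H∈ with ∈-filter⁻ both? {xs = subgraphs n} H∈
    ... | _ , (((S , v∈) , avoid) , w∈) =
        ∈-cartesianProduct⁺
          (∈-filter⁺ (countPred? G (w ∷ A) v) (∈-subgraphs _)
            ( restrict-subtree (S , v∈)
            , (λ w∈′ → bridged (~-sym v~w) (proj₂ (∈-restrict⁻ H w∈′)))
              ∷ All.map (λ a∉ a∈ → a∉ (proj₁ (∈-restrict⁻ H a∈))) avoid))
          (∈-filter⁺ (countPred? G (v ∷ []) w) (∈-subgraphs _)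
            (restrict-subtree (S , w∈) , (λ v∈′ → bridged v~w (proj₂ (∈-restrict⁻ H v∈′))) ∷ []))
      , join-restrict v~w S v∈ w∈

    from-into : ∀ {HH} → HH ∈ˡ cartesianProduct ys₁ ys₂ → from HH ∈ˡ filter both? (subgraphs n) × to (from HH) ≡ HH
    from-into {H₁ , H₂} HH∈ with ∈-cartesianProduct⁻ ys₁ ys₂ HH∈
    ... | H₁∈ , H₂∈ with ∈-filter⁻ (countPred? G (w ∷ A) v) {xs = subgraphs n} H₁∈
                       | ∈-filter⁻ (countPred? G (v ∷ []) w) {xs = subgraphs n} H₂∈
    ... | _ , (sub₁ , w∉ ∷ avoid) | _ , (sub₂ , v∉ ∷ []) =
        ∈-filter⁺ both? (∈-subgraphs _)
          (((join-subtree v~w sub₁ sub₂ , ∈-join⁺ v w H₁ H₂ (inj₁ (proj₂ sub₁))) , All.tabulate avoids)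
          , ∈-join⁺ v w H₁ H₂ (inj₂ (proj₂ sub₂)))
      , cong₂ _,_ (restrict-joinˡ v~w sub₁ sub₂ w∉ v∉) (restrict-joinʳ v~w sub₁ sub₂ w∉ v∉)
      where
      avoids : ∀ {a} → a ∈ˡ A → a ∉ vertices (join v w H₁ H₂)
      avoids {a} a∈A a∈H with ∈-join⁻ v w H₁ H₂ a∈H
      ... | inj₁ a∈₁ = All.lookup avoid a∈A a∈₁
      ... | inj₂ a∈₂ = sibling-sides-disjoint v~w (All.lookup A-nbrs a∈A) (λ { refl → w∉A a∈A })
                         (avoids-side sub₂ v∉ (~-sym v~w) a∈₂) ε

    both≡ : count both? (subgraphs n) ≡ avoidingCount G (w ∷ A) v * avoidingCount G (v ∷ []) w
    both≡ = trans
      (length-bijection to from (Uniqueₚ.filter⁺ both? (unique-subgraphs n))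
        (Uniqueₚ.cartesianProduct⁺ (Uniqueₚ.filter⁺ (countPred? G (w ∷ A) v) (unique-subgraphs n))
                                   (Uniqueₚ.filter⁺ (countPred? G (v ∷ []) w) (unique-subgraphs n)))
        to-into from-into)
      (length-cartesianProduct ys₁ ys₂)

  private
    at? : ∀ v → Decidable₁ {A = Fin n} (_≡ v)
    at? v = Finₚ._≟ v

    none? : Decidable {A = Fin n} {B = Fin n} (λ _ _ → ⊥)
    none? _ _ = no id

  singleton : Fin n → Subgraph n
  singleton v = comprehension (at? v) none?

  singleton-counted : ∀ {v A} → All (_≢ v) A → CountPred G A v (singleton v)
  singleton-counted {v} A≢v =
    ( subtree-from-root (λ (edge e) → ⊥-elim (no-edge e)) (λ (edge e) → ⊥-elim (no-edge e))
        (λ (edge e) → ⊥-elim (no-edge e)) v∈ (λ x∈ → subst (Star _ v) (sym (∈-vertices⁻ (at? v) none? x∈)) ε)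
    , v∈)
    , All.map (λ a≢v a∈ → a≢v (∈-vertices⁻ (at? v) none? a∈)) A≢v
    where
    v∈ : v ∈ vertices (singleton v)
    v∈ = ∈-vertices⁺ (at? v) none? refl
    no-edge : ∀ {a b} → ¬ b ∈ nbrs (singleton v) a
    no-edge = ∈-nbrs⁻ (at? v) none?

  avoidingCount>0 : ∀ {v A} → All (_≢ v) A → 0 < avoidingCount G A v
  avoidingCount>0 {v} {A} A≢v =
    filter-some (countPred? G A v) (lose (∈-subgraphs (singleton v)) (singleton-counted A≢v))

  avoidingCount-all : ∀ {v A} → (∀ {w} → v ~ w → w ∈ˡ A) → All (_≢ v) A → avoidingCount G A v ≡ 1
  avoidingCount-all {v} {A} nbrs∈A A≢v =
    count-singleton (countPred? G A v) (unique-subgraphs n) (∈-subgraphs _) (singleton-counted A≢v) only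
    where
    only : ∀ {H} → CountPred G A v H → H ≡ singleton v
    only {H} ((S , v∈) , avoid) = subgraph-ext
      (λ x∈ → ∈-vertices⁺ (at? v) none? (at-v (edge-walk S v∈ x∈)))
      (λ x∈ → subst (_∈ vertices H) (sym (∈-vertices⁻ (at? v) none? x∈)) v∈)
      (λ e → contradiction (subst (λ u → Edge H u _) (at-v (edge-walk S v∈ (edge-source S e))) e) no-edge)
      (λ (edge e) → ⊥-elim (∈-nbrs⁻ (at? v) none? e))
      where
      no-edge : ∀ {x} → ¬ Edge H v x
      no-edge e = All.lookup avoid (nbrs∈A (edge-~ S e)) (edge-target S e)
      at-v : ∀ {x} → Star (Edge H) v x → x ≡ v
      at-v ε       = refl
      at-v (e ◅ _) = contradiction e no-edge

-- Shapes of rooted binary trees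

data BT : Set where
  leaf : BT
  node : BT → BT → BT

size : BT → ℕ
size leaf       = 1
size (node s t) = suc (size s + size t)

-- Each factor is the choice at one child: leave it out, or continue with a root subtree of it.
rootSubtrees : BT → ℕ
rootSubtrees leaf       = 1
rootSubtrees (node s t) = suc (rootSubtrees s) * suc (rootSubtrees t)

count-strict : {A : Set} {P Q : Pred A 0ℓ} (P? : Decidable₁ P) (Q? : Decidable₁ Q) →
               (∀ {x} → P x → Q x) → ∀ {x xs} → x ∈ˡ xs → Q x → ¬ P x → count P? xs < count Q? xs
count-strict P? Q? P⇒Q {x} {xs} x∈ qx ¬px = subst (count P? xs <_) (sym split)
  (m<m+n (count P? xs) (filter-some Q∖P? (lose x∈ (qx , ¬px))))
  where
  Q∖P? = λ x → Q? x ×-dec ¬? (P? x)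
  split : count Q? xs ≡ count P? xs + count Q∖P? xs
  split = count-⊎ Q? P? Q∖P? (λ {y} qy → case y qy) P⇒Q proj₁ (λ py (_ , ¬py) → ¬py py) xs
    where
    case : ∀ y → _ → _
    case y qy with P? y
    ... | yes py = inj₁ py
    ... | no ¬py = inj₂ (qy , ¬py)

length-allFin : ∀ n → length (allFin n) ≡ n
length-allFin n = length-tabulate id

∣p∣≡1⇒unique : ∀ {n} {p : Subset n} {x y} → ∣ p ∣ ≡ 1 → x ∈ p → y ∈ p → y ≡ x
∣p∣≡1⇒unique {p = p} {x} {y} p≡1 x∈ y∈ with y Finₚ.≟ x
... | yes y≡x = y≡x
... | no y≢x  = contradiction (<-≤-trans (s≤s 1≤) (subst (∣ p - x ∣ <_) p≡1 (x∈p⇒∣p-x∣<∣p∣ x∈))) (n≮n _)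
  where
  1≤ : 1 ≤ ∣ p - x ∣
  1≤ = subst (_≤ ∣ p - x ∣) (∣⁅x⁆∣≡1 y)
    (p⊆q⇒∣p∣≤∣q∣ λ z∈ → subst (_∈ p - x) (sym (x∈⁅y⁆⇒x≡y y z∈)) (x∈p∧x≢y⇒x∈p-y y∈ y≢x))

∣p∣≡1⇒nonempty : ∀ {n} {p : Subset n} → ∣ p ∣ ≡ 1 → ∃[ x ] x ∈ p
∣p∣≡1⇒nonempty {n} {p} p≡1 with nonempty? p
... | yes ne = ne
... | no e   = contradiction (trans (sym p≡1) (trans (cong ∣_∣ (Empty-unique e)) (∣⊥∣≡0 n))) λ ()

-- Branches, edges of a side, and trails

module _ {n : ℕ} (G : Graph n) where
  open Graph G

  OnlyNbr : Fin n → Fin n → Set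
  OnlyNbr u v = ∀ {w} → v ~ w → w ≡ u

  record Fork (u v w₁ w₂ : Fin n) : Set where
    field
      v~w₁  : v ~ w₁
      v~w₂  : v ~ w₂
      w₁≢u  : w₁ ≢ u
      w₂≢u  : w₂ ≢ u
      w₁≢w₂ : w₁ ≢ w₂
      nbrs⊆ : ∀ {w} → v ~ w → w ≡ u ⊎ w ≡ w₁ ⊎ w ≡ w₂

  fork-swap : ∀ {u v w₁ w₂} → Fork u v w₁ w₂ → Fork u v w₂ w₁
  fork-swap f = record { v~w₁ = v~w₂ ; v~w₂ = v~w₁ ; w₁≢u = w₂≢u ; w₂≢u = w₁≢u ; w₁≢w₂ = w₁≢w₂ ∘ sym
                       ; nbrs⊆ = λ v~w → [ inj₁ , [ inj₂ ∘ inj₂ , inj₂ ∘ inj₁ ]′ ]′ (nbrs⊆ v~w) }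
    where open Fork f

  -- Branch u v t: the component of v after deletion of the edge u v, rooted at v, is t.
  data Branch : Fin n → Fin n → BT → Set where
    leaf : ∀ {u v} → u ~ v → OnlyNbr u v → Branch u v leaf
    node : ∀ {u v w₁ w₂ s t} → u ~ v → Fork u v w₁ w₂ → Branch v w₁ s → Branch v w₂ t → Branch u v (node s t)

  branch-~ : ∀ {u v t} → Branch u v t → u ~ v
  branch-~ (leaf u~v _)     = u~v
  branch-~ (node u~v _ _ _) = u~v

  sideSize : Fin n → Fin n → ℕ
  sideSize u v = count (side? G u v) (allFin n)

  pairs : List (Fin n × Fin n)
  pairs = cartesianProduct (allFin n) (allFin n)

  ∈-pairs : ∀ xs → xs ∈ˡ pairs
  ∈-pairs (a , b) = ∈-cartesianProduct⁺ (∈-allFin a) (∈-allFin b)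

  -- One end on the side suffices, so u v itself is included: these are the edges of the branch at u
  -- that starts with v. The condition a < b picks one orientation, as `edgeCount` does.
  SideEdge : Fin n → Fin n → Pred (Fin n × Fin n) 0ℓ
  SideEdge u v (a , b) = a Data.Fin.< b × a ~ b × (Side G u v a ⊎ Side G u v b)

  sideEdge? : ∀ u v → Decidable₁ (SideEdge u v)
  sideEdge? u v (a , b) = (a Finₚ.<? b) ×-dec (a ~? b) ×-dec (side? G u v a ⊎-dec side? G u v b)

  sideEdges : Fin n → Fin n → ℕ
  sideEdges u v = count (sideEdge? u v) pairs

  branchCount : Fin n → Fin n → ℕ
  branchCount u v = avoidingCount G (u ∷ []) v

  ~⇒≢ : ∀ {u v} → u ~ v → u ≢ v
  ~⇒≢ u~v u≡v = ~-irrefl u≡v u~v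

  -- Trail u v x y k: a non-backtracking walk u, v, …, x, y with k + 1 edges.
  data Trail : (u v x y : Fin n) → ℕ → Set where
    single : ∀ {u v} → u ~ v → Trail u v u v 0
    extend : ∀ {u v w x y k} → u ~ v → w ≢ u → Trail v w x y k → Trail u v x y (suc k)

  trail-first : ∀ {u v x y k} → Trail u v x y k → u ~ v
  trail-first (single u~v)     = u~v
  trail-first (extend u~v _ _) = u~v

  trail-last : ∀ {u v x y k} → Trail u v x y k → x ~ y
  trail-last (single u~v)      = u~v
  trail-last (extend _ _ rest) = trail-last rest

  trail-tail : ∀ {u v x y k} → Trail u v x y k → Walk G k v y
  trail-tail (single _)        = refl
  trail-tail (extend _ _ rest) = _ , trail-first rest , trail-tail rest

  trail-walk : ∀ {u v x y k} → Trail u v x y k → Walk G (suc k) u y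
  trail-walk t = _ , trail-first t , trail-tail t

  trail-init : ∀ {u v x y k} → Trail u v x y k → Walk G k u x
  trail-init (single _)          = refl
  trail-init (extend u~v _ rest) = _ , u~v , trail-init rest

  -- A walk that backtracks can be cut short by two steps.
  trail-or-shorter : ∀ k {a b} → Walk G (suc k) a b →
    (∃[ v ] ∃[ x ] Trail a v x b k) ⊎ ∃[ m ] (m < suc k × Walk G m a b)
  trail-or-shorter zero    (w , a~w , refl) = inj₁ (_ , _ , single a~w)
  trail-or-shorter (suc k) {a} (w , a~w , rest) with trail-or-shorter k rest
  ... | inj₂ (m , m< , walk) = inj₂ (suc m , s≤s m< , w , a~w , walk)
  ... | inj₁ (v , x , trail) with v Finₚ.≟ a
  ...   | yes refl = inj₂ (k , m≤n⇒m≤1+n ≤-refl , trail-tail trail)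
  ...   | no v≢a   = inj₁ (w , x , extend a~w v≢a trail)

  walk-snoc : ∀ k {a b c} → Walk G k a b → b ~ c → Walk G (suc k) a c
  walk-snoc zero    refl           b~c = _ , b~c , refl
  walk-snoc (suc k) (w , a~w , rest) b~c = w , a~w , walk-snoc k rest b~c

  walk-reverse : ∀ k {a b} → Walk G k a b → Walk G k b a
  walk-reverse zero    refl             = refl
  walk-reverse (suc k) (w , a~w , rest) = walk-snoc k (walk-reverse k rest) (~-sym a~w)

  star⇒walk : ∀ {a b} → Star _~_ a b → ∃[ k ] Walk G k a b
  star⇒walk ε       = 0 , refl
  star⇒walk (r ◅ s) = let k , walk = star⇒walk s in suc k , _ , r , walk

  walk-exit : ∀ m {u v a b} → Side G u v a → ¬ Side G u v b → Walk G m a b → ∃[ j ] (j < m × Walk G j a v)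
  walk-exit zero    a∈ b∉ refl = contradiction a∈ b∉
  walk-exit (suc m) a∈ b∉ (w , a~w , rest) with side-step G a∈ a~w
  ... | inj₂ (refl , _) = 0 , s≤s z≤n , refl
  ... | inj₁ w∈ = let j , j<m , walk = walk-exit m w∈ b∉ rest in suc j , s≤s j<m , w , a~w , walk

-- Counts, sizes and weights along an edge

module BranchCounting {n : ℕ} (G : Graph n) (conn : Connected G) (bridged : Bridged G) where
  open Graph G
  open Sides G conn bridged
  open SubtreeCounting G conn bridged

  subtreeCount-edge : ∀ {u v} → u ~ v → subtreeCount G u ≡ branchCount G v u * suc (branchCount G u v)
  subtreeCount-edge {u} u~v = trans (subtreeCount≡avoidingCount G u) (avoidingCount-edge u~v [] λ ())

  branchCount-child : ∀ {u v w} → u ~ v → v ~ w → w ≢ u → branchCount G v w < branchCount G u v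
  branchCount-child {u} {v} {w} u~v v~w w≢u =
    subst (branchCount G v w <_) (sym (avoidingCount-edge v~w (~-sym u~v ∷ []) (λ { (here w≡u) → w≢u w≡u })))
      (m≤n*m (suc (branchCount G v w)) (avoidingCount G (w ∷ u ∷ []) v) {{>-nonZero (avoidingCount>0 ((~⇒≢ G v~w ∘ sym) ∷ ~⇒≢ G u~v ∷ []))}})

  branchCount-leaf : ∀ {u v} → u ~ v → OnlyNbr G u v → branchCount G u v ≡ 1
  branchCount-leaf u~v only = avoidingCount-all (here ∘ only) (~⇒≢ G u~v ∷ [])

  branchCount-fork : ∀ {u v w₁ w₂} → u ~ v → Fork G u v w₁ w₂ →
                     branchCount G u v ≡ suc (branchCount G v w₁) * suc (branchCount G v w₂)
  branchCount-fork {u} {v} {w₁} {w₂} u~v f =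
    trans (avoidingCount-edge v~w₁ (~-sym u~v ∷ []) (λ { (here e) → w₁≢u e }))
    (trans (*-comm _ (suc (branchCount G v w₁)))
    (cong (suc (branchCount G v w₁) *_)
      (trans (avoidingCount-edge v~w₂ (v~w₁ ∷ ~-sym u~v ∷ []) (λ { (here e) → w₁≢w₂ (sym e) ; (there (here e)) → w₂≢u e }))
      (trans (cong (_* suc (branchCount G v w₂)) (avoidingCount-all covers avoid)) (*-identityˡ _)))))
    where
    open Fork f
    covers : ∀ {w} → v ~ w → w ∈ˡ w₂ ∷ w₁ ∷ u ∷ []
    covers v~w with nbrs⊆ v~w
    ... | inj₁ e        = there (there (here e))
    ... | inj₂ (inj₁ e) = there (here e)
    ... | inj₂ (inj₂ e) = here e
    avoid : All (_≢ v) (w₂ ∷ w₁ ∷ u ∷ [])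
    avoid = (~⇒≢ G v~w₂ ∘ sym) ∷ (~⇒≢ G v~w₁ ∘ sym) ∷ ~⇒≢ G u~v ∷ []

  branch-count : ∀ {u v t} → Branch G u v t → branchCount G u v ≡ rootSubtrees t
  branch-count (leaf u~v only) = branchCount-leaf u~v only
  branch-count (node u~v f b₁ b₂) =
    trans (branchCount-fork u~v f) (cong₂ (λ x y → suc x * suc y) (branch-count b₁) (branch-count b₂))

  -- With a root subtrees at u and b at v, the two counts are a + a b and b + b a; the subtrees
  -- through the edge cancel.
  heavier-subtreeCount : ∀ {u v} → u ~ v → branchCount G u v < branchCount G v u → subtreeCount G v < subtreeCount G u
  heavier-subtreeCount {u} {v} u~v lt = subst₂ _<_
    (sym (subtreeCount-edge (~-sym u~v))) (sym (subtreeCount-edge u~v))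
    (subst₂ _<_ (sym (*-suc (branchCount G u v) _)) (sym (*-suc (branchCount G v u) _))
      (+-mono-<-≤ lt (≤-reflexive (*-comm (branchCount G u v) _))))

  -- One step outward shrinks the branch ahead and enlarges the one behind, so the inequality
  -- persists and the counts keep falling on the way to z.
  subtreeCount-side : ∀ {u v} → u ~ v → branchCount G u v < branchCount G v u →
                      ∀ {z} → Side G u v z → subtreeCount G z < subtreeCount G u
  subtreeCount-side u~v lt z∈ = go (<-wellFounded _) u~v lt z∈
    where
    go : ∀ {u v z} → Acc _<_ (branchCount G u v) → u ~ v → branchCount G u v < branchCount G v u →
         Side G u v z → subtreeCount G z < subtreeCount G u
    go {u} {v} (acc rec) u~v lt z∈ with side-split z∈
    ... | inj₁ refl = heavier-subtreeCount u~v lt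
    ... | inj₂ (w , v~w , w≢u , z∈w) = <-trans
      (go (rec (branchCount-child u~v v~w w≢u)) v~w
        (<-trans (branchCount-child u~v v~w w≢u)
          (<-trans lt (branchCount-child (~-sym v~w) (~-sym u~v) (w≢u ∘ sym)))) z∈w)
      (heavier-subtreeCount u~v lt)

  sideSize-complement : ∀ {u v} → u ~ v → sideSize G u v + sideSize G v u ≡ n
  sideSize-complement {u} {v} u~v = trans (sym (count-⊎ all? (side? G u v) (side? G v u)
      (λ {x} _ → side-total u v x) (λ _ → refl) (λ _ → refl) (side-disjoint u~v) (allFin n)))
    (trans (cong length (filter-all all? (All.tabulate {xs = allFin n} λ _ → refl))) (length-allFin n))
    where
    all? : Decidable₁ {A = Fin n} (λ _ → 0 ≡ 0)
    all? _ = yes refl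

  sideSize>0 : ∀ u v → 0 < sideSize G u v
  sideSize>0 u v = filter-some (side? G u v) (lose (∈-allFin v) ε)

  sideSize-child : ∀ {u v w} → u ~ v → v ~ w → w ≢ u → sideSize G v w < sideSize G u v
  sideSize-child {u} {v} {w} u~v v~w w≢u = count-strict (side? G v w) (side? G u v)
    (side-child u~v v~w w≢u) (∈-allFin v) ε (bridged v~w)

  sideSize-leaf : ∀ {u v} → u ~ v → OnlyNbr G u v → sideSize G u v ≡ 1
  sideSize-leaf {u} {v} u~v only =
    count-singleton (side? G u v) (Uniqueₚ.allFin⁺ n) (∈-allFin v) ε at-v
    where
    at-v : ∀ {x} → Side G u v x → x ≡ v
    at-v x∈ with side-split x∈
    ... | inj₁ x≡v               = x≡v
    ... | inj₂ (w , v~w , w≢u , _) = contradiction (only v~w) w≢u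

  fork-side : ∀ {u v w₁ w₂ x} → Fork G u v w₁ w₂ → Side G u v x → x ≡ v ⊎ Side G v w₁ x ⊎ Side G v w₂ x
  fork-side f x∈ with side-split x∈
  ... | inj₁ x≡v = inj₁ x≡v
  ... | inj₂ (w , v~w , w≢u , x∈w) with Fork.nbrs⊆ f v~w
  ...   | inj₁ w≡u         = contradiction w≡u w≢u
  ...   | inj₂ (inj₁ refl) = inj₂ (inj₁ x∈w)
  ...   | inj₂ (inj₂ refl) = inj₂ (inj₂ x∈w)

  -- The predicate is left open because it is used for the side of an edge and, at a root of degree
  -- two, for the whole tree.
  count-root+children : ∀ {P : Pred (Fin n) 0ℓ} (P? : Decidable₁ P) {v w₁ w₂} → v ~ w₁ → v ~ w₂ → w₁ ≢ w₂ →
    (∀ {x} → P x → x ≡ v ⊎ Side G v w₁ x ⊎ Side G v w₂ x) → P v →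
    (∀ {x} → Side G v w₁ x → P x) → (∀ {x} → Side G v w₂ x → P x) →
    count P? (allFin n) ≡ suc (sideSize G v w₁ + sideSize G v w₂)
  count-root+children P? {v} {w₁} {w₂} v~w₁ v~w₂ w₁≢w₂ split pv p₁ p₂ =
    trans (count-⊎ P? (Finₚ._≟ v) either? split (λ { refl → pv }) [ p₁ , p₂ ]′
            (λ { refl → [ bridged v~w₁ , bridged v~w₂ ]′ }) (allFin n))
    (cong₂ _+_ (count-singleton (Finₚ._≟ v) (Uniqueₚ.allFin⁺ n) (∈-allFin v) refl id)
               (count-⊎ either? (side? G v w₁) (side? G v w₂) id inj₁ inj₂ (sibling-sides-disjoint v~w₁ v~w₂ w₁≢w₂) (allFin n)))
    where
    either? = λ x → side? G v w₁ x ⊎-dec side? G v w₂ x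

  sideSize-fork : ∀ {u v w₁ w₂} → u ~ v → Fork G u v w₁ w₂ →
                  sideSize G u v ≡ suc (sideSize G v w₁ + sideSize G v w₂)
  sideSize-fork {u} {v} u~v f = count-root+children (side? G u v) v~w₁ v~w₂ w₁≢w₂
    (fork-side f) ε (side-child u~v v~w₁ w₁≢u) (side-child u~v v~w₂ w₂≢u)
    where open Fork f

  branch-size : ∀ {u v t} → Branch G u v t → sideSize G u v ≡ size t
  branch-size (leaf u~v only) = sideSize-leaf u~v only
  branch-size (node u~v f b₁ b₂) =
    trans (sideSize-fork u~v f) (cong suc (cong₂ _+_ (branch-size b₁) (branch-size b₂)))

  EdgeIs : Fin n → Fin n → Pred (Fin n × Fin n) 0ℓ
  EdgeIs u v (a , b) = a Data.Fin.< b × ((a ≡ u × b ≡ v) ⊎ (a ≡ v × b ≡ u))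

  edgeIs? : ∀ u v → Decidable₁ (EdgeIs u v)
  edgeIs? u v (a , b) = (a Finₚ.<? b) ×-dec
    (((a Finₚ.≟ u) ×-dec (b Finₚ.≟ v)) ⊎-dec ((a Finₚ.≟ v) ×-dec (b Finₚ.≟ u)))

  count-edgeIs : ∀ {u v} → u ~ v → count (edgeIs? u v) (pairs G) ≡ 1
  count-edgeIs {u} {v} u~v with Finₚ.<-cmp u v
  ... | tri< u<v _ v≮u = count-singleton (edgeIs? u v)
    (Uniqueₚ.cartesianProduct⁺ (Uniqueₚ.allFin⁺ n) (Uniqueₚ.allFin⁺ n)) (∈-pairs G _) (u<v , inj₁ (refl , refl))
    λ { (_ , inj₁ (refl , refl)) → refl ; (v<u , inj₂ (refl , refl)) → contradiction v<u v≮u }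
  ... | tri≈ _ u≡v _ = contradiction u≡v (~⇒≢ G u~v)
  ... | tri> u≮v _ v<u = count-singleton (edgeIs? u v)
    (Uniqueₚ.cartesianProduct⁺ (Uniqueₚ.allFin⁺ n) (Uniqueₚ.allFin⁺ n)) (∈-pairs G _) (v<u , inj₂ (refl , refl))
    λ { (u<v , inj₁ (refl , refl)) → contradiction u<v u≮v ; (_ , inj₂ (refl , refl)) → refl }

  edgeIs⇒sideEdge : ∀ {u v e} → u ~ v → EdgeIs u v e → SideEdge G u v e
  edgeIs⇒sideEdge u~v (a<b , inj₁ (refl , refl)) = a<b , u~v , inj₂ ε
  edgeIs⇒sideEdge u~v (a<b , inj₂ (refl , refl)) = a<b , ~-sym u~v , inj₁ ε

  sideEdges-leaf : ∀ {u v} → u ~ v → OnlyNbr G u v → sideEdges G u v ≡ 1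
  sideEdges-leaf {u} {v} u~v only =
    trans (count-cong (sideEdge? G u v) (edgeIs? u v) to (edgeIs⇒sideEdge u~v) (pairs G)) (count-edgeIs u~v)
    where
    at-v : ∀ {x} → Side G u v x → x ≡ v
    at-v x∈ with side-split x∈
    ... | inj₁ x≡v               = x≡v
    ... | inj₂ (w , v~w , w≢u , _) = contradiction (only v~w) w≢u
    to : ∀ {e} → SideEdge G u v e → EdgeIs u v e
    to (a<b , a~b , inj₁ a∈) with at-v a∈
    ... | refl = a<b , inj₂ (refl , only a~b)
    to (a<b , a~b , inj₂ b∈) with at-v b∈
    ... | refl = a<b , inj₁ (only (~-sym a~b) , refl)

  -- An edge meeting two disjoint sides would have to leave one of them through its root edge.
  sideEdge-separated : ∀ {v w₁ w₂ e} → v ~ w₁ → v ~ w₂ → w₁ ≢ w₂ → SideEdge G v w₁ e → ¬ SideEdge G v w₂ e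
  sideEdge-separated {v} v~w₁ v~w₂ w₁≢w₂ (_ , a~b , s₁) (_ , _ , s₂) = go s₁ s₂
    where
    cross : ∀ {a b} → a ~ b → Side G v _ a → ¬ Side G v _ b
    cross a~b a∈₁ b∈₂ with side-step G a∈₁ a~b
    ... | inj₁ b∈₁        = sibling-sides-disjoint v~w₁ v~w₂ w₁≢w₂ b∈₁ b∈₂
    ... | inj₂ (_ , refl) = bridged v~w₂ b∈₂
    go : Side G v _ _ ⊎ Side G v _ _ → ¬ (Side G v _ _ ⊎ Side G v _ _)
    go (inj₁ a∈₁) (inj₁ a∈₂) = sibling-sides-disjoint v~w₁ v~w₂ w₁≢w₂ a∈₁ a∈₂
    go (inj₁ a∈₁) (inj₂ b∈₂) = cross a~b a∈₁ b∈₂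
    go (inj₂ b∈₁) (inj₁ a∈₂) = cross (~-sym a~b) b∈₁ a∈₂
    go (inj₂ b∈₁) (inj₂ b∈₂) = sibling-sides-disjoint v~w₁ v~w₂ w₁≢w₂ b∈₁ b∈₂

  sideEdges-fork : ∀ {u v w₁ w₂} → u ~ v → Fork G u v w₁ w₂ →
                   sideEdges G u v ≡ suc (sideEdges G v w₁ + sideEdges G v w₂)
  sideEdges-fork {u} {v} {w₁} {w₂} u~v f =
    trans (count-⊎ (sideEdge? G u v) (edgeIs? u v) either? split (edgeIs⇒sideEdge u~v)
            [ child v~w₁ w₁≢u , child v~w₂ w₂≢u ]′
            (λ e → [ root-edge v~w₁ w₁≢u e , root-edge v~w₂ w₂≢u e ]′) (pairs G))
    (cong₂ _+_ (count-edgeIs u~v)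
      (count-⊎ either? (sideEdge? G v w₁) (sideEdge? G v w₂) id inj₁ inj₂
        (sideEdge-separated v~w₁ v~w₂ w₁≢w₂) (pairs G)))
    where
    open Fork f
    either? = λ e → sideEdge? G v w₁ e ⊎-dec sideEdge? G v w₂ e
    child : ∀ {w e} → v ~ w → w ≢ u → SideEdge G v w e → SideEdge G u v e
    child v~w w≢u (a<b , a~b , s) =
      a<b , a~b , [ inj₁ ∘ side-child u~v v~w w≢u , inj₂ ∘ side-child u~v v~w w≢u ]′ s
    no-u : ∀ {w} → v ~ w → w ≢ u → ¬ Side G v w u
    no-u v~w w≢u u∈ = bridged u~v (side-child u~v v~w w≢u u∈)
    root-edge : ∀ {w e} → v ~ w → w ≢ u → EdgeIs u v e → ¬ SideEdge G v w e
    root-edge v~w w≢u (_ , inj₁ (refl , refl)) (_ , _ , s) = [ no-u v~w w≢u , bridged v~w ]′ s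
    root-edge v~w w≢u (_ , inj₂ (refl , refl)) (_ , _ , s) = [ bridged v~w , no-u v~w w≢u ]′ s
    split : ∀ {e} → SideEdge G u v e → EdgeIs u v e ⊎ SideEdge G v w₁ e ⊎ SideEdge G v w₂ e
    split (a<b , a~b , inj₁ a∈) with fork-side f a∈
    ... | inj₂ (inj₁ a∈₁) = inj₂ (inj₁ (a<b , a~b , inj₁ a∈₁))
    ... | inj₂ (inj₂ a∈₂) = inj₂ (inj₂ (a<b , a~b , inj₁ a∈₂))
    ... | inj₁ refl with nbrs⊆ a~b
    ...   | inj₁ refl        = inj₁ (a<b , inj₂ (refl , refl))
    ...   | inj₂ (inj₁ refl) = inj₂ (inj₁ (a<b , a~b , inj₂ ε))
    ...   | inj₂ (inj₂ refl) = inj₂ (inj₂ (a<b , a~b , inj₂ ε))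
    split (a<b , a~b , inj₂ b∈) with fork-side f b∈
    ... | inj₂ (inj₁ b∈₁) = inj₂ (inj₁ (a<b , a~b , inj₂ b∈₁))
    ... | inj₂ (inj₂ b∈₂) = inj₂ (inj₂ (a<b , a~b , inj₂ b∈₂))
    ... | inj₁ refl with nbrs⊆ (~-sym a~b)
    ...   | inj₁ refl        = inj₁ (a<b , inj₁ (refl , refl))
    ...   | inj₂ (inj₁ refl) = inj₂ (inj₁ (a<b , a~b , inj₁ ε))
    ...   | inj₂ (inj₂ refl) = inj₂ (inj₂ (a<b , a~b , inj₁ ε))

  -- Every vertex of the side accounts for the edge to its parent, u v included. Hence weights,
  -- which count edges, can be measured in vertices.
  branch-edges : ∀ {u v t} → Branch G u v t → sideEdges G u v ≡ size t
  branch-edges (leaf u~v only) = sideEdges-leaf u~v only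
  branch-edges (node u~v f b₁ b₂) =
    trans (sideEdges-fork u~v f) (cong suc (cong₂ _+_ (branch-edges b₁) (branch-edges b₂)))

  -- The only edge of K at v leads to w, so a walk in K from v can enter no other branch.
  pendant-vertices : ∀ {v w K x} → PendantAt G v K → Edge K v w → x ∈ vertices K → x ≡ v ⊎ Side G v w x
  pendant-vertices {v} {w} {K} ((S , v∈) , one) (edge w∈) x∈ =
    star-preserves Q step (inj₁ refl) (edge-walk v∈ x∈)
    where
    open Subtree S
    Q : Pred (Fin n) 0ℓ
    Q x = x ≡ v ⊎ Side G v w x
    step : ∀ {a b} → Q a → Edge K a b → Q b
    step (inj₁ refl) (edge b∈) = inj₂ (subst (Side G v w) (sym (∣p∣≡1⇒unique one w∈ b∈)) ε)
    step (inj₂ a∈) e with side-step G a∈ (edge-~ e)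
    ... | inj₁ b∈        = inj₂ b∈
    ... | inj₂ (_ , b≡v) = inj₁ b≡v

  pendant-edges : ∀ {v w K a b} → PendantAt G v K → Edge K v w → Edge K a b → Side G v w a ⊎ Side G v w b
  pendant-edges {v} {w} {K} P@((S , _) , one) (edge w∈) e with pendant-vertices P (edge w∈) (Subtree.edge-source S e)
  ... | inj₂ a∈ = inj₁ a∈
  pendant-edges {v} {w} {K} P@((S , _) , one) (edge w∈) (edge b∈) | inj₁ refl =
    inj₂ (subst (Side G v w) (sym (∣p∣≡1⇒unique one w∈ b∈)) ε)

  pendant-edgeCount : ∀ {v w K} → PendantAt G v K → Edge K v w → edgeCount K ≤ sideEdges G v w
  pendant-edgeCount {v} {w} {K} P@((S , _) , _) e =
    count-mono (λ (a , b) → (a Finₚ.<? b) ×-dec (b ∈? nbrs K a)) (sideEdge? G v w)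
      (λ (a<b , b∈) → a<b , Subtree.edge-~ S (edge b∈) , pendant-edges P e (edge b∈)) (pairs G)

  weight-upper : ∀ {v m} → (∀ {w} → v ~ w → sideEdges G v w ≤ m) → weight G v ≤ m
  weight-upper {v} {m} bound = max≤v⁺ z≤n (Allₚ.map⁺ (All.tabulate {xs = filter (isBranch? G v) (subgraphs n)} λ {K} K∈ →
    let _ , P , _ = ∈-filter⁻ (isBranch? G v) {xs = subgraphs n} K∈
        w , w∈ = ∣p∣≡1⇒nonempty (proj₂ P)
    in ≤-trans (pendant-edgeCount P (edge w∈)) (bound (Subtree.edge-~ (proj₁ (proj₁ P)) (edge w∈)))))

  module _ {v w : Fin n} (v~w : v ~ w) where
    private
      V? : Decidable₁ (λ x → x ≡ v ⊎ Side G v w x)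
      V? x = (x Finₚ.≟ v) ⊎-dec side? G v w x
      E? : Decidable (λ a b → a ~ b × (Side G v w a ⊎ Side G v w b))
      E? a b = (a ~? b) ×-dec (side? G v w a ⊎-dec side? G v w b)

    fullBranch : Subgraph n
    fullBranch = comprehension V? E?

    private
      e-V : ∀ {a b} → a ~ b → Side G v w a ⊎ Side G v w b → a ≡ v ⊎ Side G v w a
      e-V a~b (inj₁ a∈) = inj₂ a∈
      e-V a~b (inj₂ b∈) with side-step G b∈ (~-sym a~b)
      ... | inj₁ a∈        = inj₂ a∈
      ... | inj₂ (_ , a≡v) = inj₁ a≡v

      e⁺ : ∀ {a b} → a ~ b → Side G v w a ⊎ Side G v w b → Edge fullBranch a b
      e⁺ a~b s = edge (∈-nbrs⁺ V? E? (a~b , s))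

      e⁻ : ∀ {a b} → Edge fullBranch a b → a ~ b × (Side G v w a ⊎ Side G v w b)
      e⁻ (edge e) = ∈-nbrs⁻ V? E? e

      v∈ : v ∈ vertices fullBranch
      v∈ = ∈-vertices⁺ V? E? (inj₁ refl)

    fullBranch-edge : Edge fullBranch v w
    fullBranch-edge = e⁺ v~w (inj₂ ε)

    fullBranch-pendant : PendantAt G v fullBranch
    fullBranch-pendant = (S , v∈) , trans (cong ∣_∣ nbrs≡) (∣⁅x⁆∣≡1 w)
      where
      reach : ∀ {x} → x ≡ v ⊎ Side G v w x → Star (Edge fullBranch) v x
      reach (inj₁ refl) = ε
      reach (inj₂ x∈)   = proj₂ (star-preserves (λ x → Side G v w x × Star (Edge fullBranch) v x)
        (λ (a∈ , p) r → a∈ ◅◅ (r ◅ ε) , p ◅◅ (e⁺ (proj₁ r) (inj₁ a∈) ◅ ε)) (ε , fullBranch-edge ◅ ε) x∈)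
      S : IsSubtree G fullBranch
      S = subtree-from-root (λ e → let a~b , s = e⁻ e in e⁺ (~-sym a~b) ([ inj₂ , inj₁ ]′ s))
        (λ e → let a~b , s = e⁻ e in ∈-vertices⁺ V? E? (e-V a~b s)) (proj₁ ∘ e⁻) v∈
        (λ x∈ → reach (∈-vertices⁻ V? E? x∈))
      nbr≡w : ∀ {x} → Edge fullBranch v x → x ≡ w
      nbr≡w e with e⁻ e
      ... | v~x , inj₁ v∈ = contradiction v∈ (bridged v~w)
      ... | v~x , inj₂ x∈ with side-step G x∈ (~-sym v~x)
      ...   | inj₁ v∈        = contradiction v∈ (bridged v~w)
      ...   | inj₂ (x≡w , _) = x≡w
      nbrs≡ : nbrs fullBranch v ≡ ⁅ w ⁆
      nbrs≡ = ⊆-antisym (λ x∈ → subst (_∈ ⁅ w ⁆) (sym (nbr≡w (edge x∈))) (x∈⁅x⁆ w))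
        (λ x∈ → subst (_∈ nbrs fullBranch v) (sym (x∈⁅y⁆⇒x≡y w x∈)) (Edge.∈-nbrs fullBranch-edge))

    -- A larger subtree with v pendant contains the edge v w, which is then its only edge at v; so
    -- it too stays behind w.
    fullBranch-isBranch : IsBranch G v fullBranch
    fullBranch-isBranch = fullBranch-pendant , λ K P (_ , E⊆) →
      let e = edge (E⊆ v (Edge.∈-nbrs fullBranch-edge)) in
        (λ x∈ → ∈-vertices⁺ V? E? (pendant-vertices P e x∈))
      , (λ u b∈ → Edge.∈-nbrs (e⁺ (Subtree.edge-~ (proj₁ (proj₁ P)) (edge b∈)) (pendant-edges P e (edge b∈))))

    sideEdges≤weight : sideEdges G v w ≤ weight G v
    sideEdges≤weight = v≤max⁺ 0 _ (inj₂ (Any.map ≤-reflexive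
        (subst (_∈ˡ _) count≡ (∈-map⁺ edgeCount (∈-filter⁺ (isBranch? G v) (∈-subgraphs fullBranch) fullBranch-isBranch)))))
      where
      count≡ : edgeCount fullBranch ≡ sideEdges G v w
      count≡ = count-cong (λ (a , b) → (a Finₚ.<? b) ×-dec (b ∈? nbrs fullBranch a)) (sideEdge? G v w)
        (λ (a<b , b∈) → a<b , e⁻ (edge b∈)) (λ (a<b , a~b , s) → a<b , Edge.∈-nbrs (e⁺ a~b s)) (pairs G)

  trail-side : ∀ {u v x y k a} → Trail G u v x y k → Side G x y a → Side G u v a
  trail-side (single _) a∈             = a∈
  trail-side (extend u~v w≢u rest) a∈ = side-child u~v (trail-first G rest) w≢u (trail-side rest a∈)

  -- Such a walk leaves the nested sides of the trail one after the other, and each exit uses a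
  -- separate edge.
  trail-length : ∀ {u v x y k m a b} → Trail G u v x y k → Side G x y a → ¬ Side G u v b → Walk G m a b → suc k ≤ m
  trail-length {m = m} (single _) a∈ b∉ walk with walk-exit G m a∈ b∉ walk
  ... | j , j<m , _ = ≤-trans (s≤s z≤n) j<m
  trail-length {m = m} trail@(extend u~v w≢u rest) a∈ b∉ walk with walk-exit G m (trail-side trail a∈) b∉ walk
  ... | j , j<m , walk′ = ≤-trans (s≤s (trail-length rest a∈ (bridged (trail-first G rest)) walk′)) j<m

-- Inequalities between products

-- The rearrangement inequality: with b = a + u and d = c + v the difference is `u * v`.
rearrange : ∀ {a b c d} → a ≤ b → c ≤ d → a * d + b * c ≤ a * c + b * d
rearrange {a} {_} {c} a≤b c≤d with m≤n⇒∃[o]m+o≡n a≤b | m≤n⇒∃[o]m+o≡n c≤d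
... | u , refl | v , refl = subst (a * (c + v) + (a + u) * c ≤_) (identity a u c v) (m≤m+n _ (u * v))
  where
  identity : ∀ a u c v → a * (c + v) + (a + u) * c + u * v ≡ a * c + (a + u) * (c + v)
  identity = solve-∀

-- From (X - x)(X - y) ≥ 0 one gets X (x + y) ≤ X X + x y ≤ X (X + Y); then X is cancelled.
sum-≤-from-product : ∀ {x y X Y} → x ≤ X → y ≤ X → x * y ≤ X * Y → x + y ≤ X + Y
sum-≤-from-product {x} {y} {zero} z≤n z≤n _ = z≤n
sum-≤-from-product {x} {y} {X@(suc _)} {Y} x≤X y≤X xy≤ = *-cancelˡ-≤ X (begin
  X * (x + y)   ≡⟨ e₁ X x y ⟩
  y * X + X * x ≤⟨ rearrange y≤X x≤X ⟩
  y * x + X * X ≡⟨ cong (_+ X * X) (*-comm y x) ⟩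
  x * y + X * X ≤⟨ +-monoˡ-≤ (X * X) xy≤ ⟩
  X * Y + X * X ≡⟨ e₂ X Y ⟩
  X * (X + Y)   ∎)
  where
  open ≤-Reasoning
  e₁ : ∀ X x y → X * (x + y) ≡ y * X + X * x
  e₁ = solve-∀
  e₂ : ∀ X Y → X * Y + X * X ≡ X * (X + Y)
  e₂ = solve-∀

-- With q = p + d the left side is 1 + p (x + y) + d y + p q (x y), and each variable term has its
-- own bound. On the right the large factor X goes with the large weight q.
weighted-product-≤ : ∀ {p q x y X Y} → p ≤ q → y ≤ X → x * y ≤ X * Y → x + y ≤ X + Y →
                     suc (p * x) * suc (q * y) ≤ suc (p * Y) * suc (q * X)
weighted-product-≤ {p} {_} {x} {y} {X} {Y} p≤q y≤X prod sum with m≤n⇒∃[o]m+o≡n p≤q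
... | d , refl = begin
  suc (p * x) * suc ((p + d) * y)                       ≡⟨ e₁ p d x y ⟩
  1 + (p * (x + y) + d * y) + p * (p + d) * (x * y)     ≤⟨ +-mono-≤ (s≤s (+-mono-≤ (*-monoʳ-≤ p sum) (*-monoʳ-≤ d y≤X)))
                                                                     (*-monoʳ-≤ (p * (p + d)) prod) ⟩
  1 + (p * (X + Y) + d * X) + p * (p + d) * (X * Y)     ≡⟨ e₂ p d X Y ⟩
  suc (p * Y) * suc ((p + d) * X)                       ∎
  where
  open ≤-Reasoning
  e₁ : ∀ p d x y → suc (p * x) * suc ((p + d) * y) ≡ 1 + (p * (x + y) + d * y) + p * (p + d) * (x * y)
  e₁ = solve-∀
  e₂ : ∀ p d X Y → 1 + (p * (X + Y) + d * X) + p * (p + d) * (X * Y) ≡ suc (p * Y) * suc ((p + d) * X)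
  e₂ = solve-∀

-- Values of complete and rgood trees

-- One more than the number of root subtrees of the complete tree of height h.
complete : ℕ → ℕ
complete zero    = 2
complete (suc h) = suc (complete h * complete h)

-- One more than the number of root subtrees of the rgood tree with 2 ^ h + r leaves (r ≤ 2 ^ h).
rgood : ℕ → ℕ → ℕ
rgood zero    zero    = 2
-- A cherry has four root subtrees. Excesses above one are outside the range and get the same value.
rgood zero    (suc _) = 5
rgood (suc h) r with r ≤? 2 ^ h
... | yes _ = suc (complete h * rgood h r)
... | no _  = suc (complete (suc h) * rgood h (r ∸ 2 ^ h))

2^suc : ∀ h → 2 ^ suc h ≡ 2 ^ h + 2 ^ h
2^suc h = cong (2 ^ h +_) (+-identityʳ (2 ^ h))

2^>0 : ∀ h → 0 < 2 ^ h
2^>0 h = m^n>0 2 h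

rgood-low : ∀ h {r} → r ≤ 2 ^ h → rgood (suc h) r ≡ suc (complete h * rgood h r)
rgood-low h {r} r≤ with r ≤? 2 ^ h
... | yes _ = refl
... | no r≰ = contradiction r≤ r≰

rgood-0 : ∀ h → rgood h 0 ≡ complete h
rgood-0 zero    = refl
rgood-0 (suc h) = trans (rgood-low h z≤n) (cong (λ x → suc (complete h * x)) (rgood-0 h))

rgood-above : ∀ h {r} → 0 < r → rgood (suc h) (2 ^ h + r) ≡ suc (complete (suc h) * rgood h r)
rgood-above h {r} 0<r with 2 ^ h + r ≤? 2 ^ h
... | yes r≤ = contradiction r≤ (<⇒≱ (m<m+n (2 ^ h) 0<r))
... | no _  = cong (λ x → suc (complete (suc h) * rgood h x)) (m+n∸m≡n (2 ^ h) r)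

rgood-top : ∀ h → rgood h (2 ^ h) ≡ complete (suc h)
rgood-top zero    = refl
rgood-top (suc h) = trans (cong (rgood (suc h)) (2^suc h))
  (trans (rgood-above h (2^>0 h)) (cong (λ x → suc (complete (suc h) * x)) (rgood-top h)))

-- At excess exactly `2 ^ h` the definition takes its first clause, but both clauses then describe
-- complete children of heights h and h + 1. So the second formula holds from r = 0 on.
rgood-high : ∀ h {r} → rgood (suc h) (2 ^ h + r) ≡ suc (complete (suc h) * rgood h r)
rgood-high h {zero} = trans (cong (rgood (suc h)) (+-identityʳ (2 ^ h)))
  (trans (rgood-low h ≤-refl) (cong suc (trans (cong (complete h *_) (rgood-top h))
    (trans (*-comm (complete h) _) (cong (complete (suc h) *_) (sym (rgood-0 h)))))))
rgood-high h {suc r} = rgood-above h (s≤s z≤n)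

data Half (h : ℕ) : ℕ → Set where
  low  : ∀ {r} → r ≤ 2 ^ h → Half h r
  high : ∀ r → r ≤ 2 ^ h → Half h (2 ^ h + r)

half : ∀ h {r} → r ≤ 2 ^ suc h → Half h r
half h {r} r≤ with r ≤? 2 ^ h
... | yes r≤′ = low r≤′
... | no r≰ = subst (Half h) eq (high (r ∸ 2 ^ h)
    (+-cancelˡ-≤ (2 ^ h) _ _ (subst₂ _≤_ (sym eq) (2^suc h) r≤)))
  where
  eq : 2 ^ h + (r ∸ 2 ^ h) ≡ r
  eq = m+[n∸m]≡n (<⇒≤ (≰⇒> r≰))

complete-mono-suc : ∀ h → complete h ≤ complete (suc h)
complete-mono-suc h = m≤n⇒m≤1+n (m≤m*n (complete h) (complete h) {{nonZero h}})
  where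
  nonZero : ∀ h → NonZero (complete h)
  nonZero zero    = _
  nonZero (suc h) = _

complete-mono : ∀ {h k} → h ≤ k → complete h ≤ complete k
complete-mono {h} {k} h≤k with m≤n⇒∃[o]m+o≡n h≤k
... | d , refl = go d
  where
  go : ∀ d → complete h ≤ complete (h + d)
  go zero    = ≤-reflexive (cong complete (sym (+-identityʳ h)))
  go (suc d) = ≤-trans (go d) (≤-trans (complete-mono-suc (h + d)) (≤-reflexive (cong complete (sym (+-suc h d)))))

rgood-mono : ∀ h {r r′} → r ≤ r′ → r′ ≤ 2 ^ h → rgood h r ≤ rgood h r′
rgood-mono zero {zero} {zero} _ _ = ≤-refl
rgood-mono zero {zero} {suc r′} _ _ = s≤s (s≤s z≤n)
rgood-mono zero {suc r} {suc r′} _ _ = ≤-refl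
rgood-mono (suc h) {r} {r′} r≤r′ r′≤ with half h (≤-trans r≤r′ r′≤) | half h r′≤
... | low r≤ | low r′≤′ = subst₂ _≤_ (sym (rgood-low h r≤)) (sym (rgood-low h r′≤′))
  (s≤s (*-monoʳ-≤ (complete h) (rgood-mono h r≤r′ r′≤′)))
... | low r≤ | high s s≤ = subst₂ _≤_ (sym (rgood-low h r≤)) (sym (rgood-high h))
  (s≤s (subst (complete h * rgood h r ≤_) (*-comm (rgood h s) (complete (suc h)))
    (*-mono-≤ (subst (_≤ rgood h s) (rgood-0 h) (rgood-mono h z≤n s≤))
              (subst (rgood h r ≤_) (rgood-top h) (rgood-mono h r≤ ≤-refl)))))
-- Only r = r′ = `2 ^ h` falls here, the value at which the two halves overlap.
... | high s s≤ | low r′≤′ = subst (_≤ rgood (suc h) r′) (cong (rgood (suc h)) eq) ≤-refl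
  where
  eq : r′ ≡ 2 ^ h + s
  eq = ≤-antisym (≤-trans r′≤′ (m≤m+n _ s)) r≤r′
... | high s s≤ | high s′ s′≤ = subst₂ _≤_ (sym (rgood-high h)) (sym (rgood-high h))
  (s≤s (*-monoʳ-≤ (complete (suc h)) (rgood-mono h (+-cancelˡ-≤ (2 ^ h) _ _ r≤r′) s′≤)))

complete≤rgood : ∀ h {r} → r ≤ 2 ^ h → complete h ≤ rgood h r
complete≤rgood h {r} r≤ = subst (_≤ rgood h r) (rgood-0 h) (rgood-mono h z≤n r≤)

rgood≤complete : ∀ h {r} → r ≤ 2 ^ h → rgood h r ≤ complete (suc h)
rgood≤complete h {r} r≤ = subst (rgood h r ≤_) (rgood-top h) (rgood-mono h r≤ ≤-refl)

-- The most unbalanced pair of trees of level h with s leaves in excess of 2 ^ h in total.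
data Extreme (h : ℕ) : ℕ → ℕ → ℕ → Set where
  low  : ∀ {s} → s ≤ 2 ^ h → Extreme h s (rgood h s) (complete h)
  high : ∀ {s} → s ≤ 2 ^ h → Extreme h (2 ^ h + s) (complete (suc h)) (rgood h s)

extreme-upper : ∀ h {r s X Y} → Extreme h s X Y → r ≤ s → r ≤ 2 ^ h → rgood h r ≤ X
extreme-upper h (low s≤) r≤s r≤ = rgood-mono h r≤s s≤
extreme-upper h (high _) r≤s r≤ = rgood≤complete h r≤

-- The total is a separate equation because the sum of r₁ and r₂ would not unify with the index
-- `2 ^ h + s` of `high`.
record Dominated (h r₁ r₂ : ℕ) : Set where
  constructor dominated
  field
    {s X Y} : ℕ
    total   : s ≡ r₁ + r₂
    extreme : Extreme h s X Y
    product : rgood h r₁ * rgood h r₂ ≤ X * Y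

dominated-via : ∀ {h r₁ r₂ s X Y X′ Y′ A B} → rgood h r₁ ≡ A → rgood h r₂ ≡ B → s ≡ r₁ + r₂ →
                Extreme h s X Y → X ≡ X′ → Y ≡ Y′ → A * B ≤ X′ * Y′ → Dominated h r₁ r₂
dominated-via refl refl total ext refl refl prod = dominated total ext prod

dominated-upper : ∀ h {r₁ r₂} → r₂ ≤ 2 ^ h → (D : Dominated h r₁ r₂) → rgood h r₂ ≤ Dominated.X D
dominated-upper h {r₁} {r₂} r₂≤ (dominated refl ext _) = extreme-upper h ext (m≤n+m r₂ r₁) r₂≤

dominated-sum : ∀ h {r₁ r₂} → r₁ ≤ 2 ^ h → r₂ ≤ 2 ^ h → (D : Dominated h r₁ r₂) →
                rgood h r₁ + rgood h r₂ ≤ Dominated.X D + Dominated.Y D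
dominated-sum h {r₁} {r₂} r₁≤ r₂≤ D@(dominated refl ext prod) = sum-≤-from-product
  (extreme-upper h ext (m≤m+n r₁ r₂) r₁≤) (dominated-upper h r₂≤ D) prod

dominated-weighted : ∀ h {r₁ r₂ p q} → r₁ ≤ 2 ^ h → r₂ ≤ 2 ^ h → p ≤ q → (D : Dominated h r₁ r₂) →
  suc (p * rgood h r₁) * suc (q * rgood h r₂) ≤ suc (p * Dominated.Y D) * suc (q * Dominated.X D)
dominated-weighted h r₁≤ r₂≤ p≤q D =
  weighted-product-≤ p≤q (dominated-upper h r₂≤ D) (Dominated.product D) (dominated-sum h r₁≤ r₂≤ D)

≤2^suc : ∀ h {r} → r ≤ 2 ^ h → r ≤ 2 ^ suc h
≤2^suc h r≤ = ≤-trans r≤ (m≤m+n (2 ^ h) _)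

2^+≤2^suc : ∀ h {r} → r ≤ 2 ^ h → 2 ^ h + r ≤ 2 ^ suc h
2^+≤2^suc h {r} r≤ = subst (2 ^ h + r ≤_) (sym (2^suc h)) (+-monoʳ-≤ (2 ^ h) r≤)

-- Each tree has a complete child of height h; the other two children are replaced by their extreme
-- pair. If that pair is `high`, the four grandchildren must also be regrouped so that the complete
-- tree of height h + 1 and the rgood one share a parent; this is `shift`.
dominate-low-low : ∀ h {r₁ r₂} → r₁ ≤ 2 ^ h → r₂ ≤ 2 ^ h → Dominated h r₁ r₂ → Dominated (suc h) r₁ r₂
dominate-low-low h r₁≤ r₂≤ D with dominated-weighted h r₁≤ r₂≤ (≤-refl {complete h}) D
dominate-low-low h r₁≤ r₂≤ (dominated total (low s≤) _) | both =
  dominated-via (rgood-low h r₁≤) (rgood-low h r₂≤) total (low (≤2^suc h s≤)) (rgood-low h s≤) refl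
    (≤-trans both (≤-reflexive (*-comm (suc (complete h * complete h)) _)))
dominate-low-low h r₁≤ r₂≤ (dominated total (high s≤) _) | both =
  dominated-via (rgood-low h r₁≤) (rgood-low h r₂≤) total (low (2^+≤2^suc h s≤)) (rgood-high h) refl
    (≤-trans both (shift (complete-mono-suc h) (complete≤rgood h s≤)))
  where
  shift : ∀ {p q z} → p ≤ q → p ≤ z → suc (p * z) * suc (p * q) ≤ suc (q * z) * suc (p * p)
  shift {p} {q} {z} p≤q p≤z = begin
    suc (p * z) * suc (p * q)                 ≡⟨ e₁ p q z ⟩
    suc (p * z + q * p) + p * p * (q * z)     ≤⟨ +-monoˡ-≤ _ (s≤s (rearrange p≤q p≤z)) ⟩
    suc (p * p + q * z) + p * p * (q * z)     ≡⟨ e₂ p q z ⟩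
    suc (q * z) * suc (p * p)                 ∎
    where
    open ≤-Reasoning
    e₁ : ∀ p q z → suc (p * z) * suc (p * q) ≡ suc (p * z + q * p) + p * p * (q * z)
    e₁ = solve-∀
    e₂ : ∀ p q z → suc (p * p + q * z) + p * p * (q * z) ≡ suc (q * z) * suc (p * p)
    e₂ = solve-∀

-- The complete children have heights h and h + 1 and act as unequal weights. Pairing the larger
-- weight with the larger extreme value already yields an extreme pair, without regrouping.
dominate-low-high : ∀ h {r s} → r ≤ 2 ^ h → s ≤ 2 ^ h → Dominated h r s → Dominated (suc h) r (2 ^ h + s)
dominate-low-high h {r} {s} r≤ s≤ D with dominated-weighted h r≤ s≤ (complete-mono-suc h) D
dominate-low-high h {r} {s} r≤ s≤ (dominated total (low {t} t≤) _) | both =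
  dominated-via (rgood-low h r≤) (rgood-high h) (trans (cong (2 ^ h +_) total) (excess (2 ^ h) r s))
    (low (2^+≤2^suc h t≤)) (rgood-high h) refl (≤-trans both (≤-reflexive (*-comm (suc (complete h * complete h)) _)))
  where
  excess : ∀ c r s → c + (r + s) ≡ r + (c + s)
  excess = solve-∀
dominate-low-high h {r} {s} r≤ s≤ (dominated total (high {t} t≤) _) | both =
  dominated-via (rgood-low h r≤) (rgood-high h) total′
    (high (≤2^suc h t≤)) refl (rgood-low h t≤) (≤-trans both (≤-reflexive (*-comm (suc (complete h * rgood h t)) _)))
  where
  e₁ : ∀ c t → c + (c + 0) + t ≡ c + (c + t)
  e₁ = solve-∀
  e₂ : ∀ c r s → c + (r + s) ≡ r + (c + s)
  e₂ = solve-∀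
  total′ : 2 ^ suc h + t ≡ r + (2 ^ h + s)
  total′ = trans (e₁ (2 ^ h) t) (trans (cong (2 ^ h +_) total) (e₂ (2 ^ h) r s))

-- Mirror image of the case of two low excesses: regrouping is needed when the inner pair is `low`,
-- so that the two complete trees of height h + 1 become siblings.
dominate-high-high : ∀ h {a b} → a ≤ 2 ^ h → b ≤ 2 ^ h → Dominated h a b → Dominated (suc h) (2 ^ h + a) (2 ^ h + b)
dominate-high-high h {a} {b} a≤ b≤ D@(dominated total _ _) with dominated-weighted h a≤ b≤ (≤-refl {complete (suc h)}) D
  | trans (cong (2 ^ suc h +_) total) (excess (2 ^ h) a b)
  where
  excess : ∀ c a b → c + (c + 0) + (a + b) ≡ c + a + (c + b)
  excess = solve-∀
dominate-high-high h a≤ b≤ (dominated _ (low s≤) _) | both | total =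
  dominated-via (rgood-high h) (rgood-high h) total (high (≤2^suc h s≤)) refl (rgood-low h s≤)
    (≤-trans both (shift (complete-mono-suc h) (rgood≤complete h s≤)))
  where
  shift : ∀ {p q x} → p ≤ q → x ≤ q → suc (q * p) * suc (q * x) ≤ suc (q * q) * suc (p * x)
  shift {p} {q} {x} p≤q x≤q = begin
    suc (q * p) * suc (q * x)               ≡⟨ e₁ p q x ⟩
    suc (p * q + q * x) + q * q * (p * x)   ≤⟨ +-monoˡ-≤ _ (s≤s (rearrange p≤q x≤q)) ⟩
    suc (p * x + q * q) + q * q * (p * x)   ≡⟨ e₂ p q x ⟩
    suc (q * q) * suc (p * x)               ∎
    where
    open ≤-Reasoning
    e₁ : ∀ p q x → suc (q * p) * suc (q * x) ≡ suc (p * q + q * x) + q * q * (p * x)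
    e₁ = solve-∀
    e₂ : ∀ p q x → suc (p * x + q * q) + q * q * (p * x) ≡ suc (q * q) * suc (p * x)
    e₂ = solve-∀
dominate-high-high h a≤ b≤ (dominated _ (high {s} s≤) _) | both | total =
  dominated-via (rgood-high h) (rgood-high h) total (high (2^+≤2^suc h s≤)) refl (rgood-high h)
    (≤-trans both (≤-reflexive (*-comm (suc (complete (suc h) * rgood h s)) _)))

dominated-comm : ∀ {h r₁ r₂} → Dominated h r₁ r₂ → Dominated h r₂ r₁
dominated-comm {h} {r₁} {r₂} (dominated {_} {X} {Y} total ext prod) =
  dominated (trans total (+-comm r₁ r₂)) ext (subst (_≤ X * Y) (*-comm (rgood h r₁) _) prod)

-- Among pairs of rgood trees of one level with a given total number of leaves, the most unbalanced
-- one has the largest product of values.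
dominate : ∀ h {r₁ r₂} → r₁ ≤ 2 ^ h → r₂ ≤ 2 ^ h → Dominated h r₁ r₂
dominate zero {zero}        {zero}        _ _ = dominated refl (low z≤n) ≤-refl
dominate zero {zero}        {suc zero}    _ _ = dominated refl (low ≤-refl) ≤-refl
dominate zero {suc zero}    {zero}        _ _ = dominated refl (low ≤-refl) ≤-refl
dominate zero {suc zero}    {suc zero}    _ _ = dominated refl (high ≤-refl) ≤-refl
dominate zero {suc (suc _)} {_}           (s≤s ()) _
dominate zero {_}           {suc (suc _)} _ (s≤s ())
dominate (suc h) r₁≤ r₂≤ with half h r₁≤ | half h r₂≤
... | low r₁≤′  | low r₂≤′  = dominate-low-low h r₁≤′ r₂≤′ (dominate h r₁≤′ r₂≤′)
... | low r₁≤′  | high _ b≤ = dominate-low-high h r₁≤′ b≤ (dominate h r₁≤′ b≤)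
... | high _ a≤ | low r₂≤′  = dominated-comm (dominate-low-high h r₂≤′ a≤ (dominate h r₂≤′ a≤))
... | high _ a≤ | high _ b≤ = dominate-high-high h a≤ b≤ (dominate h a≤ b≤)

-- AtLevel h k v: v is at most the value of the rgood tree with k leaves, of level h.
record AtLevel (h k v : ℕ) : Set where
  constructor atLevel
  field
    {r}   : ℕ
    r≤    : r ≤ 2 ^ h
    k≡    : k ≡ 2 ^ h + r
    bound : v ≤ rgood h r

-- Adding a tree of lower level to one of level h raises the level by at most one.
JoinsTo : ℕ → ℕ → ℕ → Set
JoinsTo h k v = AtLevel h k v ⊎ AtLevel (suc h) k v

atLevel-≤ : ∀ {h k k′ v v′} → k ≡ k′ → v′ ≤ v → AtLevel h k v → AtLevel h k′ v′
atLevel-≤ refl v′≤v (atLevel r≤ k≡ bound) = atLevel r≤ k≡ (≤-trans v′≤v bound)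

joinsTo-≤ : ∀ {h k k′ v v′} → k ≡ k′ → v′ ≤ v → JoinsTo h k v → JoinsTo h k′ v′
joinsTo-≤ k≡ v≤ (inj₁ p) = inj₁ (atLevel-≤ k≡ v≤ p)
joinsTo-≤ k≡ v≤ (inj₂ p) = inj₂ (atLevel-≤ k≡ v≤ p)

-- An extreme pair consists of exactly the two children of an rgood tree of the next level.
join-same : ∀ h {r s} → r ≤ 2 ^ h → s ≤ 2 ^ h →
            AtLevel (suc h) (2 ^ h + r + (2 ^ h + s)) (suc (rgood h r * rgood h s))
join-same h {r} {s} r≤ s≤ with dominate h r≤ s≤
... | dominated {t} total (low t≤) prod = atLevel (≤2^suc h t≤)
      (trans (e (2 ^ h) r s) (cong (2 ^ suc h +_) (sym total)))
      (≤-trans (s≤s prod) (≤-reflexive (trans (cong suc (*-comm _ (complete h))) (sym (rgood-low h t≤)))))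
  where
  e : ∀ c r s → c + r + (c + s) ≡ c + (c + 0) + (r + s)
  e = solve-∀
... | dominated {t} total (high t≤) prod = atLevel (2^+≤2^suc h t≤)
      (trans (e (2 ^ h) r s) (cong (2 ^ suc h +_) (sym total)))
      (≤-trans (s≤s prod) (≤-reflexive (sym (rgood-high h))))
  where
  e : ∀ c r s → c + r + (c + s) ≡ c + (c + 0) + (r + s)
  e = solve-∀

-- The rotation of ((q, r), y) to (q, (r, y)): the value grows by q - y, and the complete tree q
-- becomes a child of the root.
join-below-high : ∀ h {r y k} → y ≤ complete (suc h) → AtLevel (suc h) k (suc (r * y)) →
                  AtLevel (suc (suc h)) (2 ^ suc h + k) (suc (suc (complete (suc h) * r) * y))
join-below-high h {r} {y} y≤q (atLevel {s} s≤ refl bound) = atLevel (≤2^suc (suc h) s≤)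
  (e (2 ^ suc h) s)
  (begin
    suc (y + q * r * y)       ≤⟨ s≤s (+-monoˡ-≤ _ y≤q) ⟩
    suc (q + q * r * y)       ≡⟨ e′ q r y ⟩
    suc (q * suc (r * y))     ≤⟨ s≤s (*-monoʳ-≤ q bound) ⟩
    suc (q * rgood (suc h) s) ≡⟨ rgood-low (suc h) s≤ ⟨
    rgood (suc (suc h)) s     ∎)
  where
  open ≤-Reasoning
  q : ℕ
  q = complete (suc h)
  e : ∀ c s → c + (c + s) ≡ c + (c + 0) + s
  e = solve-∀
  e′ : ∀ q r y → suc (q + q * r * y) ≡ suc (q * suc (r * y))
  e′ = solve-∀

-- A high excess is rotated to the case of equal levels. For a low one, with complete child c, the
-- other two trees of level h are replaced by their extreme pair X, Y; regrouped as (X, (c, Y)) they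
-- form an rgood tree.
join-adjacent : ∀ h {r s} → r ≤ 2 ^ suc h → s ≤ 2 ^ h →
                JoinsTo (suc h) (2 ^ suc h + r + (2 ^ h + s)) (suc (rgood (suc h) r * rgood h s))
join-adjacent h {s = s} r≤ s≤ with half h r≤
... | high a a≤ = inj₂ (atLevel-≤ (sym (e (2 ^ h) (2 ^ suc h) a s)) (≤-reflexive (cong (λ v → suc (v * rgood h s)) (rgood-high h)))
      (join-below-high h {rgood h a} (rgood≤complete h s≤) (join-same h a≤ s≤)))
  where
  e : ∀ c d a s → d + (c + a) + (c + s) ≡ d + (c + a + (c + s))
  e = solve-∀
... | low {r} r≤′ with dominate h r≤′ s≤ | dominated-upper h s≤ (dominate h r≤′ s≤)
...   | dominated {_} {X} {Y} total ext prod | s≤X = helper total ext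
        (subst (λ v → suc (v * rgood h s) ≤ suc (X + complete h * (X * Y))) (sym (rgood-low h r≤′)) (s≤s bound))
  where
  open ≤-Reasoning
  bound : suc (complete h * rgood h r) * rgood h s ≤ X + complete h * (X * Y)
  bound = begin
    rgood h s + complete h * rgood h r * rgood h s   ≡⟨ cong (rgood h s +_) (*-assoc (complete h) _ _) ⟩
    rgood h s + complete h * (rgood h r * rgood h s) ≤⟨ +-mono-≤ s≤X (*-monoʳ-≤ (complete h) prod) ⟩
    X + complete h * (X * Y)                         ∎
  helper : ∀ {t X Y} → t ≡ r + s → Extreme h t X Y →
           suc (rgood (suc h) r * rgood h s) ≤ suc (X + complete h * (X * Y)) →
           JoinsTo (suc h) (2 ^ suc h + r + (2 ^ h + s)) (suc (rgood (suc h) r * rgood h s))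
  helper {t} total (low t≤) le = inj₁ (atLevel (2^+≤2^suc h t≤)
    (trans (e (2 ^ suc h) (2 ^ h) r s) (cong (λ t → 2 ^ suc h + (2 ^ h + t)) (sym total)))
    (≤-trans le (≤-reflexive (trans (e′ (complete h) (rgood h t)) (sym (rgood-high h))))))
    where
    e : ∀ d c r s → d + r + (c + s) ≡ d + (c + (r + s))
    e = solve-∀
    e′ : ∀ p x → suc (x + p * (x * p)) ≡ suc (suc (p * p) * x)
    e′ = solve-∀
  helper total (high {t} t≤) le = inj₂ (atLevel (≤2^suc (suc h) (≤2^suc h t≤))
    (trans (e (2 ^ h) r s) (trans (cong (λ t → 2 ^ suc h + (2 ^ h + t)) (sym total)) (e′ (2 ^ h) t)))
    (≤-trans le (≤-reflexive (trans (e″ (complete h) (complete (suc h)) (rgood h t))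
      (sym (trans (rgood-low (suc h) (≤2^suc h t≤)) (cong (λ v → suc (complete (suc h) * v)) (rgood-low h t≤))))))))
    where
    e : ∀ c r s → c + (c + 0) + r + (c + s) ≡ c + (c + 0) + (c + (r + s))
    e = solve-∀
    e′ : ∀ c t → c + (c + 0) + (c + (c + t)) ≡ c + (c + 0) + (c + (c + 0) + 0) + t
    e′ = solve-∀
    e″ : ∀ p q x → suc (q + p * (q * x)) ≡ suc (q * suc (p * x))
    e″ = solve-∀

-- The complete child of the taller tree is rotated to the root, the lower tree joins the other
-- child by induction, and `finish` attaches the complete tree to the result. The rotation gains
-- since the lower tree is worth no more than the complete child.
join-below : ∀ h h′ {r s} → h′ < h → r ≤ 2 ^ h → s ≤ 2 ^ h′ →
             JoinsTo h (2 ^ h + r + (2 ^ h′ + s)) (suc (rgood h r * rgood h′ s))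
join-below (suc h) h′ {r} {s} (s≤s h′≤h) r≤ s≤ with m≤n⇒m<n∨m≡n h′≤h
... | inj₂ refl = join-adjacent h r≤ s≤
... | inj₁ h′<h with half h r≤
...   | low {r} r≤′ = joinsTo-≤ (e (2 ^ h) r (2 ^ h′ + s)) le (finish (join-below h h′ h′<h r≤′ s≤))
  where
  y : ℕ
  y = rgood h′ s
  e : ∀ c r j → c + r + j + (c + 0) ≡ c + (c + 0) + r + j
  e = solve-∀
  y≤ : y ≤ complete h
  y≤ = ≤-trans (rgood≤complete h′ s≤) (complete-mono h′<h)
  le : suc (rgood (suc h) r * y) ≤ suc (suc (rgood h r * y) * complete h)
  le = begin
    suc (rgood (suc h) r * y)            ≡⟨ cong (λ v → suc (v * y)) (rgood-low h r≤′) ⟩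
    suc (y + complete h * rgood h r * y) ≤⟨ s≤s (+-monoˡ-≤ _ y≤) ⟩
    suc (complete h + complete h * rgood h r * y) ≡⟨ e′ (complete h) (rgood h r) y ⟩
    suc (suc (rgood h r * y) * complete h) ∎
    where
    open ≤-Reasoning
    e′ : ∀ p x y → suc (p + p * x * y) ≡ suc (suc (x * y) * p)
    e′ = solve-∀
  finish : ∀ {k v} → JoinsTo h k v → JoinsTo (suc h) (k + (2 ^ h + 0)) (suc (v * complete h))
  finish (inj₁ (atLevel {t} t≤ refl bound)) = inj₁ (atLevel-≤ refl
    (s≤s (≤-trans (*-monoˡ-≤ (complete h) bound) (≤-reflexive (cong (rgood h t *_) (sym (rgood-0 h))))))
    (join-same h t≤ z≤n))
  finish (inj₂ (atLevel {t} t≤ refl bound)) = joinsTo-≤ refl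
    (s≤s (≤-trans (*-monoˡ-≤ (complete h) bound) (≤-reflexive (cong (rgood (suc h) t *_) (sym (rgood-0 h))))))
    (join-adjacent h t≤ z≤n)
...   | high a a≤ = joinsTo-≤ (e (2 ^ suc h) (2 ^ h) a (2 ^ h′ + s)) le (finish (join-below h h′ h′<h a≤ s≤))
  where
  y : ℕ
  y = rgood h′ s
  q : ℕ
  q = complete (suc h)
  e : ∀ d c a j → d + (c + a + j) ≡ d + (c + a) + j
  e = solve-∀
  y≤ : y ≤ q
  y≤ = ≤-trans (rgood≤complete h′ s≤) (complete-mono (≤-trans h′<h (n≤1+n h)))
  le : suc (rgood (suc h) (2 ^ h + a) * y) ≤ suc (q * suc (rgood h a * y))
  le = begin
    suc (rgood (suc h) (2 ^ h + a) * y) ≡⟨ cong (λ v → suc (v * y)) (rgood-high h) ⟩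
    suc (y + q * rgood h a * y)         ≤⟨ s≤s (+-monoˡ-≤ _ y≤) ⟩
    suc (q + q * rgood h a * y)         ≡⟨ e′ q (rgood h a) y ⟩
    suc (q * suc (rgood h a * y))       ∎
    where
    open ≤-Reasoning
    e′ : ∀ q x y → suc (q + q * x * y) ≡ suc (q * suc (x * y))
    e′ = solve-∀
  finish : ∀ {k v} → JoinsTo h k v → JoinsTo (suc h) (2 ^ suc h + k) (suc (q * v))
  finish (inj₁ (atLevel {t} t≤ refl bound)) = inj₁ (atLevel (2^+≤2^suc h t≤) refl
    (≤-trans (s≤s (*-monoʳ-≤ q bound)) (≤-reflexive (sym (rgood-high h)))))
  finish (inj₂ (atLevel {t} t≤ refl bound)) = inj₂ (atLevel (≤2^suc (suc h) t≤) (e″ (2 ^ suc h) t)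
    (≤-trans (s≤s (*-monoʳ-≤ q bound)) (≤-reflexive (sym (rgood-low (suc h) t≤)))))
    where
    e″ : ∀ c s → c + (c + s) ≡ c + (c + 0) + s
    e″ = solve-∀

leaves : BT → ℕ
leaves leaf       = 1
leaves (node s t) = leaves s + leaves t

value : BT → ℕ
value t = suc (rootSubtrees t)

value≤rgood : ∀ t → ∃[ h ] AtLevel h (leaves t) (value t)
value≤rgood leaf = 0 , atLevel z≤n refl ≤-refl
value≤rgood (node s t) with value≤rgood s | value≤rgood t
... | h , atLevel {a} a≤ k≡ x≤ | h′ , atLevel {b} b≤ k′≡ y≤ with <-cmp h h′
... | tri≈ _ refl _ = suc h , atLevel-≤ (sym (cong₂ _+_ k≡ k′≡)) (s≤s (*-mono-≤ x≤ y≤)) (join-same h a≤ b≤)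
... | tri> _ _ h′<h = drop (joinsTo-≤ (sym (cong₂ _+_ k≡ k′≡)) (s≤s (*-mono-≤ x≤ y≤)) (join-below h h′ h′<h a≤ b≤))
  where
  drop : ∀ {h k v} → JoinsTo h k v → ∃[ h ] AtLevel h k v
  drop (inj₁ p) = _ , p
  drop (inj₂ p) = _ , p
... | tri< h<h′ _ _ = drop (joinsTo-≤ (trans (+-comm (2 ^ h′ + b) _) (sym (cong₂ _+_ k≡ k′≡)))
        (≤-trans (s≤s (*-mono-≤ x≤ y≤)) (≤-reflexive (cong suc (*-comm (rgood h a) _)))) (join-below h′ h h<h′ b≤ a≤))
  where
  drop : ∀ {h k v} → JoinsTo h k v → ∃[ h ] AtLevel h k v
  drop (inj₁ p) = _ , p
  drop (inj₂ p) = _ , p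

-- The number of leaves fixes the level except at powers of two, where a complete tree is counted at
-- its own height with excess 0 and one level below with full excess.
rgood-unique : ∀ {h h′ r r′} → r ≤ 2 ^ h → r′ ≤ 2 ^ h′ → 2 ^ h + r ≡ 2 ^ h′ + r′ → rgood h r ≤ rgood h′ r′
rgood-unique {h} {h′} {r} {r′} r≤ r′≤ eq with <-cmp h h′
... | tri≈ _ refl _ = ≤-reflexive (cong (rgood h) (+-cancelˡ-≡ (2 ^ h) r r′ eq))
... | tri< h<h′ _ _ = ≤-trans (rgood≤complete h r≤) (≤-trans (complete-mono h<h′) (complete≤rgood h′ r′≤))
... | tri> _ _ h′<h = subst₂ (λ r r′ → rgood h r ≤ rgood h′ r′) (sym r≡0) (sym r′≡)
    (subst₂ _≤_ (sym (rgood-0 h)) (sym (rgood-top h′)) (≤-reflexive (cong complete (sym h≡))))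
  where
  total≤ : 2 ^ h + r ≤ 2 ^ suc h′
  total≤ = subst (_≤ 2 ^ suc h′) (sym eq) (2^+≤2^suc h′ r′≤)
  h≡ : suc h′ ≡ h
  h≡ with m≤n⇒m<n∨m≡n h′<h
  ... | inj₂ e   = e
  ... | inj₁ lt  = contradiction (≤-trans (m≤m+n (2 ^ h) r) total≤) (<⇒≱ (^-monoʳ-< 2 (s≤s (s≤s z≤n)) lt))
  r≡0 : r ≡ 0
  r≡0 = n≤0⇒n≡0 (+-cancelˡ-≤ (2 ^ h) r 0 (subst (2 ^ h + r ≤_) (trans (cong (2 ^_) h≡) (sym (+-identityʳ _))) total≤))
  r′≡ : r′ ≡ 2 ^ h′
  r′≡ = +-cancelˡ-≡ (2 ^ h′) _ _ (trans (sym eq) (trans (cong (2 ^ h +_) r≡0)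
    (trans (+-identityʳ _) (trans (cong (2 ^_) (sym h≡)) (2^suc h′)))))

-- Rgood shapes and their optimality

data Complete : ℕ → BT → Set where
  leaf : Complete 0 leaf
  node : ∀ {h s t} → Complete h s → Complete h t → Complete (suc h) (node s t)

CompleteNear : ℕ → BT → Set
CompleteNear h t = Complete h t ⊎ Complete (suc h) t

-- The shape of an rgood tree whose leaves have heights h and h + 1: the condition on the last level
-- means that of any two siblings at least one is complete.
data RGood : ℕ → BT → Set where
  leaf   : RGood 0 leaf
  cherry : RGood 0 (node leaf leaf)
  node   : ∀ {h s t} → RGood h s → RGood h t → CompleteNear h s ⊎ CompleteNear h t → RGood (suc h) (node s t)

record Exactly (h : ℕ) (t : BT) : Set where
  constructor exactly
  field
    {r}    : ℕ
    r≤     : r ≤ 2 ^ h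
    leaves≡ : leaves t ≡ 2 ^ h + r
    value≡  : value t ≡ rgood h r

complete-leaves : ∀ {h t} → Complete h t → leaves t ≡ 2 ^ h
complete-leaves leaf = refl
complete-leaves (node {h} s t) = trans (cong₂ _+_ (complete-leaves s) (complete-leaves t)) (sym (2^suc h))

complete-value : ∀ {h t} → Complete h t → value t ≡ complete h
complete-value leaf = refl
complete-value (node s t) = cong suc (cong₂ _*_ (complete-value s) (complete-value t))

-- The height of the complete child selects the clause of `rgood`.
exactly-node : ∀ {h s t} → CompleteNear h s → Exactly h t → Exactly (suc h) (node s t)
exactly-node {h} (inj₁ cs) (exactly {r} r≤ l v) = exactly (≤2^suc h r≤)
  (trans (cong₂ _+_ (complete-leaves cs) l) (e (2 ^ h) r))
  (trans (cong suc (cong₂ _*_ (complete-value cs) v)) (sym (rgood-low h r≤)))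
  where
  e : ∀ c r → c + (c + r) ≡ c + (c + 0) + r
  e = solve-∀
exactly-node {h} (inj₂ cs) (exactly r≤ l v) = exactly (2^+≤2^suc h r≤) (cong₂ _+_ (complete-leaves cs) l)
  (trans (cong suc (cong₂ _*_ (complete-value cs) v)) (sym (rgood-high h)))

rgood-exact : ∀ {h t} → RGood h t → Exactly h t
rgood-exact leaf   = exactly z≤n refl refl
rgood-exact cherry = exactly ≤-refl refl refl
rgood-exact (node rs rt (inj₁ cs)) = exactly-node cs (rgood-exact rt)
rgood-exact (node {s = s} rs rt (inj₂ ct)) with exactly-node ct (rgood-exact rs)
... | exactly r≤ l v = exactly r≤ (trans (+-comm (leaves s) _) l) (trans (cong suc (*-comm (value s) _)) v)

1+size≡2*leaves : ∀ t → suc (size t) ≡ 2 * leaves t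
1+size≡2*leaves leaf = refl
1+size≡2*leaves (node s t) = trans (e (size s) (size t))
  (trans (cong₂ _+_ (1+size≡2*leaves s) (1+size≡2*leaves t)) (sym (*-distribˡ-+ 2 (leaves s) (leaves t))))
  where
  e : ∀ a b → suc (suc (a + b)) ≡ suc a + suc b
  e = solve-∀

rgood-optimal : ∀ {h s t} → RGood h t → size s ≡ size t → rootSubtrees s ≤ rootSubtrees t
rgood-optimal {h} {s} {t} rt size≡ with value≤rgood s | rgood-exact rt
... | h′ , atLevel r′≤ l′ v′ | exactly r≤ l v =
  ≤-pred (≤-trans v′ (≤-trans (rgood-unique {h′} {h} r′≤ r≤ (trans (sym l′) (trans leaves≡ l))) (≤-reflexive (sym v))))
  where
  leaves≡ : leaves s ≡ leaves t
  leaves≡ = *-cancelˡ-≡ _ _ 2 (trans (sym (1+size≡2*leaves s)) (trans (cong suc size≡) (1+size≡2*leaves t)))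

-- Caterpillars

data Caterpillar : BT → Set where
  leaf : Caterpillar leaf
  node : ∀ {t} → Caterpillar t → Caterpillar (node leaf t)

-- With A = 2^a and B = 2^b for the two children, the claim becomes 6 A B ≤ 2 + (3 A - 1)(3 B - 1).
caterpillar-minimal : ∀ t → ∃[ j ] (size t ≡ suc (2 * j) × 3 * 2 ^ j ≤ 2 + rootSubtrees t)
caterpillar-minimal leaf = 0 , refl , ≤-refl
caterpillar-minimal (node s t) with caterpillar-minimal s | caterpillar-minimal t
... | a , sa , 3a≤ | b , sb , 3b≤ = suc (a + b) , trans (cong suc (cong₂ _+_ sa sb)) (e₀ a b) ,
    subst (λ z → 3 * (2 * z) ≤ 2 + value s * value t) (sym (^-distribˡ-+-* 2 a b))
      (bound (2^>0 a) (2^>0 b) 3a≤ 3b≤)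
  where
  e₀ : ∀ a b → suc (suc (2 * a) + suc (2 * b)) ≡ suc (2 * suc (a + b))
  e₀ = solve-∀
  bound : ∀ {A B x y} → 0 < A → 0 < B → 3 * A ≤ suc x → 3 * B ≤ suc y → 3 * (2 * (A * B)) ≤ 2 + x * y
  bound {suc A} {suc B} {x} {y} _ _ 3A≤ 3B≤ = begin
    -- The slack 3 A B, in the predecessors of the two powers, vanishes exactly when one child is a
    -- leaf.
    3 * (2 * (suc A * suc B))           ≤⟨ m≤m+n _ (3 * (A * B)) ⟩
    3 * (2 * (suc A * suc B)) + 3 * (A * B) ≡⟨ e₁ A B ⟩
    2 + (2 + 3 * A) * (2 + 3 * B)       ≤⟨ +-monoʳ-≤ 2 (*-mono-≤ (≤-pred (subst (_≤ suc x) (e₂ A) 3A≤)) (≤-pred (subst (_≤ suc y) (e₂ B) 3B≤))) ⟩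
    2 + x * y                           ∎
    where
    open ≤-Reasoning
    e₁ : ∀ A B → 3 * (2 * (suc A * suc B)) + 3 * (A * B) ≡ 2 + (2 + 3 * A) * (2 + 3 * B)
    e₁ = solve-∀
    e₂ : ∀ A → 3 * suc A ≡ suc (2 + 3 * A)
    e₂ = solve-∀

caterpillar-value : ∀ {t} → Caterpillar t → ∃[ j ] (size t ≡ suc (2 * j) × 2 + rootSubtrees t ≡ 3 * 2 ^ j)
caterpillar-value leaf = 0 , refl , refl
caterpillar-value (node {t} c) with caterpillar-value c
... | j , s , v = suc j , trans (cong (λ x → suc (suc x)) s) (e₀ j) , trans (e₁ (rootSubtrees t)) (trans (cong (2 *_) v) (e₂ (2 ^ j)))
  where
  e₀ : ∀ j → suc (suc (suc (2 * j))) ≡ suc (2 * suc j)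
  e₀ = solve-∀
  e₁ : ∀ v → 2 + 2 * suc v ≡ 2 * (2 + v)
  e₁ = solve-∀
  e₂ : ∀ z → 2 * (3 * z) ≡ 3 * (2 * z)
  e₂ = solve-∀

-- Loop erasure

data EndsIn {A : Set} (u : A) : List A → Set where
  end  : EndsIn u (u ∷ [])
  cons : ∀ {a b xs} → EndsIn u (b ∷ xs) → EndsIn u (a ∷ b ∷ xs)

endsIn⇒∷ʳ : ∀ {A : Set} {u : A} {xs} → EndsIn u xs → ∃[ zs ] xs ≡ zs ∷ʳ u
endsIn⇒∷ʳ end = [] , refl
endsIn⇒∷ʳ (cons {a} e) with endsIn⇒∷ʳ e
... | zs , eq = a ∷ zs , cong (a ∷_) eq

module _ {n : ℕ} {R : Rel (Fin n) 0ℓ} where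

  SimplePath : Fin n → Fin n → Set
  SimplePath a u = ∃[ p ] (Linked R (a ∷ p) × Unique (a ∷ p) × EndsIn u (a ∷ p))

  path-from : ∀ {a u xs} → a ∈ˡ xs → Linked R xs → Unique xs → EndsIn u xs → SimplePath a u
  path-from (here refl) l q e = _ , l , q , e
  path-from (there a∈) (_ ∷ l) (_ ∷ q) (cons e) = path-from a∈ l q e

  erase-loops : ∀ {a u} → Star R a u → SimplePath a u
  erase-loops ε = [] , [-] , [] ∷ [] , end
  erase-loops {a} (_◅_ {j = b} r s) with erase-loops s
  ... | p , l , q , e with DecMembership._∈?_ Finₚ._≟_ a (b ∷ p)
  ...   | yes a∈ = path-from a∈ l q e
  ...   | no a∉  = b ∷ p , r ∷ l , ¬Any⇒All¬ _ a∉ ∷ q , cons e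

-- A simple path from v to u that avoids the edge u v closes to a cycle with it. Paths with fewer
-- than two edges would mean u = v or the deleted edge itself.
acyclic⇒bridged : ∀ {n} (G : Graph n) → Acyclic G → Bridged G
acyclic⇒bridged G acyclic {u} {v} u~v s with erase-loops s
... | []        , _ , _ , end = Graph.~-irrefl G refl u~v
... | (b ∷ [])  , (_ , _ , ¬exit) ∷ _ , _ , cons end = ¬exit (refl , refl)
... | (b ∷ c ∷ p) , l , q , cons (cons e) with endsIn⇒∷ʳ e
...   | zs , eq = acyclic v b zs u
        (Linked.map proj₁ (subst (λ xs → Linked (OffEdge G u v) (v ∷ b ∷ xs)) eq l) , subst (λ xs → Unique (v ∷ b ∷ xs)) eq q)
        u~v

-- Degrees and distances

module _ {n : ℕ} (G : Graph n) where
  open Graph G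

  record RootFork (r w₁ w₂ : Fin n) : Set where
    field
      r~w₁  : r ~ w₁
      r~w₂  : r ~ w₂
      w₁≢w₂ : w₁ ≢ w₂
      nbrs⊆ : ∀ {w} → r ~ w → w ≡ w₁ ⊎ w ≡ w₂

  -- Degree one or three as seen on arrival from any neighbour, which is what recursion along
  -- branches asks for.
  CubicAt : Fin n → Set
  CubicAt v = ∀ {u} → u ~ v → OnlyNbr G u v ⊎ ∃[ w₁ ] ∃[ w₂ ] Fork G u v w₁ w₂

  private
    nbrList : Fin n → List (Fin n)
    nbrList v = filter (v ~?_) (allFin n)

    nbrList-unique : ∀ v → Unique (nbrList v)
    nbrList-unique v = Uniqueₚ.filter⁺ (v ~?_) (Uniqueₚ.allFin⁺ n)

    ∈-nbrList⁺ : ∀ {v w} → v ~ w → w ∈ˡ nbrList v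
    ∈-nbrList⁺ {v} {w} = ∈-filter⁺ (v ~?_) (∈-allFin w)

    ∈-nbrList⁻ : ∀ {v w} → w ∈ˡ nbrList v → v ~ w
    ∈-nbrList⁻ {v} w∈ = proj₂ (∈-filter⁻ (v ~?_) {xs = allFin n} w∈)

  degree-from-list : ∀ {v xs} → Unique xs → (∀ {w} → v ~ w → w ∈ˡ xs) → (∀ {w} → w ∈ˡ xs → v ~ w) →
                     degree G v ≡ length xs
  degree-from-list uniq to from = length-cong-∈ (nbrList-unique _) uniq (to ∘ ∈-nbrList⁻) (∈-nbrList⁺ ∘ from)

  onlyNbr⇒degree : ∀ {u v} → v ~ u → OnlyNbr G u v → degree G v ≡ 1
  onlyNbr⇒degree v~u only = degree-from-list ([] ∷ []) (here ∘ only) λ { (here refl) → v~u }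

  degree1⇒onlyNbr : ∀ {u v} → u ~ v → degree G v ≡ 1 → OnlyNbr G u v
  degree1⇒onlyNbr {u} {v} u~v one v~w = helper (nbrList v) one (∈-nbrList⁺ (~-sym u~v)) (∈-nbrList⁺ v~w)
    where
    helper : ∀ xs → length xs ≡ 1 → u ∈ˡ xs → _ ∈ˡ xs → _ ≡ u
    helper (_ ∷ []) _ (here refl) (here refl) = refl

  degree3⇒fork : ∀ {u v} → u ~ v → degree G v ≡ 3 → ∃[ w₁ ] ∃[ w₂ ] Fork G u v w₁ w₂
  degree3⇒fork {u} {v} u~v three =
    helper (nbrList v) three (nbrList-unique v) (∈-nbrList⁺ (~-sym u~v)) ∈-nbrList⁻ ∈-nbrList⁺
    where
    helper : ∀ xs → length xs ≡ 3 → Unique xs → u ∈ˡ xs → (∀ {w} → w ∈ˡ xs → v ~ w) → (∀ {w} → v ~ w → w ∈ˡ xs) →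
             ∃[ w₁ ] ∃[ w₂ ] Fork G u v w₁ w₂
    helper (a ∷ b ∷ c ∷ []) _ ((a≢b ∷ a≢c ∷ []) ∷ (b≢c ∷ []) ∷ _) (here refl) to from = b , c , record
      { v~w₁ = to (there (here refl)) ; v~w₂ = to (there (there (here refl))) ; w₁≢u = a≢b ∘ sym ; w₂≢u = a≢c ∘ sym
      ; w₁≢w₂ = b≢c ; nbrs⊆ = λ v~w → cases (from v~w) }
      where
      cases : ∀ {w} → w ∈ˡ a ∷ b ∷ c ∷ [] → w ≡ a ⊎ w ≡ b ⊎ w ≡ c
      cases (here e)                 = inj₁ e
      cases (there (here e))         = inj₂ (inj₁ e)
      cases (there (there (here e))) = inj₂ (inj₂ e)
    helper (a ∷ b ∷ c ∷ []) _ ((a≢b ∷ a≢c ∷ []) ∷ (b≢c ∷ []) ∷ _) (there (here refl)) to from = a , c , record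
      { v~w₁ = to (here refl) ; v~w₂ = to (there (there (here refl))) ; w₁≢u = a≢b ; w₂≢u = b≢c ∘ sym
      ; w₁≢w₂ = a≢c ; nbrs⊆ = λ v~w → cases (from v~w) }
      where
      cases : ∀ {w} → w ∈ˡ a ∷ b ∷ c ∷ [] → w ≡ b ⊎ w ≡ a ⊎ w ≡ c
      cases (here e)                 = inj₂ (inj₁ e)
      cases (there (here e))         = inj₁ e
      cases (there (there (here e))) = inj₂ (inj₂ e)
    helper (a ∷ b ∷ c ∷ []) _ ((a≢b ∷ a≢c ∷ []) ∷ (b≢c ∷ []) ∷ _) (there (there (here refl))) to from = a , b , record
      { v~w₁ = to (here refl) ; v~w₂ = to (there (here refl)) ; w₁≢u = a≢c ; w₂≢u = b≢c
      ; w₁≢w₂ = a≢b ; nbrs⊆ = λ v~w → cases (from v~w) }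
      where
      cases : ∀ {w} → w ∈ˡ a ∷ b ∷ c ∷ [] → w ≡ c ⊎ w ≡ a ⊎ w ≡ b
      cases (here e)                 = inj₂ (inj₁ e)
      cases (there (here e))         = inj₂ (inj₂ e)
      cases (there (there (here e))) = inj₁ e

  degree2⇒rootFork : ∀ {r} → degree G r ≡ 2 → ∃[ w₁ ] ∃[ w₂ ] RootFork r w₁ w₂
  degree2⇒rootFork {r} two = helper (nbrList r) two (nbrList-unique r) ∈-nbrList⁻ ∈-nbrList⁺
    where
    helper : ∀ xs → length xs ≡ 2 → Unique xs → (∀ {w} → w ∈ˡ xs → r ~ w) → (∀ {w} → r ~ w → w ∈ˡ xs) →
             ∃[ w₁ ] ∃[ w₂ ] RootFork r w₁ w₂
    helper (a ∷ b ∷ []) _ ((a≢b ∷ []) ∷ _) to from = a , b , record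
      { r~w₁ = to (here refl) ; r~w₂ = to (there (here refl)) ; w₁≢w₂ = a≢b ; nbrs⊆ = λ r~w → cases (from r~w) }
      where
      cases : ∀ {w} → w ∈ˡ a ∷ b ∷ [] → w ≡ a ⊎ w ≡ b
      cases (here e)         = inj₁ e
      cases (there (here e)) = inj₂ e

  degree⇒cubicAt : ∀ {v} → degree G v ≡ 1 ⊎ degree G v ≡ 3 → CubicAt v
  degree⇒cubicAt (inj₁ one) u~v   = inj₁ (degree1⇒onlyNbr u~v one)
  degree⇒cubicAt (inj₂ three) u~v = inj₂ (degree3⇒fork u~v three)

  private
    walkLengths : Fin n → Fin n → List ℕ
    walkLengths u v = filter (λ k → walk? G k u v) (upTo n)

  dist-≤ : ∀ {k u v} → Walk G k u v → dist G u v ≤ k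
  dist-≤ {k} {u} {v} walk with k <? n
  ... | yes k<n = All.lookup (min≤xs n (walkLengths u v)) (∈-filter⁺ (λ k → walk? G k u v) (∈-upTo⁺ k<n) walk)
  ... | no k≮n  = ≤-trans (min≤⊤ n (walkLengths u v)) (≮⇒≥ k≮n)

  -- The bound d ≤ n covers the default value n of the minimum.
  dist-≥ : ∀ {d u v} → d ≤ n → (∀ {k} → Walk G k u v → d ≤ k) → d ≤ dist G u v
  dist-≥ {d} {u} {v} d≤n bound = v≤min⁺ {xs = walkLengths u v} d≤n
    (All.tabulate λ k∈ → bound (proj₂ (∈-filter⁻ (λ k → walk? G k u v) {xs = upTo n} k∈)))

  trail-snoc : ∀ {u v x y z k} → Trail G u v x y k → y ~ z → z ≢ x → Trail G u v y z (suc k)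
  trail-snoc (single u~v) y~z z≢x          = extend u~v z≢x (single y~z)
  trail-snoc (extend u~v w≢u rest) y~z z≢x = extend u~v w≢u (trail-snoc rest y~z z≢x)

module Distances {n : ℕ} (G : Graph n) (conn : Connected G) (bridged : Bridged G) where
  open Graph G
  open Sides G conn bridged
  open BranchCounting G conn bridged

  trail-sideSize : ∀ {u v x y k} → Trail G u v x y k → sideSize G x y + k ≤ sideSize G u v
  trail-sideSize (single _) = ≤-reflexive (+-identityʳ _)
  trail-sideSize {u} {v} {x} {y} {suc k} (extend u~v w≢u rest) = begin
    sideSize G x y + suc k   ≡⟨ +-suc _ k ⟩
    suc (sideSize G x y + k) ≤⟨ s≤s (trail-sideSize rest) ⟩
    suc (sideSize G v _)     ≤⟨ sideSize-child u~v (trail-first G rest) w≢u ⟩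
    sideSize G u v           ∎
    where open ≤-Reasoning

  -- Without backtracking a walk in a tree is shortest: any other walk, reversed, must leave all the
  -- sides along the trail.
  trail-dist : ∀ {u v x y k} → Trail G u v x y k → dist G u y ≡ suc k
  trail-dist {u} {v} {x} {y} {k} trail = ≤-antisym (dist-≤ G (trail-walk G trail))
    (dist-≥ G suc-k≤n λ {m} walk → trail-length trail ε (bridged (trail-first G trail)) (walk-reverse G m walk))
    where
    open ≤-Reasoning
    suc-k≤n : suc k ≤ n
    suc-k≤n = begin
      suc k                           ≤⟨ +-monoˡ-≤ k (sideSize>0 x y) ⟩
      sideSize G x y + k              ≤⟨ trail-sideSize trail ⟩
      sideSize G u v                  ≤⟨ m≤m+n _ _ ⟩
      sideSize G u v + sideSize G v u ≡⟨ sideSize-complement (trail-first G trail) ⟩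
      n                               ∎

  dist-refl : ∀ {u} → dist G u u ≡ 0
  dist-refl = n≤0⇒n≡0 (dist-≤ G {0} refl)

  trail-to : ∀ {a b} → a ≢ b → ∃[ v ] ∃[ x ] ∃[ k ] Trail G a v x b k
  trail-to {a} {b} a≢b = let k , walk = star⇒walk G (conn a b) in go k (<-wellFounded k) walk
    where
    go : ∀ k → Acc _<_ k → Walk G k a b → ∃[ v ] ∃[ x ] ∃[ k ] Trail G a v x b k
    go zero    _         refl = contradiction refl a≢b
    go (suc k) (acc rec) walk with trail-or-shorter G k walk
    ... | inj₁ (v , x , trail)   = v , x , k , trail
    ... | inj₂ (m , m< , walk′) = go m (rec m<) walk′

  branch-of : ∀ {u v} → u ~ v → (∀ {x} → Side G u v x → CubicAt G x) → ∃[ t ] Branch G u v t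
  branch-of {u} {v} = go (<-wellFounded (sideSize G u v))
    where
    go : ∀ {u v} → Acc _<_ (sideSize G u v) → u ~ v → (∀ {x} → Side G u v x → CubicAt G x) → ∃[ t ] Branch G u v t
    go (acc rec) u~v cubic with cubic ε u~v
    ... | inj₁ only = leaf , leaf u~v only
    ... | inj₂ (w₁ , w₂ , f) with go (rec (sideSize-child u~v v~w₁ w₁≢u)) v~w₁ (cubic ∘ side-child u~v v~w₁ w₁≢u)
                                | go (rec (sideSize-child u~v v~w₂ w₂≢u)) v~w₂ (cubic ∘ side-child u~v v~w₂ w₂≢u)
      where open Fork f
    ...   | s , b₁ | t , b₂ = node s t , node u~v f b₁ b₂

  branchCount-rootFork : ∀ {r w₁ w₂} → RootFork G r w₁ w₂ →
                         subtreeCount G r ≡ suc (branchCount G r w₁) * suc (branchCount G r w₂)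
  branchCount-rootFork {r} {w₁} {w₂} f =
    trans (subtreeCount≡avoidingCount G r)
    (trans (avoidingCount-edge r~w₁ [] λ ())
    (trans (*-comm _ (suc (branchCount G r w₁)))
    (cong (suc (branchCount G r w₁) *_)
      (trans (avoidingCount-edge r~w₂ (r~w₁ ∷ []) (λ { (here e) → w₁≢w₂ (sym e) }))
      (trans (cong (_* suc (branchCount G r w₂)) (avoidingCount-all covers ((~⇒≢ G r~w₂ ∘ sym) ∷ (~⇒≢ G r~w₁ ∘ sym) ∷ [])))
             (*-identityˡ _))))))
    where
    open RootFork f
    open SubtreeCounting G conn bridged using (avoidingCount-edge; avoidingCount-all)
    covers : ∀ {w} → r ~ w → w ∈ˡ w₂ ∷ w₁ ∷ []
    covers r~w with nbrs⊆ r~w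
    ... | inj₁ e = there (here e)
    ... | inj₂ e = here e

  sideSize-rootFork : ∀ {r w₁ w₂} → RootFork G r w₁ w₂ → n ≡ suc (sideSize G r w₁ + sideSize G r w₂)
  sideSize-rootFork {r} {w₁} {w₂} f = trans
    (trans (sym (length-allFin n)) (sym (cong length (filter-all all? (All.tabulate {xs = allFin n} λ _ → refl)))))
    (count-root+children all? r~w₁ r~w₂ w₁≢w₂ (λ {x} _ → split x) refl (λ _ → refl) (λ _ → refl))
    where
    open RootFork f
    all? : Decidable₁ {A = Fin n} (λ _ → 0 ≡ 0)
    all? _ = yes refl
    split : ∀ x → x ≡ r ⊎ Side G r w₁ x ⊎ Side G r w₂ x
    split x with r Finₚ.≟ x
    ... | yes refl = inj₁ refl
    ... | no r≢x with side-toward r≢x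
    ...   | w , r~w , x∈ with nbrs⊆ r~w
    ...     | inj₁ refl = inj₂ (inj₁ x∈)
    ...     | inj₂ refl = inj₂ (inj₂ x∈)

-- From rgood graphs to rgood shapes

record RootedShape {n} (G : Graph n) (r : Fin n) (t : BT) : Set where
  constructor rootedShape
  field
    {w₁ w₂} : Fin n
    {s₁ s₂} : BT
    fork    : RootFork G r w₁ w₂
    branch₁ : Branch G r w₁ s₁
    branch₂ : Branch G r w₂ s₂
    shape≡  : t ≡ node s₁ s₂

module RootedTree {n : ℕ} (R : Graph n) (r : Fin n) (tree : IsTree R) (n≢1 : n ≢ 1)
                  (rooted : IsRootedBinaryTree R r) where
  open Graph R

  private
    conn = proj₁ (proj₂ tree)
    bridged = acyclic⇒bridged R (proj₂ (proj₂ tree))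
  open Sides R conn bridged
  open BranchCounting R conn bridged
  open Distances R conn bridged

  private
    degrees : degree R r ≡ 2 × (∀ v → v ≢ r → degree R v ≡ 1 ⊎ degree R v ≡ 3)
    degrees = [ (λ n≡1 → contradiction n≡1 n≢1) , id ]′ (proj₂ rooted)

  cubicAt : ∀ {v} → v ≢ r → CubicAt R v
  cubicAt v≢r = degree⇒cubicAt R (proj₂ degrees _ v≢r)

  rooted-shape : ∃[ t ] RootedShape R r t
  rooted-shape with degree2⇒rootFork R (proj₁ degrees)
  ... | w₁ , w₂ , f with branch-of r~w₁ (λ x∈ → cubicAt λ { refl → bridged r~w₁ x∈ })
                       | branch-of r~w₂ (λ x∈ → cubicAt λ { refl → bridged r~w₂ x∈ })
    where open RootFork f
  ...   | s₁ , b₁ | s₂ , b₂ = node s₁ s₂ , rootedShape f b₁ b₂ refl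

  shape-count : ∀ {t} → RootedShape R r t → subtreeCount R r ≡ rootSubtrees t
  shape-count (rootedShape f b₁ b₂ refl) =
    trans (branchCount-rootFork f) (cong₂ (λ x y → suc x * suc y) (branch-count b₁) (branch-count b₂))

  shape-size : ∀ {t} → RootedShape R r t → n ≡ size t
  shape-size (rootedShape f b₁ b₂ refl) =
    trans (sideSize-rootFork f) (cong suc (cong₂ _+_ (branch-size b₁) (branch-size b₂)))

module RGoodTree {n : ℕ} (R : Graph n) (r : Fin n) (n≢1 : n ≢ 1) (rgood : IsRgood R r)
                 (top : Fin n) (≤top : ∀ w → level R r w ≤ level R r top) where
  open Graph R

  private
    tree = proj₁ (proj₁ rgood)
    conn = proj₁ (proj₂ tree)
    bridged = acyclic⇒bridged R (proj₂ (proj₂ tree))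
  open Distances R conn bridged
  open RootedTree R r tree n≢1 (proj₁ rgood)

  private
    lv = level R r
    pendants-close = proj₁ (proj₂ rgood)
    open Ordering (proj₁ (proj₂ (proj₂ rgood)))
    final-segment = proj₂ (proj₂ (proj₂ rgood))

  -- Position p v t k h: v is at level k + 1 with parent p and branch t, and the top level is k + h + 2.
  record Position (p v : Fin n) (t : BT) (k h : ℕ) : Set where
    constructor position
    field
      {a}    : Fin n
      trail  : Trail R r a p v k
      branch : Branch R p v t
      height : suc (suc (k + h)) ≡ lv top

  child-parentOf : ∀ {a p v w k} → Trail R r a p v k → v ~ w → w ≢ p → _ParentOf_ R r v w
  child-parentOf trail v~w w≢p =
    v~w , trans (trail-dist (trail-snoc R trail v~w w≢p)) (cong suc (sym (trail-dist trail)))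

  top-leaf : ∀ {a p v k t} → Trail R r a p v k → suc k ≡ lv top → Branch R p v t → t ≡ leaf
  top-leaf trail _ (leaf _ _) = refl
  top-leaf {k = k} trail k≡ (node _ f _ _) = contradiction
    (subst₂ _≤_ (trail-dist (trail-snoc R trail v~w₁ w₁≢u)) (sym k≡) (≤top _)) (n≮n (suc k))
    where open Fork f

  r≢top : r ≢ top
  r≢top r≡top = contradiction
    (subst₂ _≤_ (trail-dist (single (RootFork.r~w₁ (RootedShape.fork (proj₂ rooted-shape)))))
                (trans (cong lv (sym r≡top)) dist-refl) (≤top _)) λ ()

  top-pendant : Pendant R top
  top-pendant = let _ , _ , _ , trail = trail-to r≢top in pendant trail (cubicAt (r≢top ∘ sym) (trail-last R trail))
    where
    pendant : ∀ {a x k} → Trail R r a x top k → OnlyNbr R x top ⊎ ∃[ w₁ ] ∃[ w₂ ] Fork R x top w₁ w₂ → Pendant R top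
    pendant trail (inj₁ only) = onlyNbr⇒degree R (~-sym (trail-last R trail)) only
    pendant trail (inj₂ (_ , _ , f)) = contradiction
      (subst₂ _≤_ (trail-dist (trail-snoc R trail v~w₁ w₁≢u)) (trail-dist trail) (≤top _)) (n≮n _)
      where open Fork f

  -- Pendant vertices occupy only the top level and the one below it; h = 0 marks the latter.
  leaf-height : ∀ {p v k h} → Position p v leaf k h → h ≡ 0
  leaf-height {k = k} {h} (position trail (leaf u~v only) height) = n≤0⇒n≡0 (+-cancelˡ-≤ k h 0
    (≤-pred (≤-pred (subst₂ _≤_ (sym height)
      (cong suc (trans (trail-dist trail) (cong suc (sym (+-identityʳ k)))))
      (pendants-close top _ top-pendant (onlyNbr⇒degree R (~-sym u~v) only))))))

  cherry-at : ∀ {p v t k} → Position p v t k 0 → t ≡ leaf ⊎ t ≡ node leaf leaf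
  cherry-at (position trail (leaf _ _) _) = inj₁ refl
  cherry-at {k = k} (position trail (node _ f b₁ b₂) height) =
    inj₂ (cong₂ node (top-leaf (trail-snoc R trail v~w₁ w₁≢u) height′ b₁) (top-leaf (trail-snoc R trail v~w₂ w₂≢u) height′ b₂))
    where
    open Fork f
    height′ : suc (suc k) ≡ lv top
    height′ = trans (cong (λ x → suc (suc x)) (sym (+-identityʳ k))) height

  isTopParent : ∀ {a p v k s t} → Trail R r a p v k → suc (suc k) ≡ lv top → Branch R p v (node s t) → IsTopParent R r v
  isTopParent {k = k} trail height (node {w₁ = w₁} _ f b₁ _) with top-leaf (trail-snoc R trail (Fork.v~w₁ f) (Fork.w₁≢u f)) height b₁
  isTopParent {k = k} trail height (node {w₁ = w₁} _ f (leaf v~w only) _) | refl = w₁ ,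
    child-parentOf trail v~w (Fork.w₁≢u f) ,
    (onlyNbr⇒degree R (~-sym v~w) only ,
     λ w → subst (lv w ≤_) (sym (trans (trail-dist (trail-snoc R trail v~w (Fork.w₁≢u f))) height)) (≤top w))

  leaf-not-topParent : ∀ {a p v k} → Trail R r a p v k → Branch R p v leaf → ¬ IsTopParent R r v
  leaf-not-topParent {k = k} trail (leaf _ only) (u , (v~u , level≡) , _) with only v~u
  ... | refl = contradiction (≤-trans (n≤1+n _) (subst (_≤ k) (trans level≡ (cong suc (trail-dist trail))) (dist-≤ R (trail-init R trail)))) (n≮n k)

  child-position₁ : ∀ {a p v w₁ w₂ s k h} → Trail R r a p v k → suc (suc (k + suc h)) ≡ lv top →
                    Fork R p v w₁ w₂ → Branch R v w₁ s → Position v w₁ s (suc k) h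
  child-position₁ {k = k} {h} trail height f b =
    position (trail-snoc R trail (Fork.v~w₁ f) (Fork.w₁≢u f)) b (trans (cong (λ x → suc (suc x)) (sym (+-suc k h))) height)

  child-position₂ : ∀ {a p v w₁ w₂ s k h} → Trail R r a p v k → suc (suc (k + suc h)) ≡ lv top →
                    Fork R p v w₁ w₂ → Branch R v w₂ s → Position v w₂ s (suc k) h
  child-position₂ trail height f = child-position₁ trail height (fork-swap R f)

  -- For h = 0 this is the final-segment condition. For larger h every child of v precedes every
  -- child of v′; were neither alternative to hold, a child of v failing the first and a child of v′
  -- failing the second would contradict the induction hypothesis for that pair.
  ordered-complete : ∀ {p v t p′ v′ t′ k} h → Position p v t k h → Position p′ v′ t′ k h → v ≺ v′ →
                     Complete h t ⊎ Complete (suc h) t′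
  ordered-complete {k = k} zero P P′ v≺v′ with cherry-at P | cherry-at P′
  ... | inj₁ refl | _         = inj₁ leaf
  ... | inj₂ refl | inj₂ refl = inj₂ (node leaf leaf)
  ... | inj₂ refl | inj₁ refl = contradiction
    (final-segment _ _ (trans (trail-dist (Position.trail P)) (sym (trail-dist (Position.trail P′)))) v≺v′
      (isTopParent (Position.trail P) (trans (cong (λ x → suc (suc x)) (sym (+-identityʳ k))) (Position.height P)) (Position.branch P)))
    (leaf-not-topParent (Position.trail P′) (Position.branch P′))
  ordered-complete (suc h) P@(position _ (leaf _ _) _) P′ _ = contradiction (leaf-height P) λ ()
  ordered-complete (suc h) P@(position _ (node _ _ _ _) _) P′@(position _ (leaf _ _) _) _ = contradiction (leaf-height P′) λ ()
  ordered-complete {k = k} (suc h) (position trail (node _ f a b) height) (position trail′ (node _ f′ c d) height′) v≺v′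
    with ordered-complete h (child-position₁ trail height f a) (child-position₁ trail′ height′ f′ c) (below (f .Fork.v~w₁) (f .Fork.w₁≢u) (f′ .Fork.v~w₁) (f′ .Fork.w₁≢u))
       | ordered-complete h (child-position₁ trail height f a) (child-position₂ trail′ height′ f′ d) (below (f .Fork.v~w₁) (f .Fork.w₁≢u) (f′ .Fork.v~w₂) (f′ .Fork.w₂≢u))
       | ordered-complete h (child-position₂ trail height f b) (child-position₁ trail′ height′ f′ c) (below (f .Fork.v~w₂) (f .Fork.w₂≢u) (f′ .Fork.v~w₁) (f′ .Fork.w₁≢u))
       | ordered-complete h (child-position₂ trail height f b) (child-position₂ trail′ height′ f′ d) (below (f .Fork.v~w₂) (f .Fork.w₂≢u) (f′ .Fork.v~w₂) (f′ .Fork.w₂≢u))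
    where
    below : ∀ {w w′} → _ ~ w → w ≢ _ → _ ~ w′ → w′ ≢ _ → w ≺ w′
    below v~w w≢p v′~w′ w′≢p′ = ≺-par (child-parentOf trail v~w w≢p) (child-parentOf trail′ v′~w′ w′≢p′)
      (trans (trail-dist (trail-snoc R trail v~w w≢p)) (sym (trail-dist (trail-snoc R trail′ v′~w′ w′≢p′)))) v≺v′
  ... | inj₁ ca | _ | inj₁ cb | _ = inj₁ (node ca cb)
  ... | inj₂ cc | inj₂ cd | _ | _ = inj₂ (node cc cd)
  ... | _ | _ | inj₂ cc | inj₂ cd = inj₂ (node cc cd)
  ... | _ | inj₁ ca | inj₁ cb | _ = inj₁ (node ca cb)
  ... | inj₁ ca | _ | _ | inj₁ cb = inj₁ (node ca cb)
  ... | _ | inj₁ ca | _ | inj₁ cb = inj₁ (node ca cb)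

  siblings-complete : ∀ {v w₁ w₂ s t k h} → w₁ ≢ w₂ → Position v w₁ s k h → Position v w₂ t k h →
                      CompleteNear h s ⊎ CompleteNear h t
  siblings-complete {w₁ = w₁} {w₂} {h = h} w₁≢w₂ P₁ P₂
    with ≺-cmp w₁ w₂ (trans (trail-dist (Position.trail P₁)) (sym (trail-dist (Position.trail P₂))))
  ... | tri≈ _ e _ = contradiction e w₁≢w₂
  ... | tri< lt _ _ = Sum.map inj₁ inj₂ (ordered-complete h P₁ P₂ lt)
  ... | tri> _ _ gt = Sum.swap (Sum.map inj₁ inj₂ (ordered-complete h P₂ P₁ gt))

  position-rgood : ∀ {p v t k} h → Position p v t k h → RGood h t
  position-rgood zero P with cherry-at P
  ... | inj₁ refl = leaf
  ... | inj₂ refl = cherry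
  position-rgood (suc h) P@(position _ (leaf _ _) _) = contradiction (leaf-height P) λ ()
  position-rgood (suc h) (position trail (node _ f a b) height) =
    node (position-rgood h P₁) (position-rgood h P₂) (siblings-complete (Fork.w₁≢w₂ f) P₁ P₂)
    where
    P₁ = child-position₁ trail height f a
    P₂ = child-position₂ trail height f b

  shape-rgood : ∀ {t} → RootedShape R r t → ∃[ h ] RGood h t
  shape-rgood (rootedShape f b₁ b₂ refl) = by-height (lv top) refl
    where
    open RootFork f
    by-height : ∀ H → lv top ≡ H → ∃[ h ] RGood h (node _ _)
    by-height zero eq = contradiction (subst₂ _≤_ (trail-dist (single r~w₁)) eq (≤top _)) λ ()
    by-height (suc zero) eq = 0 , subst₂ (λ s t → RGood 0 (node s t))
      (sym (top-leaf (single r~w₁) (sym eq) b₁)) (sym (top-leaf (single r~w₂) (sym eq) b₂)) cherry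
    by-height (suc (suc h)) eq = suc h ,
      node (position-rgood h P₁) (position-rgood h P₂) (siblings-complete w₁≢w₂ P₁ P₂)
      where
      P₁ = position (single r~w₁) b₁ (sym eq)
      P₂ = position (single r~w₂) b₂ (sym eq)

rgood-maximal : ∀ {n} (R : Graph n) {r t} → n ≢ 1 → IsRgood R r → size t ≡ n → rootSubtrees t ≤ subtreeCount R r
rgood-maximal {n} R {r} {t} n≢1 rgood size≡ =
  subst (rootSubtrees t ≤_) (sym (shape-count shape)) (rgood-optimal shape-good (trans size≡ (shape-size shape)))
  where
  open RootedTree R r (proj₁ (proj₁ rgood)) n≢1 (proj₁ rgood)
  shape = proj₂ rooted-shape
  top = argmax (level R r) r (allFin n)
  shape-good : RGood _ _
  shape-good = proj₂ (RGoodTree.shape-rgood R r n≢1 rgood top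
    (λ w → All.lookup (f[xs]≤f[argmax] r (allFin n)) (∈-allFin w)) shape)

-- The rest of a cycle through z x leads from x to z without this edge, since x occurs on it only
-- once.
bridged⇒acyclic : ∀ {n} (G : Graph n) → Bridged G → Acyclic G
bridged⇒acyclic {n} G bridged x y zs z (x~y ∷ linked , (x≢y ∷ x∉) ∷ (y∉ ∷ _)) z~x =
  bridged z~x ((x~y , (λ (_ , y≡x) → x≢y (sym y≡x)) , (λ (_ , y≡z) → All.lookup y∉ z∈ y≡z)) ◅ follow linked (x≢y ∷ x∉))
  where
  open Graph G
  z∈ : z ∈ˡ zs ∷ʳ z
  z∈ = ∈-++⁺ʳ zs (here refl)
  follow : ∀ {a ws} → Linked _~_ (a ∷ ws ∷ʳ z) → All (x ≢_) (a ∷ ws ∷ʳ z) → Star (OffEdge G z x) a z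
  follow {ws = []}    (a~z ∷ _) (x≢a ∷ x≢z ∷ []) =
    (a~z , (λ (_ , z≡x) → x≢z (sym z≡x)) , (λ (a≡x , _) → x≢a (sym a≡x))) ◅ ε
  follow {ws = b ∷ _} (a~b ∷ l) (x≢a ∷ x≢b ∷ x≢) =
    (a~b , (λ (_ , b≡x) → x≢b (sym b≡x)) , (λ (a≡x , _) → x≢a (sym a≡x))) ◅ follow l (x≢b ∷ x≢)

-- The heap as an rgood tree of every odd order from three on

data ChildIndex (p c : ℕ) : Set where
  first  : c ≡ suc (2 * p) → ChildIndex p c
  second : c ≡ suc (suc (2 * p)) → ChildIndex p c

childIndex-lower : ∀ {p c} → ChildIndex p c → suc (2 * p) ≤ c
childIndex-lower (first refl) = ≤-refl
childIndex-lower (second refl) = n≤1+n _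

childIndex-upper : ∀ {p c} → ChildIndex p c → c ≤ suc (suc (2 * p))
childIndex-upper (first refl) = n≤1+n _
childIndex-upper (second refl) = ≤-refl

childIndex-< : ∀ {p c} → ChildIndex p c → p < c
childIndex-< {p} ch = ≤-trans (s≤s (m≤m+n p (p + 0))) (childIndex-lower ch)

childIndex-mono : ∀ {p q c d} → ChildIndex p c → ChildIndex q d → p < q → c < d
childIndex-mono {p} {q} ch ch′ p<q = ≤-trans (s≤s (childIndex-upper ch))
  (≤-trans (s≤s (≤-trans (≤-reflexive (sym (*-suc 2 p))) (*-monoʳ-≤ 2 p<q))) (childIndex-lower ch′))

childIndex-cancel : ∀ {p q c d} → ChildIndex p c → ChildIndex q d → c ≤ d → p ≤ q
childIndex-cancel ch ch′ c≤d = ≮⇒≥ λ q<p → <⇒≱ (childIndex-mono ch′ ch q<p) c≤d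

childIndex-unique : ∀ {p q c} → ChildIndex p c → ChildIndex q c → p ≡ q
childIndex-unique {c = c} ch ch′ =
  ≤-antisym (childIndex-cancel ch ch′ (≤-refl {c})) (childIndex-cancel ch′ ch (≤-refl {c}))

parentIndex : ∀ c → ∃[ p ] ChildIndex p (suc c)
parentIndex zero = 0 , first refl
parentIndex (suc c) with parentIndex c
... | p , first e = p , second (cong suc e)
... | p , second e = suc p , first (trans (cong suc e) (cong suc (sym (*-suc 2 p))))

-- The rgood tree on 2 m + 1 vertices, numbered in heap order.
module Heap (m : ℕ) where

  V : Set
  V = Fin (suc (2 * m))

  -- A record, so that the vertices can be inferred.
  record Child (p c : V) : Set where
    constructor child-at
    field index : ChildIndex (toℕ p) (toℕ c)

  open Child

  child-< : ∀ {p c} → Child p c → toℕ p < toℕ c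
  child-< = childIndex-< ∘ index

  child? : ∀ p c → Dec (Child p c)
  child? p c = map′ [ child-at ∘ first , child-at ∘ second ]′ (λ { (child-at (first e)) → inj₁ e ; (child-at (second e)) → inj₂ e })
    ((toℕ c ≟ _) ⊎-dec (toℕ c ≟ _))

  heap : Graph (suc (2 * m))
  heap = record
    { _~_      = λ a b → Child a b ⊎ Child b a
    ; ~-sym    = Sum.swap
    ; ~-irrefl = λ { refl → [ (λ ch → n≮n _ (child-< ch)) , (λ ch → n≮n _ (child-< ch)) ]′ }
    ; _~?_     = λ a b → child? a b ⊎-dec child? b a
    }

  open Graph heap

  root : V
  root = Fin.zero

  child-unique : ∀ {p q c} → Child p c → Child q c → p ≡ q
  child-unique ch ch′ = Finₚ.toℕ-injective (childIndex-unique (index ch) (index ch′))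

  toℕ≤2m : ∀ (v : V) → toℕ v ≤ 2 * m
  toℕ≤2m v = ≤-pred (Finₚ.toℕ<n v)

  parent : ∀ (c : V) → c ≢ root → ∃[ p ] Child p c
  parent Fin.zero    c≢root = contradiction refl c≢root
  parent (Fin.suc c) _ with parentIndex (toℕ c)
  ... | p , ch = fromℕ< p< , child-at (subst (λ i → ChildIndex i _) (sym (Finₚ.toℕ-fromℕ< p<)) ch)
    where
    p< : p < suc (2 * m)
    p< = <-trans (childIndex-< ch) (s≤s (Finₚ.toℕ<n c))

  to-root : ∀ v → Star _~_ v root
  to-root v = go v (<-wellFounded (toℕ v))
    where
    go : ∀ v → Acc _<_ (toℕ v) → Star _~_ v root
    go v (acc rec) with v Finₚ.≟ root
    ... | yes refl = ε
    ... | no v≢root with parent v v≢root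
    ...   | p , ch = inj₂ ch ◅ go p (rec (child-< ch))

  connected : Connected heap
  connected u v = to-root u ◅◅ Star.reverse ~-sym (to-root v)

  data Descendant (c : V) : V → Set where
    self  : Descendant c c
    child : ∀ {p x} → Descendant c p → Child p x → Descendant c x

  descendant-≥ : ∀ {c x} → Descendant c x → toℕ c ≤ toℕ x
  descendant-≥ self         = ≤-refl
  descendant-≥ (child d ch) = ≤-trans (descendant-≥ d) (<⇒≤ (child-< ch))

  -- A step up from a proper descendant reaches the unique parent, again a descendant; the step up
  -- from c is the deleted edge.
  below : ∀ {p c x} → Child p c → Side heap p c x → Descendant c x
  below {p} {c} ch = star-preserves (Descendant c) step self
    where
    step : ∀ {a b} → Descendant c a → OffEdge heap p c a b → Descendant c b
    step d (inj₁ a→b , _) = child d a→b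
    step self (inj₂ b→c , _ , ¬up) = contradiction (refl , child-unique b→c ch) ¬up
    step (child d q→a) (inj₂ b→a , _) = subst (Descendant c) (child-unique q→a b→a) d

  bridged : Bridged heap
  bridged (inj₁ ch) s = <⇒≱ (child-< ch) (descendant-≥ (below ch s))
  bridged {u} {v} (inj₂ ch) s = <⇒≱ (child-< ch) (descendant-≥ (below ch
    (Star.reverse (λ (a~b , p , q) → ~-sym a~b , (λ (e , f) → p (f , e)) , (λ (e , f) → q (f , e))) s)))

  open Distances heap connected bridged

  Level : V → ℕ
  Level = level heap root

  level-root : Level root ≡ 0
  level-root = dist-refl {root}

  root-trail : ∀ {p c} → Child p c → ∃[ a ] ∃[ k ] Trail heap root a p c k
  root-trail {c = c} = go (<-wellFounded (toℕ c))
    where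
    go : ∀ {p c} → Acc _<_ (toℕ c) → Child p c → ∃[ a ] ∃[ k ] Trail heap root a p c k
    go {p} {c} (acc rec) ch with p Finₚ.≟ root
    ... | yes refl = _ , _ , single (inj₁ ch)
    ... | no p≢root with parent p p≢root
    ...   | q , ch′ with go (rec (child-< ch)) ch′
    ...     | a , k , trail = a , suc k , trail-snoc heap trail (inj₁ ch)
              λ { refl → <-asym (child-< ch) (child-< ch′) }

  level-child : ∀ {p c} → Child p c → Level c ≡ suc (Level p)
  level-child {p} {c} ch with p Finₚ.≟ root
  ... | yes refl = trans (trail-dist (single (inj₁ ch))) (cong suc (sym level-root))
  ... | no p≢root with parent p p≢root
  ...   | q , ch′ with root-trail ch′
  ...     | a , k , trail = trans (trail-dist (trail-snoc heap trail (inj₁ ch)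
              λ { refl → <-asym (child-< ch) (child-< ch′) })) (cong suc (sym (trail-dist trail)))

  -- Heap numbering is breadth-first: passing to parents preserves the order of indices and lowers
  -- both levels by one.
  level-mono : ∀ a b → toℕ a ≤ toℕ b → Level a ≤ Level b
  level-mono a b = go a b (<-wellFounded (toℕ b))
    where
    go : ∀ a b → Acc _<_ (toℕ b) → toℕ a ≤ toℕ b → Level a ≤ Level b
    go a b (acc rec) a≤b with a Finₚ.≟ root
    ... | yes refl = ≤-trans (≤-reflexive level-root) z≤n
    ... | no a≢root with parent a a≢root | parent b (λ { refl → a≢root (Finₚ.toℕ-injective (n≤0⇒n≡0 a≤b)) })
    ...   | p , ch | q , ch′ = subst₂ _≤_ (sym (level-child ch)) (sym (level-child ch′))
              (s≤s (go p q (rec (child-< ch′)) (childIndex-cancel (index ch) (index ch′) a≤b)))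

  parentOf⇒child : ∀ {p u} → _ParentOf_ heap root p u → Child p u
  parentOf⇒child (inj₁ ch , _) = ch
  parentOf⇒child {p} {u} (inj₂ ch , level≡) =
    contradiction (≤-trans (n≤1+n _) (≤-reflexive (sym (trans level≡ (cong suc (level-child ch)))))) (n≮n (Level u))

  inner-index : ∀ {p c} → Child p c → toℕ p < m
  inner-index {p} {c} ch = *-cancelˡ-< 2 _ _ (≤-trans (childIndex-lower (index ch)) (toℕ≤2m c))

  module _ {v : V} (v<m : toℕ v < m) where
    private
      left< : suc (2 * toℕ v) < suc (2 * m)
      left< = s≤s (*-monoʳ-< 2 v<m)
      right< : suc (suc (2 * toℕ v)) < suc (2 * m)
      right< = s≤s (≤-trans (≤-reflexive (sym (*-suc 2 (toℕ v)))) (*-monoʳ-≤ 2 v<m))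

    left right : V
    left  = fromℕ< left<
    right = fromℕ< right<

    left-child : Child v left
    left-child = child-at (first (Finₚ.toℕ-fromℕ< left<))

    right-child : Child v right
    right-child = child-at (second (Finₚ.toℕ-fromℕ< right<))

    left≢right : left ≢ right
    left≢right e = 1+n≢n (sym (trans (sym (Finₚ.toℕ-fromℕ< left<)) (trans (cong toℕ e) (Finₚ.toℕ-fromℕ< right<))))

    children : ∀ {c} → Child v c → c ≡ left ⊎ c ≡ right
    children (child-at (first e)) = inj₁ (Finₚ.toℕ-injective (trans e (sym (Finₚ.toℕ-fromℕ< left<))))
    children (child-at (second e)) = inj₂ (Finₚ.toℕ-injective (trans e (sym (Finₚ.toℕ-fromℕ< right<))))

  degree-root : 0 < m → degree heap root ≡ 2
  degree-root 0<m = degree-from-list heap (((left≢right 0<m) ∷ []) ∷ [] ∷ [])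
    (λ { (inj₁ ch) → [ here , there ∘ here ]′ (children 0<m ch) ; (inj₂ ch) → contradiction (child-< ch) λ () })
    (λ { (here refl) → inj₁ (left-child 0<m) ; (there (here refl)) → inj₁ (right-child 0<m) })

  degree-inner : ∀ {v} → v ≢ root → toℕ v < m → degree heap v ≡ 3
  degree-inner {v} v≢root v<m with parent v v≢root
  ... | p , ch = degree-from-list heap ((parent≢ (left-child v<m) ∷ parent≢ (right-child v<m) ∷ []) ∷ (left≢right v<m ∷ []) ∷ [] ∷ [])
    (λ { (inj₁ ch′) → [ there ∘ here , there ∘ there ∘ here ]′ (children v<m ch′) ; (inj₂ ch′) → here (child-unique ch′ ch) })
    (λ { (here refl) → inj₂ ch ; (there (here refl)) → inj₁ (left-child v<m) ; (there (there (here refl))) → inj₁ (right-child v<m) })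
    where
    parent≢ : ∀ {c} → Child v c → p ≢ c
    parent≢ ch′ refl = <-asym (child-< ch) (child-< ch′)

  degree-outer : ∀ {v} → v ≢ root → m ≤ toℕ v → degree heap v ≡ 1
  degree-outer {v} v≢root m≤v with parent v v≢root
  ... | p , ch = degree-from-list heap ([] ∷ [])
    (λ { (inj₁ ch′) → contradiction (inner-index ch′) (≤⇒≯ m≤v) ; (inj₂ ch′) → here (child-unique ch′ ch) })
    (λ { (here refl) → inj₂ ch })

  pendant-index : 0 < m → ∀ {v} → Pendant heap v → m ≤ toℕ v
  pendant-index 0<m {v} one = ≮⇒≥ inner
    where
    inner : ¬ toℕ v < m
    inner v<m with v Finₚ.≟ root
    ... | yes refl  = contradiction (trans (sym one) (degree-root 0<m)) λ ()
    ... | no v≢root = contradiction (trans (sym one) (degree-inner v≢root v<m)) λ ()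

  heap-tree : IsTree heap
  heap-tree = s≤s z≤n , connected , bridged⇒acyclic heap bridged

  heap-rooted : 0 < m → IsRootedBinaryTree heap root
  heap-rooted 0<m = heap-tree , inj₂ (degree-root 0<m , degrees)
    where
    degrees : ∀ v → v ≢ root → degree heap v ≡ 1 ⊎ degree heap v ≡ 3
    degrees v v≢root with toℕ v <? m
    ... | yes v<m = inj₂ (degree-inner v≢root v<m)
    ... | no v≮m  = inj₁ (degree-outer v≢root (≮⇒≥ v≮m))

  -- The parent of u has index below m, while the pendant v has index at least m; so the parent is
  -- no deeper than v.
  pendant-levels : 0 < m → ∀ u v → Pendant heap u → Pendant heap v → Level u ≤ suc (Level v)
  pendant-levels 0<m u v _ v-pendant with u Finₚ.≟ root
  ... | yes refl = ≤-trans (≤-reflexive level-root) z≤n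
  ... | no u≢root with parent u u≢root
  ...   | p , ch = ≤-trans (≤-reflexive (level-child ch))
            (s≤s (level-mono p v (≤-trans (<⇒≤ (inner-index ch)) (pendant-index 0<m v-pendant))))

  -- The heap fills its last level from the left, so the order is reversed.
  ordering : Ordering heap root
  ordering = record
    { _≺_     = λ u v → toℕ v < toℕ u
    ; ≺-trans = λ _ _ v<u w<v → <-trans w<v v<u
    ; ≺-cmp   = λ u v _ → compare u v
    ; ≺-par   = λ p→u q→v _ q<p → childIndex-mono (index (parentOf⇒child q→v)) (index (parentOf⇒child p→u)) q<p
    }
    where
    compare : ∀ u v → Relation.Binary.Tri (toℕ v < toℕ u) (u ≡ v) (toℕ u < toℕ v)
    compare u v with <-cmp (toℕ u) (toℕ v)
    ... | tri< lt ¬e ¬gt = tri> ¬gt (¬e ∘ cong toℕ) lt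
    ... | tri≈ ¬lt e ¬gt = tri≈ ¬gt (Finₚ.toℕ-injective e) ¬lt
    ... | tri> ¬lt ¬e gt = tri< gt (¬e ∘ cong toℕ) ¬lt

  -- As q precedes the inner vertex p in heap order, it is inner too. Its left child lies on the top
  -- level and is pendant, for a child of it would lie higher still.
  top-parents-final : ∀ p q → Level p ≡ Level q → toℕ q < toℕ p → IsTopParent heap root p → IsTopParent heap root q
  top-parents-final p q level≡ q<p (u , p→u , (_ , u-top)) =
    left q<m , (inj₁ (left-child q<m) , level-child (left-child q<m)) ,
    (degree-outer (λ e → contradiction (subst (λ x → toℕ q < toℕ x) e (child-< (left-child q<m))) λ ()) (≮⇒≥ not-inner)
    , left-top)
    where
    q<m : toℕ q < m
    q<m = <-trans q<p (inner-index (parentOf⇒child p→u))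
    left-level : Level (left q<m) ≡ Level u
    left-level = trans (level-child (left-child q<m)) (trans (cong suc (sym level≡)) (sym (proj₂ p→u)))
    left-top : ∀ w → Level w ≤ Level (left q<m)
    left-top w = subst (Level w ≤_) (sym left-level) (u-top w)
    not-inner : ¬ toℕ (left q<m) < m
    not-inner l<m = <⇒≱ (≤-reflexive (sym (level-child (left-child l<m)))) (left-top (left l<m))

  heap-rgood : 0 < m → IsRgood heap root
  heap-rgood 0<m = heap-rooted 0<m , pendant-levels 0<m , ordering , top-parents-final

-- Weights and the position of the centroid

module CubicTree {n : ℕ} (G : Graph n) (conn : Connected G) (bridged : Bridged G) (cubic : ∀ v → CubicAt G v) where
  open Graph G
  open Sides G conn bridged
  open BranchCounting G conn bridged
  open Distances G conn bridged

  branch : ∀ {u v} → u ~ v → ∃[ t ] Branch G u v t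
  branch u~v = branch-of u~v (λ {x} _ → cubic x)

  sideEdges≡sideSize : ∀ {u v} → u ~ v → sideEdges G u v ≡ sideSize G u v
  sideEdges≡sideSize u~v = let _ , b = branch u~v in trans (branch-edges b) (sym (branch-size b))

  sideSize≤weight : ∀ {v w} → v ~ w → sideSize G v w ≤ weight G v
  sideSize≤weight {v} v~w = subst (_≤ weight G v) (sideEdges≡sideSize v~w) (sideEdges≤weight v~w)

  weight≤ : ∀ {v m} → (∀ {w} → v ~ w → sideSize G v w ≤ m) → weight G v ≤ m
  weight≤ {v} {m} bound = weight-upper λ v~w → subst (_≤ m) (sym (sideEdges≡sideSize v~w)) (bound v~w)

  -- Were the side of v at least as large, it would bound every branch at v, and v would weigh no
  -- more than c.
  centroid-leave : ∀ {c v} → c ~ v → IsCentroid G c → ¬ IsCentroid G v → sideSize G c v < sideSize G v c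
  centroid-leave {c} {v} c~v centroid ¬centroid = ≰⇒> λ heavy →
    ¬centroid λ u → ≤-trans (weight≤ (bound heavy)) (≤-trans (sideSize≤weight c~v) (centroid u))
    where
    bound : sideSize G v c ≤ sideSize G c v → ∀ {w} → v ~ w → sideSize G v w ≤ sideSize G c v
    bound heavy {w} v~w with w Finₚ.≟ c
    ... | yes refl = heavy
    ... | no w≢c   = <⇒≤ (sideSize-child c~v v~w w≢c)

  -- A vertex off the larger side has that whole side in one of its branches, while every branch at
  -- y is strictly smaller than it.
  centroid-side : ∀ {x y z} → x ~ y → sideSize G y x < sideSize G x y → IsCentroid G z → Side G x y z
  centroid-side {x} {y} {z} x~y lt centroid with side? G x y z
  ... | yes z∈ = z∈
  ... | no z∉ with side-toward {z} {y} (λ { refl → z∉ ε })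
  ...   | w , z~w , y∈ = contradiction (≤-trans z-heavy (centroid y)) (<⇒≱ y-light)
    where
    z-heavy : sideSize G x y ≤ weight G z
    z-heavy = ≤-trans (count-mono (side? G x y) (side? G z w) (side-⊆-toward z~w y∈ z∉) (allFin n)) (sideSize≤weight z~w)
    -- The predecessor turns the strict bounds on the branches at y into the weak bound that
    -- `weight≤` takes.
    pred+1 : suc (pred (sideSize G x y)) ≡ sideSize G x y
    pred+1 = suc-pred _ {{>-nonZero (sideSize>0 x y)}}
    y-light : weight G y < sideSize G x y
    y-light = ≤-<-trans (weight≤ (≤-pred ∘ light)) (≤-reflexive pred+1)
      where
      light : ∀ {w′} → y ~ w′ → sideSize G y w′ < suc (pred (sideSize G x y))
      light {w′} y~w′ with w′ Finₚ.≟ x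
      ... | yes refl = subst (sideSize G y x <_) (sym pred+1) lt
      ... | no w′≢x  = subst (sideSize G y w′ <_) (sym pred+1) (sideSize-child x~y y~w′ w′≢x)

  trail-sideSize-cubic : ∀ {u v x y k} → Trail G u v x y k → sideSize G x y + 2 * k ≤ sideSize G u v
  trail-sideSize-cubic (single _) = ≤-reflexive (+-identityʳ _)
  trail-sideSize-cubic {u} {v} {x} {y} {suc k} (extend {w = w} u~v w≢u rest) = begin
    sideSize G x y + 2 * suc k         ≡⟨ e (sideSize G x y) k ⟩
    2 + (sideSize G x y + 2 * k)       ≤⟨ +-monoʳ-≤ 2 (trail-sideSize-cubic rest) ⟩
    2 + sideSize G v w                 ≤⟨ grow (cubic v u~v) (trail-first G rest) w≢u ⟩
    sideSize G u v                     ∎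
    where
    open ≤-Reasoning
    e : ∀ s k → s + 2 * suc k ≡ 2 + (s + 2 * k)
    e = solve-∀
    grow : OnlyNbr G u v ⊎ ∃[ w₁ ] ∃[ w₂ ] Fork G u v w₁ w₂ → ∀ {w} → v ~ w → w ≢ u → 2 + sideSize G v w ≤ sideSize G u v
    grow (inj₁ only) v~w w≢u = contradiction (only v~w) w≢u
    grow (inj₂ (w₁ , w₂ , f)) v~w w≢u with Fork.nbrs⊆ f v~w
    ... | inj₁ w≡u = contradiction w≡u w≢u
    ... | inj₂ (inj₁ refl) = subst (2 + sideSize G v w₁ ≤_) (sym (sideSize-fork u~v f))
          (s≤s (≤-trans (≤-reflexive (+-comm 1 _)) (+-monoʳ-≤ _ (sideSize>0 v w₂))))
    ... | inj₂ (inj₂ refl) = subst (2 + sideSize G v w₂ ≤_) (sym (sideSize-fork u~v f))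
          (s≤s (+-monoˡ-≤ _ (sideSize>0 v w₁)))

  -- Along the spine each step drops one spine vertex and its leaf, so `trail-sideSize-cubic` holds
  -- here with equality.
  caterpillar-trail : ∀ i {u v t} → Branch G u v t → Caterpillar t → 2 * i < size t →
                      ∃[ x ] ∃[ y ] (Trail G u v x y i × sideSize G x y + 2 * i ≡ size t)
  caterpillar-trail zero b _ _ = _ , _ , single (branch-~ G b) , trans (+-identityʳ _) (branch-size b)
  caterpillar-trail (suc i) (leaf _ _) leaf 2i< = contradiction (≤-trans 2i< (s≤s z≤n)) (<⇒≱ (s≤s (s≤s z≤n)))
  caterpillar-trail (suc i) {u} {v} (node {w₂ = w₂} {t = t} u~v f _ b) (node c) 2i< =
    let x , y , trail , eq = caterpillar-trail i b c (≤-pred (≤-pred (subst (_< suc (suc (size t))) (*-suc 2 i) 2i<)))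
    in x , y , extend u~v (Fork.w₂≢u f) trail , trans (e (sideSize G x y) i) (cong (2 +_) eq)
    where
    e : ∀ s k → s + 2 * suc k ≡ 2 + (s + 2 * k)
    e = solve-∀

-- Caterpillars and their ends

linked-prefix : ∀ {A : Set} {R : A → A → Set} as {bs} → Linked R (as ++ bs) → Linked R as
linked-prefix []           _       = []
linked-prefix (a ∷ [])     _       = [-]
linked-prefix (a ∷ b ∷ as) (r ∷ l) = r ∷ linked-prefix (b ∷ as) l

linked-suffix : ∀ {A : Set} {R : A → A → Set} as {bs} → Linked R (as ++ bs) → Linked R bs
linked-suffix []       l = l
linked-suffix (a ∷ as) l = linked-suffix as (Linked.tail l)

unique-split : ∀ {A : Set} {x : A} as {bs} → Unique (as ++ x ∷ bs) → All (x ≢_) as × All (x ≢_) bs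
unique-split []       (x∉ ∷ _) = [] , x∉
unique-split (a ∷ as) (a∉ ∷ u) with unique-split as u
... | x∉as , x∉bs = (λ x≡a → All.lookup a∉ (∈-++⁺ʳ as (here refl)) (sym x≡a)) ∷ x∉as , x∉bs

module CaterpillarTree {n : ℕ} (G : Graph n) (conn : Connected G) (bridged : Bridged G) (cubic : ∀ v → CubicAt G v)
  (p : List (Fin n)) (path : IsPath G p) (dominates : ∀ v → v ∉ˡ p → ∃[ w ] (w ∈ˡ p × Graph._~_ G v w)) where
  open Graph G
  open Sides G conn bridged
  open BranchCounting G conn bridged
  open Distances G conn bridged
  open CubicTree G conn bridged cubic

  -- The side can be left only through x.
  avoiding-path-in-side : ∀ {x y xs} → Linked _~_ xs → All (x ≢_) xs → Any (Side G x y) xs → All (Side G x y) xs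
  avoiding-path-in-side [-] _ (here a∈) = a∈ ∷ []
  avoiding-path-in-side (a~b ∷ l) (_ ∷ x≢b ∷ x≢) (here a∈) with side-step G a∈ a~b
  ... | inj₁ b∈        = a∈ ∷ avoiding-path-in-side l (x≢b ∷ x≢) (here b∈)
  ... | inj₂ (_ , b≡x) = contradiction (sym b≡x) x≢b
  avoiding-path-in-side (a~b ∷ l) (x≢a ∷ x≢) (there any) with avoiding-path-in-side l x≢ any
  ... | b∈ ∷ all with side-step G b∈ (~-sym a~b)
  ...   | inj₁ a∈        = a∈ ∷ b∈ ∷ all
  ...   | inj₂ (_ , a≡x) = contradiction (sym a≡x) x≢a

  avoiding-path-one-side : ∀ {x y z xs q q′} → Linked _~_ xs → All (x ≢_) xs → x ~ y → x ~ z → y ≢ z →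
                           q ∈ˡ xs → Side G x y q → q′ ∈ˡ xs → ¬ Side G x z q′
  avoiding-path-one-side l x≢ x~y x~z y≢z q∈ q∈y q′∈ q′∈z =
    sibling-sides-disjoint x~y x~z y≢z q∈y (All.lookup (avoiding-path-in-side l x≢ (lose q′∈ q′∈z)) q∈)

  -- Either z is on the path or a path vertex is adjacent to it; as z is not y, that edge cannot be
  -- the way out of the side.
  path-meets-side : ∀ {x y z} → x ~ y → y ~ z → z ≢ x → ∃[ q ] (q ∈ˡ p × Side G x y q)
  path-meets-side {x} {y} {z} x~y y~z z≢x with DecMembership._∈?_ Finₚ._≟_ z p
  ... | yes z∈p = z , z∈p , side-child x~y y~z z≢x ε
  ... | no z∉p with dominates z z∉p
  ...   | w , w∈p , z~w with side-step G (side-child x~y y~z z≢x ε) z~w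
  ...     | inj₁ w∈        = w , w∈p , w∈
  ...     | inj₂ (z≡y , _) = contradiction (sym z≡y) (~⇒≢ G y~z)

  -- The path meets all three sides. Removing x leaves at most two pieces of it, and each piece
  -- stays in one side.
  no-three-inner-nbrs : ∀ {x y₁ y₂ y₃ z₁ z₂ z₃} → x ~ y₁ → x ~ y₂ → x ~ y₃ → y₁ ≢ y₂ → y₁ ≢ y₃ → y₂ ≢ y₃ →
    y₁ ~ z₁ → y₂ ~ z₂ → y₃ ~ z₃ → z₁ ≢ x → z₂ ≢ x → z₃ ≢ x → ⊥
  no-three-inner-nbrs {x} x~y₁ x~y₂ x~y₃ y₁≢y₂ y₁≢y₃ y₂≢y₃ y₁~z₁ y₂~z₂ y₃~z₃ z₁≢x z₂≢x z₃≢x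
    with path-meets-side x~y₁ y₁~z₁ z₁≢x | path-meets-side x~y₂ y₂~z₂ z₂≢x | path-meets-side x~y₃ y₃~z₃ z₃≢x
       | DecMembership._∈?_ Finₚ._≟_ x p
  ... | q₁ , q₁∈ , s₁ | q₂ , q₂∈ , s₂ | _ | no x∉p =
    avoiding-path-one-side (proj₁ path) (Allₚ.¬Any⇒All¬ p x∉p) x~y₁ x~y₂ y₁≢y₂ q₁∈ s₁ q₂∈ s₂
  ... | q₁ , q₁∈ , s₁ | q₂ , q₂∈ , s₂ | q₃ , q₃∈ , s₃ | yes x∈p with ∈-∃++ x∈p
  ...   | as , bs , refl = pigeonhole (part q₁∈ x~y₁ s₁) (part q₂∈ x~y₂ s₂) (part q₃∈ x~y₃ s₃)
    where
    part : ∀ {q y} → q ∈ˡ as ++ x ∷ bs → x ~ y → Side G x y q → q ∈ˡ as ⊎ q ∈ˡ bs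
    part q∈ x~y s with ∈-++⁻ as q∈
    ... | inj₁ q∈as         = inj₁ q∈as
    ... | inj₂ (here refl)  = contradiction s (bridged x~y)
    ... | inj₂ (there q∈bs) = inj₂ q∈bs
    x∉ = unique-split as (proj₂ path)
    inˡ : ∀ {y z q q′} → x ~ y → x ~ z → y ≢ z → q ∈ˡ as → Side G x y q → q′ ∈ˡ as → ¬ Side G x z q′
    inˡ = avoiding-path-one-side (linked-prefix as (proj₁ path)) (proj₁ x∉)
    inʳ : ∀ {y z q q′} → x ~ y → x ~ z → y ≢ z → q ∈ˡ bs → Side G x y q → q′ ∈ˡ bs → ¬ Side G x z q′
    inʳ = avoiding-path-one-side (Linked.tail (linked-suffix as (proj₁ path))) (proj₂ x∉)
    pigeonhole : q₁ ∈ˡ as ⊎ q₁ ∈ˡ bs → q₂ ∈ˡ as ⊎ q₂ ∈ˡ bs → q₃ ∈ˡ as ⊎ q₃ ∈ˡ bs → ⊥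
    pigeonhole (inj₁ m₁) (inj₁ m₂) _         = inˡ x~y₁ x~y₂ y₁≢y₂ m₁ s₁ m₂ s₂
    pigeonhole (inj₁ m₁) (inj₂ _)  (inj₁ m₃) = inˡ x~y₁ x~y₃ y₁≢y₃ m₁ s₁ m₃ s₃
    pigeonhole (inj₁ _)  (inj₂ m₂) (inj₂ m₃) = inʳ x~y₂ x~y₃ y₂≢y₃ m₂ s₂ m₃ s₃
    pigeonhole (inj₂ _)  (inj₁ m₂) (inj₁ m₃) = inˡ x~y₂ x~y₃ y₂≢y₃ m₂ s₂ m₃ s₃
    pigeonhole (inj₂ m₁) (inj₁ _)  (inj₂ m₃) = inʳ x~y₁ x~y₃ y₁≢y₃ m₁ s₁ m₃ s₃
    pigeonhole (inj₂ m₁) (inj₂ m₂) _         = inʳ x~y₁ x~y₂ y₁≢y₂ m₁ s₁ m₂ s₂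

  -- The vertex z witnesses that u is not a leaf. Hence v, if it forks, has an inner neighbour
  -- behind it, and one of the two ahead must be a leaf.
  caterpillar-branch : ∀ {z u v} → u ~ z → z ≢ v → u ~ v → ∃[ t ] (Branch G u v t × Caterpillar t)
  caterpillar-branch {u = u} {v} = go (<-wellFounded (sideSize G u v))
    where
    go : ∀ {z u v} → Acc _<_ (sideSize G u v) → u ~ z → z ≢ v → u ~ v → ∃[ t ] (Branch G u v t × Caterpillar t)
    go {z} {u} {v} (acc rec) u~z z≢v u~v with cubic v u~v
    ... | inj₁ only = leaf , leaf u~v only , leaf
    ... | inj₂ (w₁ , w₂ , f) with cubic w₁ (Fork.v~w₁ f) | cubic w₂ (Fork.v~w₂ f)
    ...   | inj₁ only | _ with go (rec (sideSize-child u~v (Fork.v~w₂ f) (Fork.w₂≢u f))) (~-sym u~v) (Fork.w₂≢u f ∘ sym) (Fork.v~w₂ f)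
    ...     | t , b , c = node leaf t , node u~v f (leaf (Fork.v~w₁ f) only) b , node c
    go {z} {u} {v} (acc rec) u~z z≢v u~v | inj₂ (w₁ , w₂ , f) | inj₂ _ | inj₁ only
      with go (rec (sideSize-child u~v (Fork.v~w₁ f) (Fork.w₁≢u f))) (~-sym u~v) (Fork.w₁≢u f ∘ sym) (Fork.v~w₁ f)
    ...     | t , b , c = node leaf t , node u~v (fork-swap G f) (leaf (Fork.v~w₂ f) only) b , node c
    go {z} {u} {v} (acc rec) u~z z≢v u~v | inj₂ (w₁ , w₂ , f) | inj₂ (z₁ , _ , f₁) | inj₂ (z₂ , _ , f₂) =
      ⊥-elim (no-three-inner-nbrs (~-sym u~v) v~w₁ v~w₂ (w₁≢u ∘ sym) (w₂≢u ∘ sym) w₁≢w₂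
        u~z (Fork.v~w₁ f₁) (Fork.v~w₁ f₂) z≢v (Fork.w₁≢u f₁) (Fork.w₁≢u f₂))
      where open Fork f

  dist≤eccentricity : ∀ u v → dist G u v ≤ eccentricity G u
  dist≤eccentricity u v = v≤max⁺ 0 (map (dist G u) (allFin n)) (inj₂ (Any.map ≤-reflexive (∈-map⁺ (dist G u) (∈-allFin v))))

  eccentricity≤ : ∀ {u m} → (∀ v → dist G u v ≤ m) → eccentricity G u ≤ m
  eccentricity≤ {u} {m} bound = max≤v⁺ {xs = map (dist G u) (allFin n)} z≤n (Allₚ.map⁺ (All.tabulate {xs = allFin n} λ {v} _ → bound v))

  record End (c : Fin n) : Set where
    field
      {nbr}       : Fin n
      {shape}     : BT
      only        : OnlyNbr G nbr c
      endBranch   : Branch G c nbr shape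
      caterpillar : Caterpillar shape

  module _ {c w : Fin n} (farthest : ∀ z v → dist G z v ≤ dist G c w) where

    no-longer-trail : ∀ {a x k z v x′ y} → Trail G c a x w k → Trail G z v x′ y (suc k) → ⊥
    no-longer-trail trail longer = n≮n _ (subst₂ _≤_ (trail-dist longer) (trail-dist trail) (farthest _ _))

    -- A further neighbour z of w₂ would start a trail z, w₂, a, w₁, ... one edge longer than the
    -- one from c. So w₂ is a leaf, and the branch at c begins like a caterpillar.
    end-fork : ∀ {a w₁ w₂ x k} → c ~ a → OnlyNbr G a c → Fork G c a w₁ w₂ → Trail G a w₁ x w k → End c
    end-fork {a} {w₁} {w₂} c~a only f rest with cubic w₂ (Fork.v~w₂ f)
    ... | inj₂ (z , _ , f₂) = ⊥-elim (no-longer-trail (extend c~a (Fork.w₁≢u f) rest)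
      (extend (~-sym (Fork.v~w₁ f₂)) (Fork.w₁≢u f₂ ∘ sym) (extend (~-sym (Fork.v~w₂ f)) (Fork.w₁≢w₂ f) rest)))
    ... | inj₁ only₂ with caterpillar-branch (Fork.v~w₂ f) (Fork.w₁≢w₂ f ∘ sym) (Fork.v~w₁ f)
    ...   | t , b , cat = record { only = only ; endBranch = node c~a (fork-swap G f) (leaf (Fork.v~w₂ f) only₂) b ; caterpillar = node cat }

    end-from-trail : ∀ {a x k} → Trail G c a x w k → End c
    end-from-trail {a} trail with cubic c (~-sym (trail-first G trail))
    ... | inj₂ (z , _ , f) = ⊥-elim (no-longer-trail trail (extend (~-sym (Fork.v~w₁ f)) (Fork.w₁≢u f ∘ sym) trail))
    ... | inj₁ only with cubic a (trail-first G trail)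
    ...   | inj₁ only′ = record { only = only ; endBranch = leaf (trail-first G trail) only′ ; caterpillar = leaf }
    end-from-trail (single c~a) | inj₁ only | inj₂ (w₁ , w₂ , f) =
      ⊥-elim (no-longer-trail (single c~a) (extend c~a (Fork.w₁≢u f) (single (Fork.v~w₁ f))))
    end-from-trail (extend c~a w≢c rest) | inj₁ only | inj₂ (w₁ , w₂ , f) with Fork.nbrs⊆ f (trail-first G rest)
    ... | inj₁ w≡c         = contradiction w≡c w≢c
    ... | inj₂ (inj₁ refl) = end-fork c~a only f rest
    ... | inj₂ (inj₂ refl) = end-fork c~a only (fork-swap G f) rest

  eccentric-end : ∀ {c b} → b ≢ c → MaxEccentricity G c → End c
  eccentric-end {c} {b} b≢c maxEcc = from-farthest (c Finₚ.≟ w)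
    where
    w = argmax (dist G c) c (allFin n)
    w-max : ∀ v → dist G c v ≤ dist G c w
    w-max v = All.lookup (f[xs]≤f[argmax] c (allFin n)) (∈-allFin v)
    farthest : ∀ z v → dist G z v ≤ dist G c w
    farthest z v = ≤-trans (dist≤eccentricity z v) (≤-trans (maxEcc z) (eccentricity≤ w-max))
    from-farthest : Dec (c ≡ w) → End c
    from-farthest (no c≢w) = let _ , _ , _ , trail = trail-to c≢w in end-from-trail farthest trail
    from-farthest (yes c≡w) = let _ , _ , _ , trail = trail-to (b≢c ∘ sym) in
      contradiction (subst₂ _≤_ (trail-dist trail) (trans (cong (dist G c) (sym c≡w)) (dist-refl {c})) (w-max b)) λ ()

-- Identifying vertices of two trees

identification-swap : ∀ {k m n} {A : Graph k} {a} {B : Graph m} {b} {C : Graph n} →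
                      IsIdentification A a B b C → IsIdentification B b A a C
identification-swap I = record
  { ι = κ ; κ = ι ; ι-inj = κ-inj ; κ-inj = ι-inj ; cover = Sum.swap ∘ cover ; glue = sym glue
  ; meet = λ t s e → let s≡ , t≡ = meet s t (sym e) in t≡ , s≡
  ; edges = λ x y → mk⇔ (Sum.swap ∘ Equivalence.to (edges x y)) (Equivalence.from (edges x y) ∘ Sum.swap)
  }
  where open IsIdentification I

module IdentificationPart {k m n : ℕ} {A : Graph k} {a : Fin k} {B : Graph m} {b : Fin m} {C : Graph n}
                          (I : IsIdentification A a B b C) where
  open IsIdentification I
  private
    module A = Graph A
    module B = Graph B
    module C = Graph C

  edge⁺ : ∀ {s s′} → s A.~ s′ → ι s C.~ ι s′
  edge⁺ s~s′ = Equivalence.from (edges _ _) (inj₁ (_ , _ , refl , refl , s~s′))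

  edge⁻ : ∀ {s y} → s ≢ a → ι s C.~ y → ∃[ s′ ] (y ≡ ι s′ × s A.~ s′)
  edge⁻ s≢a e with Equivalence.to (edges _ _) e
  ... | inj₁ (s , s′ , ιs≡ , ιs′≡ , s~s′) = s′ , sym ιs′≡ , subst (A._~ s′) (ι-inj ιs≡) s~s′
  ... | inj₂ (t , _ , κt≡ , _ , _)        = contradiction (proj₁ (meet _ t (sym κt≡))) s≢a

  reach-glue : Connected A → ∀ s → Star C._~_ (ι s) (ι a)
  reach-glue conn s = Star.gmap ι edge⁺ (conn s a)

  -- The retraction of C onto A that collapses B to the glued vertex. It carries walks avoiding an
  -- edge of A to walks in A avoiding it, so bridges of A remain bridges.
  project : Fin n → Fin k
  project x with cover x
  ... | inj₁ (s , _) = s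
  ... | inj₂ _       = a

  project-ι : ∀ s → project (ι s) ≡ s
  project-ι s with cover (ι s)
  ... | inj₁ (s′ , e) = ι-inj e
  ... | inj₂ (t , e)  = sym (proj₁ (meet s t (sym e)))

  project-κ : ∀ t → project (κ t) ≡ a
  project-κ t with cover (κ t)
  ... | inj₁ (s , e) = proj₁ (meet s t e)
  ... | inj₂ _       = refl

  project-side : ∀ {s s′ x} → Side C (ι s) (ι s′) x → Side A s s′ (project x)
  project-side {s} {s′} = star-preserves (λ x → Side A s s′ (project x)) step (subst (Side A s s′) (sym (project-ι s′)) ε)
    where
    step : ∀ {x y} → Side A s s′ (project x) → OffEdge C (ι s) (ι s′) x y → Side A s s′ (project y)
    step {x} {y} p (x~y , ¬enter , ¬exit) with Equivalence.to (edges x y) x~y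
    ... | inj₁ (u , v , refl , refl , u~v) = subst (Side A s s′) (sym (project-ι v))
          (subst (Side A s s′) (project-ι u) p ◅◅ ((u~v , (λ { (refl , refl) → ¬enter (refl , refl) }) , (λ { (refl , refl) → ¬exit (refl , refl) })) ◅ ε))
    ... | inj₂ (u , v , refl , refl , u~v) = subst (Side A s s′) (trans (project-κ u) (sym (project-κ v))) p

  bridged-ι : Bridged A → ∀ {s s′} → s A.~ s′ → ¬ Side C (ι s) (ι s′) (ι s)
  bridged-ι bridged {s} {s′} s~s′ p = bridged s~s′ (subst (Side A s s′) (project-ι s) (project-side p))

  fork-ι : ∀ {u v w₁ w₂} → v ≢ a → Fork A u v w₁ w₂ → Fork C (ι u) (ι v) (ι w₁) (ι w₂)
  fork-ι v≢a f = record
    { v~w₁ = edge⁺ v~w₁ ; v~w₂ = edge⁺ v~w₂ ; w₁≢u = w₁≢u ∘ ι-inj ; w₂≢u = w₂≢u ∘ ι-inj ; w₁≢w₂ = w₁≢w₂ ∘ ι-inj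
    ; nbrs⊆ = λ e → let s′ , y≡ , v~s′ = edge⁻ v≢a e in
        Sum.map (λ e′ → trans y≡ (cong ι e′)) (Sum.map (λ e′ → trans y≡ (cong ι e′)) (λ e′ → trans y≡ (cong ι e′))) (nbrs⊆ v~s′)
    }
    where open Fork f

  onlyNbr-ι : ∀ {u v} → v ≢ a → OnlyNbr A u v → OnlyNbr C (ι u) (ι v)
  onlyNbr-ι v≢a only e = let s′ , y≡ , v~s′ = edge⁻ v≢a e in trans y≡ (cong ι (only v~s′))

  cubicAt-ι : ∀ {v} → v ≢ a → CubicAt A v → CubicAt C (ι v)
  cubicAt-ι {v} v≢a cubic e with edge⁻ v≢a (C.~-sym e)
  ... | u , refl , v~u with cubic (A.~-sym v~u)
  ...   | inj₁ only          = inj₁ (onlyNbr-ι v≢a only)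
  ...   | inj₂ (w₁ , w₂ , f) = inj₂ (ι w₁ , ι w₂ , fork-ι v≢a f)

  branch-ι : Connected A → Bridged A → ∀ {u v t} → Branch A u v t → ¬ Side A u v a → Branch C (ι u) (ι v) t
  branch-ι conn bridged {u} {v} br a∉ = go br a∉
    where
    open Sides A conn bridged
    go : ∀ {u v t} → Branch A u v t → ¬ Side A u v a → Branch C (ι u) (ι v) t
    go (leaf u~v only) a∉ = leaf (edge⁺ u~v) (onlyNbr-ι (λ { refl → a∉ ε }) only)
    go (node u~v f b₁ b₂) a∉ = node (edge⁺ u~v) (fork-ι (λ { refl → a∉ ε }) f)
      (go b₁ (a∉ ∘ side-child u~v v~w₁ w₁≢u)) (go b₂ (a∉ ∘ side-child u~v v~w₂ w₂≢u))
      where open Fork f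

identification-connected : ∀ {k m n} {A : Graph k} {a} {B : Graph m} {b} {C : Graph n} →
  IsIdentification A a B b C → Connected A → Connected B → Connected C
identification-connected {C = C} I connA connB u v = reach u ◅◅ Star.reverse ~-sym (reach v)
  where
  open Graph C
  open IsIdentification I
  reach : ∀ x → Star _~_ x (ι _)
  reach x with cover x
  ... | inj₁ (s , refl) = IdentificationPart.reach-glue I connA s
  ... | inj₂ (t , refl) = subst (Star _~_ (κ t)) (sym glue) (IdentificationPart.reach-glue (identification-swap I) connB t)

identification-bridged : ∀ {k m n} {A : Graph k} {a} {B : Graph m} {b} {C : Graph n} →
  IsIdentification A a B b C → Bridged A → Bridged B → Bridged C
identification-bridged I bridgedA bridgedB {u} {v} u~v with Equivalence.to (IsIdentification.edges I u v) u~v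
... | inj₁ (_ , _ , refl , refl , e) = IdentificationPart.bridged-ι I bridgedA e
... | inj₂ (_ , _ , refl , refl , e) = IdentificationPart.bridged-ι (identification-swap I) bridgedB e

-- Two neighbours from the root of A and one from the leaf b of B make the glued vertex cubic; the
-- fork is needed as seen from each of the three.
module GluedFork {k m n : ℕ} {A : Graph k} {a : Fin k} {B : Graph m} {b : Fin m} {C : Graph n}
                 (I : IsIdentification A a B b C) {w₁ w₂ : Fin k} {u : Fin m}
                 (root : RootFork A a w₁ w₂) (b~u : Graph._~_ B b u) (only : OnlyNbr B u b) where
  open IsIdentification I
  open RootFork root
  private
    module A = Graph A
    module B = Graph B
    module C = Graph C

  κ-edge : κ u C.~ ι a
  κ-edge = subst (κ u C.~_) (sym glue) (IdentificationPart.edge⁺ (identification-swap I) (B.~-sym b~u))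

  private
    ι≢κ : ∀ {w} → a A.~ w → ι w ≢ κ u
    ι≢κ a~w e = ~⇒≢ A a~w (sym (proj₁ (meet _ _ e)))

    glue-nbrs : ∀ {x} → ι a C.~ x → x ≡ κ u ⊎ x ≡ ι w₁ ⊎ x ≡ ι w₂
    glue-nbrs {x} e with Equivalence.to (edges (ι a) x) e
    ... | inj₁ (s , s′ , ιs≡ , ιs′≡ , s~s′) = inj₂ (Sum.map (λ e → trans (sym ιs′≡) (cong ι e)) (λ e → trans (sym ιs′≡) (cong ι e))
          (nbrs⊆ (subst (A._~ s′) (ι-inj ιs≡) s~s′)))
    ... | inj₂ (t , t′ , κt≡ , κt′≡ , t~t′) =
          inj₁ (trans (sym κt′≡) (cong κ (only (subst (B._~ t′) (κ-inj (trans κt≡ glue)) t~t′))))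

  fork-from-κ : Fork C (κ u) (ι a) (ι w₁) (ι w₂)
  fork-from-κ = record
    { v~w₁ = IdentificationPart.edge⁺ I r~w₁ ; v~w₂ = IdentificationPart.edge⁺ I r~w₂
    ; w₁≢u = ι≢κ r~w₁ ; w₂≢u = ι≢κ r~w₂ ; w₁≢w₂ = w₁≢w₂ ∘ ι-inj ; nbrs⊆ = glue-nbrs }

  fork-from-ι₁ : Fork C (ι w₁) (ι a) (κ u) (ι w₂)
  fork-from-ι₁ = record
    { v~w₁ = C.~-sym κ-edge ; v~w₂ = IdentificationPart.edge⁺ I r~w₂
    ; w₁≢u = ι≢κ r~w₁ ∘ sym ; w₂≢u = w₁≢w₂ ∘ sym ∘ ι-inj ; w₁≢w₂ = ι≢κ r~w₂ ∘ sym
    ; nbrs⊆ = λ e → [ inj₂ ∘ inj₁ , [ inj₁ , inj₂ ∘ inj₂ ]′ ]′ (glue-nbrs e) }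

  fork-from-ι₂ : Fork C (ι w₂) (ι a) (κ u) (ι w₁)
  fork-from-ι₂ = record
    { v~w₁ = C.~-sym κ-edge ; v~w₂ = IdentificationPart.edge⁺ I r~w₁
    ; w₁≢u = ι≢κ r~w₂ ∘ sym ; w₂≢u = w₁≢w₂ ∘ ι-inj ; w₁≢w₂ = ι≢κ r~w₁ ∘ sym
    ; nbrs⊆ = λ e → [ inj₂ ∘ inj₁ , [ inj₂ ∘ inj₂ , inj₁ ]′ ]′ (glue-nbrs e) }

  cubicAt-glue : CubicAt C (ι a)
  cubicAt-glue e with glue-nbrs (C.~-sym e)
  ... | inj₁ refl        = inj₂ (_ , _ , fork-from-κ)
  ... | inj₂ (inj₁ refl) = inj₂ (_ , _ , fork-from-ι₁)
  ... | inj₂ (inj₂ refl) = inj₂ (_ , _ , fork-from-ι₂)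

  cubic : (∀ s → s ≢ a → CubicAt A s) → (∀ t → CubicAt B t) → ∀ x → CubicAt C x
  cubic cubicA cubicB x with cover x
  ... | inj₁ (s , refl) with s Finₚ.≟ a
  ...   | yes refl = cubicAt-glue
  ...   | no s≢a   = IdentificationPart.cubicAt-ι I s≢a (cubicA s s≢a)
  cubic cubicA cubicB x | inj₂ (t , refl) with t Finₚ.≟ b
  ...   | yes refl = subst (CubicAt C) glue cubicAt-glue
  ...   | no t≢b   = IdentificationPart.cubicAt-ι (identification-swap I) t≢b (cubicB t)

-- Distances between vertex sets

module _ {n : ℕ} (G : Graph n) {X Y : Pred (Fin n) 0ℓ} (X? : Decidable₁ X) (Y? : Decidable₁ Y) where
  private
    xs = filter X? (allFin n)
    ys = filter Y? (allFin n)

  setDist-≤ : ∀ {k x y} → X x → Y y → Walk G k x y → setDist G X? Y? ≤ k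
  setDist-≤ {k} {x} {y} x∈ y∈ walk = ≤-trans
    (All.lookup (min≤xs n (map (uncurry (dist G)) (cartesianProduct xs ys)))
      (∈-map⁺ (uncurry (dist G)) (∈-cartesianProduct⁺ (∈-filter⁺ X? (∈-allFin x) x∈) (∈-filter⁺ Y? (∈-allFin y) y∈))))
    (dist-≤ G walk)

  setDist-≥ : ∀ {d} → d ≤ n → (∀ {k x y} → X x → Y y → Walk G k x y → d ≤ k) → d ≤ setDist G X? Y?
  setDist-≥ {d} d≤n bound = v≤min⁺ {xs = map (uncurry (dist G)) (cartesianProduct xs ys)} d≤n
    (Allₚ.map⁺ (All.tabulate λ {xy} xy∈ →
      let x∈ , y∈ = ∈-cartesianProduct⁻ xs ys xy∈ in
      dist-≥ G d≤n (bound (proj₂ (∈-filter⁻ X? {xs = allFin n} x∈)) (proj₂ (∈-filter⁻ Y? {xs = allFin n} y∈)))))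

module _ {n : ℕ} (G : Graph n) (v₀ : Fin n) where

  core-exists : ∃[ s ] IsCore G s
  core-exists = argmax (subtreeCount G) v₀ (allFin n) , λ u → All.lookup (f[xs]≤f[argmax] v₀ (allFin n)) (∈-allFin u)

  centroid-exists : ∃[ c ] IsCentroid G c
  centroid-exists = argmin (weight G) v₀ (allFin n) , λ u → All.lookup (f[argmin]≤f[xs] v₀ (allFin n)) (∈-allFin u)

-- The critical order as a bound on the core side

binaryTree-cubic : ∀ {n} (G : Graph n) → IsBinaryTree G → ∀ v → CubicAt G v
binaryTree-cubic G (_ , degrees) v with degree G v ≟ 1
... | yes one = degree⇒cubicAt G (inj₁ one)
... | no ¬one = degree⇒cubicAt G (inj₂ (degrees v ¬one))

odd-∤ : ∀ j → 2 ∤ suc (2 * j)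
odd-∤ j 2∣ with ∣1⇒≡1 (∣m+n∣m⇒∣n (subst (2 ∣_) (+-comm 1 (2 * j)) 2∣) (m∣m*n j))
... | ()

threshold : ∀ {n k s} j → n ≡ k + s → s ≡ suc (2 * j) → 3 * 2 ^ ((n ∸ k ∸ 1) / 2) ∸ 2 ≡ 3 * 2 ^ j ∸ 2
threshold {k = k} j refl refl = cong (λ e → 3 * 2 ^ e ∸ 2)
  (trans (cong (λ x → (x ∸ 1) / 2) (m+n∸m≡n k (suc (2 * j)))) (trans (cong (_/ 2) (*-comm 2 j)) (m*n/n≡m j 2)))

exceeds : ∀ {n t j m} s → n ≡ size t + size s → size s ≡ suc (2 * j) → 3 * 2 ^ j ≤ 2 + rootSubtrees s →
          size t ≡ suc (2 * suc m) → rootSubtrees s < rootSubtrees t → ExceedsThreshold n (suc (2 * suc m))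
exceeds {n} {t} {j} {m} s n≡ s≡ bound t≡ lt = heap , root , heap-rgood (s≤s z≤n) , (begin-strict
    3 * 2 ^ ((n ∸ suc (2 * suc m) ∸ 1) / 2) ∸ 2 ≡⟨ threshold j (trans n≡ (cong (_+ size s) t≡)) s≡ ⟩
    3 * 2 ^ j ∸ 2                               ≤⟨ ∸-monoˡ-≤ 2 bound ⟩
    rootSubtrees s                              <⟨ lt ⟩
    rootSubtrees t                              ≤⟨ rgood-maximal heap (λ ()) (heap-rgood (s≤s z≤n)) t≡ ⟩
    subtreeCount heap root                      ∎)
  where
  open Heap (suc m)
  open ≤-Reasoning

rootSubtrees>0 : ∀ t → 0 < rootSubtrees t
rootSubtrees>0 leaf       = s≤s z≤n
rootSubtrees>0 (node _ _) = s≤s z≤n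

critical-≤ : ∀ {n l} s t → IsCriticalOrder n l → n ≡ size t + size s → rootSubtrees s < rootSubtrees t → l ≤ size t
-- A leaf has one root subtree and s has at least one, so the strict inequality fails.
critical-≤ s leaf critical n≡ lt = contradiction (≤-trans (s≤s (rootSubtrees>0 s)) lt) (n≮n 1)
critical-≤ {n} {l} s t@(node t₁ t₂) (_ , minimal) n≡ lt = from-sizes (caterpillar-minimal s) (caterpillar-minimal t)
  where
  from-sizes : ∃[ j ] (size s ≡ suc (2 * j) × 3 * 2 ^ j ≤ 2 + rootSubtrees s) →
               ∃[ j ] (size t ≡ suc (2 * j) × 3 * 2 ^ j ≤ 2 + rootSubtrees t) → l ≤ size t
  from-sizes _ (zero , t≡ , _) = contradiction (suc-injective t≡) (m<n⇒n≢0 (≤-trans (size>0 t₁) (m≤m+n _ _)))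
    where
    size>0 : ∀ t → 0 < size t
    size>0 leaf       = s≤s z≤n
    size>0 (node _ _) = s≤s z≤n
  from-sizes (j , s≡ , bound) (suc m , t≡ , _) = subst (l ≤_) (sym t≡)
    (minimal _ (odd-∤ (suc m)) (exceeds {t = t} {j} {m} s n≡ s≡ bound t≡ lt))

-- A shortest walk from X to Y leaves X and enters Y at once.
closest-pair : ∀ {n} (G : Graph n) {X Y : Pred (Fin n) 0ℓ} → Decidable₁ X → Decidable₁ Y → ∀ {d α} →
  (∀ {k x y} → X x → Y y → Walk G k x y → d ≤ k) →
  (∀ {u v x y k} → X u → ¬ X v → ¬ Y x → Y y → Trail G u v x y k → suc k ≤ α) →
  ∀ {k x y} → X x → Y y → Walk G k x y → d ≤ α
closest-pair G {X} {Y} X? Y? {d} {α} below trail-bound {k} = go (<-wellFounded k)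
  where
  go : ∀ {k x y} → Acc _<_ k → X x → Y y → Walk G k x y → d ≤ α
  go {zero} _ x∈ y∈ walk = ≤-trans (below x∈ y∈ walk) z≤n
  go {suc k} (acc rec) x∈ y∈ walk with trail-or-shorter G k walk
  ... | inj₂ (m , m< , walk′) = go (rec m<) x∈ y∈ walk′
  ... | inj₁ (v , x , trail) with X? v | Y? x
  ...   | yes v∈ | _      = go (rec ≤-refl) v∈ y∈ (trail-tail G trail)
  ...   | no _   | yes x∈′ = go (rec ≤-refl) x∈ x∈′ (trail-init G trail)
  ...   | no v∉  | no x∉  = ≤-trans (below x∈ y∈ walk) (trail-bound x∈ v∉ x∉ y∈ trail)

-- The bound for an arbitrary binary tree

module BinaryTreeBound {n : ℕ} (T : Graph n) (binary : IsBinaryTree T) where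
  open Graph T

  private
    conn = proj₁ (proj₂ (proj₁ binary))
    bridged = acyclic⇒bridged T (proj₂ (proj₂ (proj₁ binary)))
  open BranchCounting T conn bridged
  open CubicTree T conn bridged (binaryTree-cubic T binary)

  core-enter : ∀ {x s} → x ~ s → IsCore T s → ¬ IsCore T x → branchCount T s x < branchCount T x s
  core-enter {x} {s} x~s core ¬core = ≰⇒> λ heavy →
    ¬core λ u → ≤-trans (core u) (subst₂ _≤_ (sym (subtreeCount-edge (~-sym x~s))) (sym (subtreeCount-edge x~s))
      (subst₂ _≤_ (sym (*-suc (branchCount T x s) _)) (sym (*-suc (branchCount T s x) _))
        (+-mono-≤ heavy (≤-reflexive (*-comm (branchCount T x s) _)))))

  critical-≤-side : ∀ {l x s} → IsCriticalOrder n l → x ~ s → IsCore T s → ¬ IsCore T x → l ≤ sideSize T x s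
  critical-≤-side {l} {x} {s} critical x~s core ¬core =
    let tB , bB = branch x~s
        tA , bA = branch (~-sym x~s)
    in subst (l ≤_) (sym (branch-size bB)) (critical-≤ tA tB critical
         (trans (sym (sideSize-complement x~s)) (cong₂ _+_ (branch-size bB) (branch-size bA)))
         (subst₂ _<_ (branch-count bA) (branch-count bB) (core-enter x~s core ¬core)))

  -- Here i counts the inner vertices of a trail from centroid to core, so the distance is i + 1;
  -- the crg tree enters only through the assumption on α.
  centroidCoreDist-bound : ∀ {l α} → IsCriticalOrder n l → (∀ i → 2 * (l + 2 * i) < n → suc i ≤ α) → centroidCoreDist T ≤ α
  centroidCoreDist-bound {l} {α} critical far =
    let v₀ = Data.Fin.fromℕ< (proj₁ (proj₁ binary))
        c , c-centroid = centroid-exists T v₀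
        s , s-core = core-exists T v₀
        k , walk = star⇒walk T (conn c s)
    in closest-pair T (centroid? T) (core? T) (setDist-≤ T (centroid? T) (core? T)) trail-bound c-centroid s-core walk
    where
    open ≤-Reasoning
    trail-bound : ∀ {c v x s k} → IsCentroid T c → ¬ IsCentroid T v → ¬ IsCore T x → IsCore T s → Trail T c v x s k → suc k ≤ α
    trail-bound {c} {v} {x} {s} {k} c-centroid ¬centroid ¬core s-core trail = far k (begin-strict
      2 * (l + 2 * k)                   ≤⟨ *-monoʳ-≤ 2 (+-monoˡ-≤ (2 * k) (critical-≤-side critical (trail-last T trail) s-core ¬core)) ⟩
      2 * (sideSize T x s + 2 * k)      ≤⟨ *-monoʳ-≤ 2 (trail-sideSize-cubic trail) ⟩
      2 * sideSize T c v                ≡⟨ cong (sideSize T c v +_) (+-identityʳ _) ⟩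
      sideSize T c v + sideSize T c v   <⟨ +-monoʳ-< (sideSize T c v) (centroid-leave (trail-first T trail) c-centroid ¬centroid) ⟩
      sideSize T c v + sideSize T v c   ≡⟨ sideSize-complement (trail-first T trail) ⟩
      n                                 ∎)

-- The distance in the crg tree

-- A binary tree hung up at an edge whose far side is a caterpillar with fewer root subtrees
-- than the near side, which has l vertices.
record Hanging {n : ℕ} (l : ℕ) (C : Graph n) : Set where
  field
    connected   : Connected C
    bridged     : Bridged C
    cubic       : ∀ x → CubicAt C x
    {g u}       : Fin n
    {tail body} : BT
    tail-branch : Branch C g u tail
    body-branch : Branch C u g body
    caterpillar : Caterpillar tail
    tail-size   : l + size tail ≡ n
    lighter     : rootSubtrees tail < rootSubtrees body

module HangingBound {n l : ℕ} {C : Graph n} (hanging : Hanging l C) where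
  open Graph C
  open Hanging hanging
  open BranchCounting C connected bridged
  open CubicTree C connected bridged cubic

  core-inward : ∀ {y} → IsCore C y → ¬ Side C g u y
  core-inward core y∈ = <⇒≱ (subtreeCount-side (branch-~ C tail-branch)
    (subst₂ _<_ (sym (branch-count tail-branch)) (sym (branch-count body-branch)) lighter) y∈) (core g)

  far : ∀ i → 2 * (l + 2 * i) < n → suc i ≤ centroidCoreDist C
  far i short = from-trail (caterpillar-trail i tail-branch caterpillar long)
    where
    open ≤-Reasoning
    long : 2 * i < size tail
    long = +-cancelˡ-< l _ _ (begin-strict
      l + 2 * i        ≤⟨ m≤m+n _ _ ⟩
      2 * (l + 2 * i)  <⟨ short ⟩
      n                ≡⟨ tail-size ⟨
      l + size tail    ∎)
    i<n : suc i ≤ n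
    i<n = ≤-trans (s≤s (≤-trans (m≤m+n i _) (≤-trans (m≤n+m (2 * i) l) (m≤m+n _ _)))) short
    near : ∀ {x y} → x ~ y → sideSize C x y + 2 * i ≡ size tail → sideSize C y x ≡ l + 2 * i
    near {x} {y} x~y size≡ = +-cancelˡ-≡ (sideSize C x y) _ _ (begin-equality
      sideSize C x y + sideSize C y x   ≡⟨ sideSize-complement x~y ⟩
      n                                 ≡⟨ tail-size ⟨
      l + size tail                     ≡⟨ cong (l +_) size≡ ⟨
      l + (sideSize C x y + 2 * i)      ≡⟨ e l (sideSize C x y) i ⟩
      sideSize C x y + (l + 2 * i)      ∎)
      where
      e : ∀ l s i → l + (s + 2 * i) ≡ s + (l + 2 * i)
      e = solve-∀
    near<far : ∀ {x y} → x ~ y → sideSize C x y + 2 * i ≡ size tail → sideSize C y x < sideSize C x y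
    near<far {x} {y} x~y size≡ = +-cancelʳ-< (sideSize C y x) _ _ (begin-strict
      sideSize C y x + sideSize C y x  ≡⟨ cong₂ _+_ (near x~y size≡) (near x~y size≡) ⟩
      (l + 2 * i) + (l + 2 * i)        ≡⟨ cong ((l + 2 * i) +_) (+-identityʳ _) ⟨
      2 * (l + 2 * i)                  <⟨ short ⟩
      n                                ≡⟨ sideSize-complement x~y ⟨
      sideSize C x y + sideSize C y x  ∎)
    from-trail : ∃[ x ] ∃[ y ] (Trail C g u x y i × sideSize C x y + 2 * i ≡ size tail) → suc i ≤ centroidCoreDist C
    -- The last edge of the trail has more than half of the vertices beyond it, hence the centroid,
    -- while the core stays before the first edge. So a walk between them crosses all i + 1 edges.
    from-trail (x , y , trail , size≡) = setDist-≥ C (centroid? C) (core? C) i<n λ {k} z-centroid y-core walk →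
      trail-length trail (centroid-side (trail-last C trail) (near<far (trail-last C trail) size≡) z-centroid)
        (core-inward y-core) walk

exceeds⇒lighter : ∀ {n l s} → l ≢ 1 → l + size s ≡ n → Caterpillar s → ExceedsThreshold n l →
                  ∃[ t ] (size t ≡ l × rootSubtrees s < rootSubtrees t)
exceeds⇒lighter {n} {l} {s} l≢1 size≡ cat (R , r , rgood , exceeds) =
  proj₁ rooted-shape , sym (shape-size (proj₂ rooted-shape)) , bound (caterpillar-value cat)
  where
  open RootedTree R r (proj₁ (proj₁ rgood)) l≢1 (proj₁ rgood)
  open ≤-Reasoning
  bound : ∃[ j ] (size s ≡ suc (2 * j) × 2 + rootSubtrees s ≡ 3 * 2 ^ j) → rootSubtrees s < rootSubtrees (proj₁ rooted-shape)
  bound (j , s≡ , value≡) = begin-strict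
    rootSubtrees s                         ≡⟨ m+n∸m≡n 2 (rootSubtrees s) ⟨
    2 + rootSubtrees s ∸ 2                 ≡⟨ cong (_∸ 2) value≡ ⟩
    3 * 2 ^ j ∸ 2                          ≡⟨ threshold j (sym size≡) s≡ ⟨
    3 * 2 ^ ((n ∸ l ∸ 1) / 2) ∸ 2          <⟨ exceeds ⟩
    subtreeCount R r                       ≡⟨ shape-count (proj₂ rooted-shape) ⟩
    rootSubtrees (proj₁ rooted-shape)      ∎

nontrivial : ∀ {N} → 1 < N → (c : Fin N) → ∃[ b ] b ≢ c
nontrivial {suc (suc N)} _ Fin.zero    = Fin.suc Fin.zero , λ ()
nontrivial {suc (suc N)} _ (Fin.suc c) = Fin.zero , λ ()
nontrivial {suc zero} (s≤s ()) _

caterpillar-end : ∀ {N} (K : Graph N) {c} (caterpillar : IsBinaryCaterpillar K) → 1 < N → MaxEccentricity K c →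
  ∃[ a ] ∃[ s ] (OnlyNbr K a c × Branch K c a s × Caterpillar s × size s + 1 ≡ N)
caterpillar-end K {c} (binary , p , path , dominates) 1<N maxEcc =
  nbr , shape , only , endBranch , caterpillar ,
  trans (cong₂ _+_ (sym (branch-size endBranch)) (sym (sideSize-leaf (Graph.~-sym K c~nbr) only))) (sideSize-complement c~nbr)
  where
  conn = proj₁ (proj₂ (proj₁ binary))
  bridged = acyclic⇒bridged K (proj₂ (proj₂ (proj₁ binary)))
  open BranchCounting K conn bridged
  open CaterpillarTree K conn bridged (binaryTree-cubic K binary) p path dominates
  open End (eccentric-end (proj₂ (nontrivial 1<N c)) maxEcc)
  c~nbr : Graph._~_ K c nbr
  c~nbr = branch-~ K endBranch

glued-hanging : ∀ {n l N} {C : Graph n} {R : Graph l} {r} {K : Graph N} {c} → IsIdentification R r K c C →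
  (rgood : IsRgood R r) → l ≢ 1 → IsBinaryTree K → ∀ {a s} → OnlyNbr K a c → Branch K c a s → Caterpillar s →
  l + size s ≡ n → ∃[ t ] (size t ≡ l × rootSubtrees s < rootSubtrees t) → Hanging l C
glued-hanging {C = C} {R} {r} {K} {c} I rgood l≢1 binaryK only branch cat size≡ (t , t≡ , lt) = record
  { connected   = identification-connected I connR connK
  ; bridged     = identification-bridged I bridgedR bridgedK
  ; cubic       = cubic (λ _ → cubicAt) (binaryTree-cubic K binaryK)
  ; tail-branch = subst (λ x → Branch C x _ _) (sym glue)
                    (IdentificationPart.branch-ι (identification-swap I) connK bridgedK branch (bridgedK (branch-~ K branch)))
  ; body-branch = node κ-edge fork-from-κ
                    (IdentificationPart.branch-ι I connR bridgedR branch₁ (bridgedR (RootFork.r~w₁ fork)))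
                    (IdentificationPart.branch-ι I connR bridgedR branch₂ (bridgedR (RootFork.r~w₂ fork)))
  ; caterpillar = cat
  ; tail-size   = size≡
  -- The shape t comes from the rgood graph that witnesses the threshold; maximality of the graph R
  -- glued into C transfers the inequality.
  ; lighter     = <-≤-trans lt (≤-trans (rgood-maximal R l≢1 rgood t≡)
                    (≤-reflexive (trans (shape-count (proj₂ rooted-shape)) (cong rootSubtrees shape≡))))
  }
  where
  connR = proj₁ (proj₂ (proj₁ (proj₁ rgood)))
  bridgedR = acyclic⇒bridged R (proj₂ (proj₂ (proj₁ (proj₁ rgood))))
  connK = proj₁ (proj₂ (proj₁ binaryK))
  bridgedK = acyclic⇒bridged K (proj₂ (proj₂ (proj₁ binaryK)))
  open IsIdentification I
  open RootedTree R r (proj₁ (proj₁ rgood)) l≢1 (proj₁ rgood)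
  open RootedShape (proj₂ rooted-shape)
  open GluedFork I fork (branch-~ K branch) only

crg-hanging : ∀ {n l} {C : Graph n} → IsCriticalOrder n l → IsCrgTree n l C → Hanging l C
crg-hanging {n} {l} ((_ , exceeds) , _) (_ , _ , _ , 3≤l , l<n , R , r , K , c , rgood , caterpillar , maxEcc , I) =
  let a , s , only , branch , cat , size≡ = caterpillar-end K caterpillar (+-monoˡ-≤ 1 (m<n⇒0<n∸m l<n)) maxEcc
      total = trans (cong (l +_) (+-cancelʳ-≡ 1 (size s) (n ∸ l) size≡)) (m+[n∸m]≡n (<⇒≤ l<n))
  in glued-hanging I rgood l≢1 (proj₁ caterpillar) only branch cat total (exceeds⇒lighter l≢1 total cat exceeds)
  where
  l≢1 : l ≢ 1
  l≢1 refl = contradiction 3≤l λ { (s≤s ()) }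

≤⇒≤-if : ∀ {d} α → d ≤ α → d ≤ (if 1 ≤ᵇ α then α else 1)
≤⇒≤-if zero    d≤0 = ≤-trans d≤0 z≤n
≤⇒≤-if (suc α) d≤α = d≤α

theorem3p12 : ∀ (n : ℕ) (T : Graph n) → 12 ≤ n → IsBinaryTree T →
    ∀ (l : ℕ) → IsCriticalOrder n l →
    ∀ (C : Graph n) → IsCrgTree n l C →
    let α = centroidCoreDist C in
    centroidCoreDist T ≤ (if 1 ≤ᵇ α then α else 1)
theorem3p12 n T _ binary l critical C crg = ≤⇒≤-if (centroidCoreDist C)
  (BinaryTreeBound.centroidCoreDist-bound T binary critical (HangingBound.far (crg-hanging critical crg)))
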